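{- Let $Q$ and $k$ be integers $\ge 1$ and let $I$ be an interval in $\mathbf{Z}$ of length $N$. When $\mathcal{F}(Q)$ is the Farey sequence of order $Q$ and $P(T) = c_0T^k + c_1T^{k-1} + \ldots + c_k$ is a polynomial of degree $k$ in $\mathbf{Z}[T]$, we have the inequality $$\sum_{x \in \mathcal{F}(Q)} \left| \sum_{i \in I} a_i\, e(xP(i)) \right|^2 \;\ll\; Q(N+Q)(\log Q)^{\omega(c_0) + \theta(k)} \, \|a\|^2$$ for every sequence of complex numbers $\{a_i\}_{i \in I}$, where the constant implicit in the $\ll$ depends only on $k$.
   Context: Notation: $e(z) = e^{2\pi i z}$. $\mathcal{F}(Q)$, the Farey sequence of order $Q$, is the set of rationals $p/q$ with $1 \le q \le Q$, $0 \le p \le q-1$ and $\gcd(p,q) = 1$. $\omega(n)$ is the number of prime divisors of $n$. $\theta(k) = k\binom{k+1}{2}$. $\|a\|^2 = \sum_{i \in I} |a_i|^2$. An interval in $\mathbf{Z}$ of length $N$ is a set of $N$ consecutive integers. $A \ll B$ means $|A| \le C B$ for some constant $C > 0$ (the implicit constant).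
   Formalization: The inequality is stated for Q ≥ 3 instead of Q ≥ 1: for Q = 1 the right side is 0 since log 1 = 0, and for Q = 2 it tends to 0 as ω(c₀) grows because log 2 < 1, while the left side can stay at 2. -}

module Defs where

open import Algebra.Apartness.Bundles using (HeytingField)
open import Algebra.Bundles using (CommutativeRing; Semiring)
open import Algebra.Bundles.Raw using (RawSemiring)
import Algebra.Definitions.RawSemiring as RawSemiringDefs
import Algebra.Apartness.Properties.HeytingCommutativeRing as HeytingProperties
import Algebra.Properties.Ring as RingProperties
open import Data.Fin.Base using (toℕ)
open import Data.Integer.Base as ℤ using (ℤ; +_; -[1+_])
open import Data.List.Base as List using (List; upTo; filter; concatMap)
open import Data.Nat.Base as ℕ using (ℕ; suc; NonZero; _!)
open import Data.Nat.Combinatorics using (_C_)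
open import Data.Nat.Divisibility using (_∣?_)
open import Data.Nat.GCD using (gcd)
open import Data.Nat.Primality using (prime?)
open import Data.Nat.Properties using (_!≢0) renaming (_≟_ to _≟ℕ_)
open import Data.Product.Base using (_×_; _,_; ∃-syntax; proj₁; proj₂)
open import Data.Rational.Base as ℚ using (ℚ)
open import Data.Sum.Base using (_⊎_; inj₁; inj₂)
open import Data.Vec.Functional using (Vector)
open import Function.Bundles using (_⇔_; Equivalence)
open import Level using (Level; _⊔_) renaming (suc to lsuc)
open import Relation.Binary.Core using (Rel)
open import Relation.Binary.Structures using (IsStrictPartialOrder)
open import Relation.Nullary using (¬_)
open import Relation.Nullary.Decidable using (_×-dec_)

-- Enumerated through the unique reduced fraction p / q of each element,
-- so no rational occurs twice.
ℱ : ℕ → List ℚ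
ℱ Q = concatMap reducedWithDenominator (upTo Q)
  where
  reducedWithDenominator : ℕ → List ℚ
  reducedWithDenominator q-1 =
    List.map (λ p → + p ℚ./ suc q-1)
             (filter (λ p → gcd p (suc q-1) ≟ℕ 1) (upTo (suc q-1)))

-- Meaningful for n ≥ 1 only: every prime divides 0.
ω : ℕ → ℕ
ω n = List.length (filter (λ p → prime? p ×-dec p ∣? n) (upTo (suc n)))

θ : ℕ → ℕ
θ k = k ℕ.* (suc k C 2)

-- Coefficients are listed from the leading one down:
-- c₀ Tᵏ + c₁ Tᵏ⁻¹ + … + c_k.
evalPoly : {k : ℕ} → Vector ℤ (suc k) → ℤ → ℤ
evalPoly {k} c t = sum (λ j → c j ℤ.* t ℤ.^ (k ℕ.∸ toℕ j))
  where
  open RawSemiringDefs ℤ.+-*-rawSemiring using (sum)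

-- The real numbers, up to isomorphism: a Cauchy complete Archimedean
-- ordered field.  The axioms are the constructive ones, in which x ≤ y is
-- ¬ (y < x) and totality of the order is not assumed.
record RealField (c ℓ₁ ℓ₂ : Level) : Set (lsuc (c ⊔ ℓ₁ ⊔ ℓ₂)) where
  infix 4 _<_ _≤_ ∣_∣≤_
  field
    heytingField : HeytingField c ℓ₁ ℓ₂

  open HeytingField heytingField public renaming (Carrier to ℝ)

  commutativeRing : CommutativeRing c ℓ₁
  commutativeRing = record { isCommutativeRing = isCommutativeRing }

  open RawSemiringDefs (Semiring.rawSemiring (CommutativeRing.semiring commutativeRing)) public
    using (sum; _^_) renaming (_×_ to _·_)

  fromℕ : ℕ → ℝ
  fromℕ n = n · 1#

  field
    _<_                  : Rel ℝ ℓ₂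
    isStrictPartialOrder : IsStrictPartialOrder _≈_ _<_
    #⇔<⊎>                : ∀ {x y} → x # y ⇔ (x < y ⊎ y < x)
    +-monoˡ-<            : ∀ {x y} z → x < y → x + z < y + z
    *-pos                : ∀ {x y} → 0# < x → 0# < y → 0# < x * y

  _≤_ : Rel ℝ ℓ₂
  x ≤ y = ¬ (y < x)

  -- |x| ≤ y, with no absolute value function needed on ℝ.
  ∣_∣≤_ : Rel ℝ ℓ₂
  ∣ x ∣≤ y = x ≤ y × - x ≤ y

  Cauchy : (ℕ → ℝ) → Set (c ⊔ ℓ₂)
  Cauchy u = ∀ ε → 0# < ε → ∃[ M ] (∀ m n → M ℕ.≤ m → M ℕ.≤ n → ∣ u m - u n ∣≤ ε)

  Limit : (ℕ → ℝ) → ℝ → Set (c ⊔ ℓ₂)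
  Limit u l = ∀ ε → 0# < ε → ∃[ M ] (∀ n → M ℕ.≤ n → ∣ u n - l ∣≤ ε)

  field
    archimedean : ∀ x → ∃[ n ] x < fromℕ n
    complete    : ∀ u → Cauchy u → ∃[ l ] Limit u l

  private
    module < = IsStrictPartialOrder isStrictPartialOrder
    open RingProperties (CommutativeRing.ring commutativeRing)
      using (-‿distribˡ-*; -‿distribʳ-*; -‿involutive)
    open HeytingProperties (HeytingField.heytingCommutativeRing heytingField)
      using (1#0)

    0<1 : 0# < 1#
    0<1 with Equivalence.to #⇔<⊎> 1#0
    ... | inj₂ 0<1 = 0<1
    ... | inj₁ 1<0 = <.<-respʳ-≈ -1*-1≈1 (*-pos 0<-1 0<-1)
      where
      0<-1 : 0# < - 1#
      0<-1 = <.<-respʳ-≈ (+-identityˡ (- 1#))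
               (<.<-respˡ-≈ (-‿inverseʳ 1#) (+-monoˡ-< (- 1#) 1<0))

      -1*-1≈1 : - 1# * - 1# ≈ 1#
      -1*-1≈1 = trans (sym (-‿distribˡ-* 1# (- 1#)))
                  (trans (-‿cong (*-identityˡ (- 1#))) (-‿involutive 1#))

  fromℕ-pos : ∀ n .{{_ : NonZero n}} → 0# < fromℕ n
  fromℕ-pos 1                 = <.<-respʳ-≈ (sym (+-identityʳ 1#)) 0<1
  fromℕ-pos (suc n@(suc _)) =
    <.trans (fromℕ-pos n)
      (<.<-respˡ-≈ (+-identityˡ (fromℕ n)) (+-monoˡ-< (fromℕ n) 0<1))

  -- #⇒invertible inverts n - 0#, which is n.
  1/_ : ∀ n .{{_ : NonZero n}} → ℝ
  1/ n = proj₁ (#⇒invertible (Equivalence.from #⇔<⊎> (inj₂ (fromℕ-pos n))))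

  fromℤ : ℤ → ℝ
  fromℤ (+ n)    = fromℕ n
  fromℤ -[1+ n ] = - fromℕ (suc n)

  fromℚ : ℚ → ℝ
  fromℚ x = fromℤ (ℚ.↥ x) * 1/ (ℚ.↧ₙ x)

module Complex {c ℓ₁ ℓ₂ : Level} (R : RealField c ℓ₁ ℓ₂) where
  open RealField R

  infix 5 _+i_
  record ℂ : Set c where
    constructor _+i_
    field
      re im : ℝ

  open ℂ public

  ℂ-rawSemiring : RawSemiring c ℓ₁
  ℂ-rawSemiring = record
    { Carrier = ℂ
    ; _≈_     = λ w z → re w ≈ re z × im w ≈ im z
    ; _+_     = λ w z → re w + re z +i im w + im z
    ; _*_     = λ w z → re w * re z - im w * im z +i re w * im z + im w * re z
    ; 0#      = 0# +i 0#
    ; 1#      = 1# +i 0#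
    }

  open RawSemiring ℂ-rawSemiring public
    using ()
    renaming (_≈_ to _≈ℂ_; _+_ to _+ℂ_; _*_ to _*ℂ_; 0# to 0ℂ; 1# to 1ℂ)
  open RawSemiringDefs ℂ-rawSemiring public
    using () renaming (sum to sumℂ; _^_ to _^ℂ_)

  ofReal : ℝ → ℂ
  ofReal x = x +i 0#

  ∣_∣² : ℂ → ℝ
  ∣ z ∣² = re z * re z + im z * im z

  ‖_‖² : {N : ℕ} → Vector ℂ N → ℝ
  ‖ a ‖² = sum (λ i → ∣ a i ∣²)

  _-ℂ_ : ℂ → ℂ → ℂ
  w -ℂ z = re w - re z +i im w - im z

  Limitℂ : (ℕ → ℂ) → ℂ → Set (c ⊔ ℓ₂)
  Limitℂ u l = ∀ ε → 0# < ε → ∃[ M ] (∀ n → M ℕ.≤ n → ∣ u n -ℂ l ∣² ≤ ε * ε)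

  expTerm : ℂ → ℕ → ℂ
  expTerm z n = ofReal (1/_ (n !) {{n !≢0}}) *ℂ z ^ℂ n

-- Each component is determined up to ≈ by its specification, so this is
-- not extra structure on R but the names of three definite objects.
record ElementaryFunctions {c ℓ₁ ℓ₂ : Level} (R : RealField c ℓ₁ ℓ₂)
       : Set (c ⊔ ℓ₁ ⊔ ℓ₂) where
  open RealField R
  open Complex R

  field
    exp        : ℂ → ℂ
    exp-series : ∀ z → Limitℂ (λ n → sumℂ {n} (λ j → expTerm z (toℕ j))) (exp z)

  sin : ℝ → ℝ
  sin t = im (exp (0# +i t))

  -- π is the least positive zero of sin.
  field
    π       : ℝ
    π-pos   : 0# < π
    sin-π   : sin π ≈ 0#
    π-least : ∀ t → 0# < t → t < π → ¬ (sin t ≈ 0#)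

  -- Not total: constructively log does not extend to all of ℝ.
  field
    log     : ∀ x → 0# < x → ℝ
    exp-log : ∀ x (0<x : 0# < x) → exp (ofReal (log x 0<x)) ≈ℂ ofReal x

  logℕ : ∀ n .{{_ : NonZero n}} → ℝ
  logℕ n = log (fromℕ n) (fromℕ-pos n)

  e : ℝ → ℂ
  e t = exp (0# +i fromℕ 2 * π * t)

  -- The interval is {m, m+1, …, m+N-1}, and a j is the coefficient
  -- attached to the integer m + j.
  exponentialSum : {k N : ℕ} → Vector ℤ (suc k) → ℤ → Vector ℂ N → ℚ → ℂ
  exponentialSum c m a x =
    sumℂ (λ j → a j *ℂ e (fromℚ x * fromℤ (evalPoly c (m ℤ.+ + toℕ j))))

  fareySum : ℕ → (ℚ → ℝ) → ℝ
  fareySum Q f = List.foldr _+_ 0# (List.map f (ℱ Q))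

{-# OPTIONS --safe #-}
-- For a fixed denominator q, extend the sum to all numerators modulo q and open
-- the square: orthogonality of the additive characters bounds it by q ‖a‖² times
-- the largest number of i ∈ I with P(i) ≡ r (mod q).  If pʲ exactly divides q
-- and p ∤ c₀, the roots of P - r modulo pʲ lie in at most k classes modulo
-- p^⌈j/k⌉, so that number is at most k^s (N / D + 1), where s is the number of
-- these primes and D = D(q) is the product of the p^⌈j/k⌉.  As D divides q, this
-- leaves the sum of k^s / D(q) over q ≤ Q to be bounded.  Peeling off the primes
-- in increasing order, it is at most
--   (∑_{n ≤ Q} 1/n)^(k²) · ∏_{p ∣ c₀, p ≤ Q} (1 + ⌊log_p Q⌋),
-- each p ∤ c₀ being absorbed by (x + y)^(k²) ≥ x^(k²) + k² x^(k² - 1) y, applied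
-- to the splitting of the harmonic sum into the terms with p ∤ n and p ∣ n.
-- Every factor is a bounded multiple of log Q, and at most log Q for p ≥ 9;
-- finally k² ≤ θ(k).
--
-- The characters are understood through the functional equation of exp and the
-- minimality of π.
module Submission where

open import Defs
open import Algebra.Bundles using (CommutativeRing; Semiring)
import Algebra.Definitions.RawSemiring as RawSemiringDefs
import Algebra.Properties.AbelianGroup as AbelianGroupProperties
import Algebra.Properties.CommutativeMonoid.Sum as MonoidSum
import Algebra.Properties.CommutativeSemiring.Binomial as Binomial
import Algebra.Properties.CommutativeSemiring.Exp as Exp
import Algebra.Properties.Ring as RingProperties
import Algebra.Properties.Semiring.Mult as SemiringMult
import Algebra.Properties.Semiring.Sum as SemiringSum
import Algebra.Solver.Ring as RingSolver
open import Algebra.Solver.Ring.AlmostCommutativeRing using (fromCommutativeRing; _-Raw-AlmostCommutative⟶_)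
open import Data.Empty using (⊥; ⊥-elim)
open import Data.Fin.Base as Fin using (Fin; zero; suc; toℕ)
import Data.Fin.Properties as FinP
open import Data.Integer.Base as ℤ using (ℤ; +_; -[1+_]; 0ℤ; 1ℤ; ∣_∣)
import Data.Integer.DivMod as ℤD
import Data.Integer.Divisibility as ℤ∣
import Data.Integer.Divisibility.Signed as Signed
import Data.Integer.GCD as ℤG
import Data.Integer.Properties as ℤP
open import Data.Integer.Solver using (module +-*-Solver)
open import Data.List.Base as List using (List; []; _∷_; _++_; length; filter; upTo)
open import Data.List.Membership.Propositional using (_∈_)
open import Data.List.Membership.Propositional.Properties using (∈-filter⁺; ∈-filter⁻; ∈-++⁺ˡ; ∈-++⁺ʳ)
import Data.List.Properties as ListP
open import Data.List.Relation.Unary.Any using (here; there)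
open import Data.Maybe.Base using (just; nothing)
open import Data.Nat.Base as ℕ using (ℕ; zero; suc; NonZero; z≤n; s≤s; _∸_; _!)
open import Data.Nat.Combinatorics using (_C_; nC1≡n; nCk+nC[k+1]≡[n+1]C[k+1]; nCk≡n!/k![n-k]!; k![n∸k]!∣n!)
open import Data.Nat.Coprimality using (prime⇒coprime; coprime-divisor) renaming (sym to coprime-sym)
open import Data.Nat.DivMod as ℕD using (_/_; _%_; m/n*n≡m)
open import Data.Nat.Divisibility as ℕ∣ using (_∣?_; divides; hasNonTrivialDivisor)
open import Data.Nat.GCD using (gcd)
open import Data.Nat.Primality
import Data.Nat.Properties as ℕP
open import Data.Product.Base using (_×_; _,_; ∃-syntax; proj₁; proj₂)
open import Data.Rational.Base as ℚ using (ℚ)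
import Data.Rational.Properties as ℚP
open import Data.Sign.Base as Sign using (Sign)
open import Data.Sum.Base using (_⊎_; inj₁; inj₂)
open import Data.Vec.Functional using (Vector; head; tail)
open import Function.Base using (_∘_)
open import Function.Bundles using (Equivalence)
open import Level using (Level)
import Relation.Binary.Reasoning.Base.Triple as TripleReasoning
import Relation.Binary.Reasoning.Setoid as SetoidReasoning
open import Relation.Binary.PropositionalEquality as ≡ using (_≡_; _≢_; cong; cong₂; subst)
open import Relation.Binary.Structures using (IsPreorder; IsStrictPartialOrder)
open import Relation.Nullary using (¬_; Dec; yes; no)
open import Relation.Nullary.Decidable using (_×-dec_; ¬?)
open import Relation.Unary using (Decidable; Pred)

-- The condition q ≤ Q ties the prime powers of q together, so the sum over q is not an Euler
-- product. The induction therefore carries a free cutoff `X` and compares the sum with a power of a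
-- harmonic sum over the same rough numbers: both split in the same way at `p`.
--
-- At a prime not dividing c₀, the k exponents j with a common ⌈j/k⌉ form a block; each of them
-- costs k classes, and this is the origin of k². At a prime dividing c₀ the congruence gives no
-- saving, so the price is the number of possible exponents. Only the finitely many p < 9 need a
-- constant in front of log Q, which makes the final constant independent of c₀.
--
-- The order is constructive: x ≤ y is a negated strict inequality. Proofs of ≤ and ≈ may argue by
-- cases, while the sign of an inverse has to be extracted from apartness. The logarithm enters the
-- estimates through a single fact, that 3ⁿ ≤ Q implies n ≤ log Q, which rests on exp 1 ≤ 3;
-- everything else is phrased with integer exponents. Hence the constants 3, 4 and 9.

-- Integers in a commutative ring, and a ring solver with integer coefficients.

module IntegerCoefficients {c ℓ} (R : CommutativeRing c ℓ) where
  open CommutativeRing R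
  open RingProperties ring using (-0#≈0#; -‿distribˡ-*; -‿distribʳ-*; -‿involutive)
  open AbelianGroupProperties +-abelianGroup using (⁻¹-∙-comm)
  open SemiringMult semiring using (×-homo-+; ×1-homo-*) renaming (_×_ to _·_)
  open SetoidReasoning setoid

  ⟦_⟧ : ℤ → Carrier
  ⟦ + n ⟧      = n · 1#
  ⟦ -[1+ n ] ⟧ = - (suc n · 1#)

  private
    cancel : ∀ x y z → (x + y) - (x + z) ≈ y - z
    cancel x y z = begin
      (x + y) - (x + z)       ≈⟨ +-congˡ (⁻¹-∙-comm x z) ⟨
      (x + y) + (- x + - z)   ≈⟨ +-congʳ (+-comm x y) ⟩
      (y + x) + (- x + - z)   ≈⟨ +-assoc y x _ ⟩
      y + (x + (- x + - z))   ≈⟨ +-congˡ (+-assoc x (- x) (- z)) ⟨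
      y + ((x - x) + - z)     ≈⟨ +-congˡ (+-congʳ (-‿inverseʳ x)) ⟩
      y + (0# + - z)          ≈⟨ +-congˡ (+-identityˡ (- z)) ⟩
      y - z                   ∎

  ⊖-homo : ∀ m n → ⟦ m ℤ.⊖ n ⟧ ≈ m · 1# - n · 1#
  ⊖-homo m zero = sym (trans (+-congˡ -0#≈0#) (+-identityʳ _))
  ⊖-homo zero (suc n) = sym (+-identityˡ _)
  ⊖-homo (suc m) (suc n) = begin
    ⟦ suc m ℤ.⊖ suc n ⟧       ≡⟨ ≡.cong ⟦_⟧ (ℤP.[1+m]⊖[1+n]≡m⊖n m n) ⟩
    ⟦ m ℤ.⊖ n ⟧               ≈⟨ ⊖-homo m n ⟩
    m · 1# - n · 1#           ≈⟨ cancel 1# (m · 1#) (n · 1#) ⟨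
    suc m · 1# - suc n · 1#   ∎

  ⟦⟧-+ : ∀ i j → ⟦ i ℤ.+ j ⟧ ≈ ⟦ i ⟧ + ⟦ j ⟧
  ⟦⟧-+ (+ m) (+ n) = ×-homo-+ 1# m n
  ⟦⟧-+ (+ m) -[1+ n ] = ⊖-homo m (suc n)
  ⟦⟧-+ -[1+ m ] (+ n) = trans (⊖-homo n (suc m)) (+-comm _ _)
  ⟦⟧-+ -[1+ m ] -[1+ n ] = begin
    - (suc (suc (m ℕ.+ n)) · 1#)             ≡⟨ ≡.cong (λ s → - (suc s · 1#)) (≡.sym (ℕP.+-suc m n)) ⟩
    - ((suc m ℕ.+ suc n) · 1#)               ≈⟨ -‿cong (×-homo-+ 1# (suc m) (suc n)) ⟩
    - (suc m · 1# + suc n · 1#)              ≈⟨ ⁻¹-∙-comm _ _ ⟨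
    - (suc m · 1#) + - (suc n · 1#)          ∎

  ⟦⟧-neg : ∀ i → ⟦ ℤ.- i ⟧ ≈ - ⟦ i ⟧
  ⟦⟧-neg (+ zero) = sym -0#≈0#
  ⟦⟧-neg (+ suc n) = refl
  ⟦⟧-neg -[1+ n ] = sym (-‿involutive _)

  private
    ⟦⟧-sign : ∀ n → ⟦ Sign.- ℤ.◃ n ⟧ ≈ - (n · 1#)
    ⟦⟧-sign zero = sym -0#≈0#
    ⟦⟧-sign (suc n) = refl

    ⟦⟧-pos : ∀ n → ⟦ Sign.+ ℤ.◃ n ⟧ ≈ n · 1#
    ⟦⟧-pos zero = refl
    ⟦⟧-pos (suc n) = refl

  ⟦⟧-* : ∀ i j → ⟦ i ℤ.* j ⟧ ≈ ⟦ i ⟧ * ⟦ j ⟧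
  ⟦⟧-* (+ m) (+ n) = trans (⟦⟧-pos (m ℕ.* n)) (×1-homo-* m n)
  ⟦⟧-* (+ m) -[1+ n ] = begin
    ⟦ Sign.- ℤ.◃ (m ℕ.* suc n) ⟧     ≈⟨ ⟦⟧-sign (m ℕ.* suc n) ⟩
    - ((m ℕ.* suc n) · 1#)           ≈⟨ -‿cong (×1-homo-* m (suc n)) ⟩
    - ((m · 1#) * (suc n · 1#))      ≈⟨ -‿distribʳ-* _ _ ⟩
    (m · 1#) * - (suc n · 1#)        ∎
  ⟦⟧-* -[1+ m ] (+ n) = begin
    ⟦ Sign.- ℤ.◃ (suc m ℕ.* n) ⟧     ≈⟨ ⟦⟧-sign (suc m ℕ.* n) ⟩
    - ((suc m ℕ.* n) · 1#)           ≈⟨ -‿cong (×1-homo-* (suc m) n) ⟩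
    - ((suc m · 1#) * (n · 1#))      ≈⟨ -‿distribˡ-* _ _ ⟩
    - (suc m · 1#) * (n · 1#)        ∎
  ⟦⟧-* -[1+ m ] -[1+ n ] = begin
    ⟦ Sign.+ ℤ.◃ (suc m ℕ.* suc n) ⟧     ≈⟨ ⟦⟧-pos (suc m ℕ.* suc n) ⟩
    (suc m ℕ.* suc n) · 1#               ≈⟨ ×1-homo-* (suc m) (suc n) ⟩
    (suc m · 1#) * (suc n · 1#)          ≈⟨ -‿involutive _ ⟨
    - - ((suc m · 1#) * (suc n · 1#))    ≈⟨ -‿cong (-‿distribʳ-* _ _) ⟩
    - ((suc m · 1#) * - (suc n · 1#))    ≈⟨ -‿distribˡ-* _ _ ⟩
    - (suc m · 1#) * - (suc n · 1#)      ∎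

  private
    -- Sends 1 to 1# on the nose, so that the solver's constant 1 is 1#.
    coeff : ℤ → Carrier
    coeff (+ 1)      = 1#
    coeff -[1+ 0 ]   = - 1#
    coeff i          = ⟦ i ⟧

    coeff≈ : ∀ i → coeff i ≈ ⟦ i ⟧
    coeff≈ (+ 0) = refl
    coeff≈ (+ 1) = sym (+-identityʳ 1#)
    coeff≈ (+ suc (suc _)) = refl
    coeff≈ -[1+ 0 ] = -‿cong (sym (+-identityʳ 1#))
    coeff≈ -[1+ suc _ ] = refl

    morphism : ℤ.+-*-rawRing -Raw-AlmostCommutative⟶ fromCommutativeRing R
    morphism = record
      { ⟦_⟧    = coeff
      ; +-homo = λ i j → trans (coeff≈ (i ℤ.+ j)) (trans (⟦⟧-+ i j) (+-cong (sym (coeff≈ i)) (sym (coeff≈ j))))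
      ; *-homo = λ i j → trans (coeff≈ (i ℤ.* j)) (trans (⟦⟧-* i j) (*-cong (sym (coeff≈ i)) (sym (coeff≈ j))))
      ; -‿homo = λ i → trans (coeff≈ (ℤ.- i)) (trans (⟦⟧-neg i) (-‿cong (sym (coeff≈ i))))
      ; 0-homo = refl
      ; 1-homo = refl
      }

    coeff≟ : ∀ i j → _
    coeff≟ i j with i ℤP.≟ j
    ... | yes i≡j = just (reflexive (≡.cong coeff i≡j))
    ... | no _    = nothing

  open RingSolver ℤ.+-*-rawRing (fromCommutativeRing R) morphism coeff≟ public
    using (solve; _:=_; _:+_; _:*_; _:-_; :-_; con)

-- Order, powers and reciprocals in the real field.

module OrderedField {c ℓ₁ ℓ₂ : Level} (R : RealField c ℓ₁ ℓ₂) where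
  open RealField R
  open CommutativeRing commutativeRing using (ring; semiring; commutativeSemiring) public
  open RingProperties ring public using (-0#≈0#; -‿distribˡ-*; -‿distribʳ-*; -‿involutive)
  open Exp commutativeSemiring public using (^-congˡ; ^-homo-*; ^-distrib-*)
  open SemiringMult semiring using (×-homo-+; ×1-homo-*)
  open IntegerCoefficients commutativeRing public
    using (solve; _:=_; _:+_; _:*_; _:-_; :-_; con; ⟦⟧-+; ⟦⟧-*; ⟦⟧-neg) renaming (⟦_⟧ to ιℤ)

  private
    module < = IsStrictPartialOrder isStrictPartialOrder

  <-respˡ : ∀ {x y z} → x ≈ y → x < z → y < z
  <-respˡ = <.<-respˡ-≈

  <-respʳ : ∀ {x y z} → x ≈ y → z < x → z < y
  <-respʳ = <.<-respʳ-≈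

  <-irrefl : ∀ {x} → ¬ (x < x)
  <-irrefl = <.irrefl refl

  <-trans : ∀ {x y z} → x < y → y < z → x < z
  <-trans = <.trans

  -- Cotransitivity of apartness does not say on which side `z` lies; if it lies beyond one
  -- endpoint, transitivity compares it with the other.
  <-cotrans : ∀ {x y} → x < y → ∀ z → x < z ⊎ z < y
  <-cotrans x<y z with #-cotrans (Equivalence.from #⇔<⊎> (inj₁ x<y)) z
  ... | inj₁ x#z with Equivalence.to #⇔<⊎> x#z
  ...   | inj₁ x<z = inj₁ x<z
  ...   | inj₂ z<x = inj₂ (<-trans z<x x<y)
  <-cotrans x<y z | inj₂ z#y with Equivalence.to #⇔<⊎> z#y
  ...   | inj₁ z<y = inj₂ z<y
  ...   | inj₂ y<z = inj₁ (<-trans x<y y<z)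

  -- Tightness of apartness: two elements neither of which is smaller cannot be apart.
  ≤-antisym : ∀ {x y} → x ≤ y → y ≤ x → x ≈ y
  ≤-antisym x≤y y≤x = proj₁ (tight _ _) λ x#y → case (Equivalence.to #⇔<⊎> x#y)
    where
    case : _ ⊎ _ → ⊥
    case (inj₁ x<y) = y≤x x<y
    case (inj₂ y<x) = x≤y y<x

  -- Trichotomy is available whenever the goal is a negation, in particular
  -- in every proof of an inequality ≤.
  trichotomy : ∀ x y → (x < y → ⊥) → (x ≈ y → ⊥) → (y < x → ⊥) → ⊥
  trichotomy x y x≮y x≉y y≮x = x≉y (≤-antisym y≮x x≮y)

  ≤-reflexive : ∀ {x y} → x ≈ y → x ≤ y
  ≤-reflexive x≈y y<x = <.irrefl (sym x≈y) y<x

  ≤-refl : ∀ {x} → x ≤ x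
  ≤-refl = <-irrefl

  <⇒≤ : ∀ {x y} → x < y → x ≤ y
  <⇒≤ = <.asym

  <-≤-trans : ∀ {x y z} → x < y → y ≤ z → x < z
  <-≤-trans {z = z} x<y y≤z with <-cotrans x<y z
  ... | inj₁ x<z = x<z
  ... | inj₂ z<y = ⊥-elim (y≤z z<y)

  ≤-<-trans : ∀ {x y z} → x ≤ y → y < z → x < z
  ≤-<-trans {x} x≤y y<z with <-cotrans y<z x
  ... | inj₁ y<x = ⊥-elim (x≤y y<x)
  ... | inj₂ x<z = x<z

  ≤-trans : ∀ {x y z} → x ≤ y → y ≤ z → x ≤ z
  ≤-trans x≤y y≤z z<x = y≤z (<-≤-trans z<x x≤y)

  ≤-isPreorder : IsPreorder _≈_ _≤_
  ≤-isPreorder = record { isEquivalence = isEquivalence ; reflexive = ≤-reflexive ; trans = ≤-trans }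

  module ≤-Reasoning = TripleReasoning ≤-isPreorder <.asym <-trans
    ((λ {x} → <-respʳ) , (λ {x} → <-respˡ)) <⇒≤ <-≤-trans ≤-<-trans

  +-monoʳ-< : ∀ {x y} z → x < y → z + x < z + y
  +-monoʳ-< z x<y = <-respˡ (+-comm _ z) (<-respʳ (+-comm _ z) (+-monoˡ-< z x<y))

  +-cancelʳ-< : ∀ {x y} z → x + z < y + z → x < y
  +-cancelʳ-< {x} {y} z x+z<y+z = <-respˡ (drop x) (<-respʳ (drop y) (+-monoˡ-< (- z) x+z<y+z))
    where
    drop : ∀ x → x + z + - z ≈ x
    drop x = solve 2 (λ x z → x :+ z :- z := x) refl x z

  +-monoˡ-≤ : ∀ {x y} z → x ≤ y → x + z ≤ y + z
  +-monoˡ-≤ z x≤y = x≤y ∘ +-cancelʳ-< z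

  +-monoʳ-≤ : ∀ {x y} z → x ≤ y → z + x ≤ z + y
  +-monoʳ-≤ z x≤y = ≤-trans (≤-reflexive (+-comm z _)) (≤-trans (+-monoˡ-≤ z x≤y) (≤-reflexive (+-comm _ z)))

  +-mono-≤ : ∀ {x y u v} → x ≤ y → u ≤ v → x + u ≤ y + v
  +-mono-≤ x≤y u≤v = ≤-trans (+-monoˡ-≤ _ x≤y) (+-monoʳ-≤ _ u≤v)

  +-nonneg : ∀ {x y} → 0# ≤ x → 0# ≤ y → 0# ≤ x + y
  +-nonneg 0≤x 0≤y = ≤-trans (≤-reflexive (sym (+-identityˡ 0#))) (+-mono-≤ 0≤x 0≤y)

  <⇒0<- : ∀ {x y} → x < y → 0# < y - x
  <⇒0<- {x} x<y = <-respˡ (-‿inverseʳ x) (+-monoˡ-< (- x) x<y)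

  ≤⇒0≤- : ∀ {x y} → x ≤ y → 0# ≤ y - x
  ≤⇒0≤- {x} x≤y = ≤-trans (≤-reflexive (sym (-‿inverseʳ x))) (+-monoˡ-≤ (- x) x≤y)

  ≤-by : ∀ {x y w} → 0# ≤ w → x + w ≈ y → x ≤ y
  ≤-by {x} 0≤w x+w≈y = ≤-trans (≤-reflexive (sym (+-identityʳ x))) (≤-trans (+-monoʳ-≤ x 0≤w) (≤-reflexive x+w≈y))

  <-by : ∀ {x y w} → 0# < w → x + w ≈ y → x < y
  <-by {x} 0<w x+w≈y = <-respˡ (+-identityʳ x) (<-respʳ x+w≈y (+-monoʳ-< x 0<w))

  *-nonneg : ∀ {x y} → 0# ≤ x → 0# ≤ y → 0# ≤ x * y
  *-nonneg {x} {y} 0≤x 0≤y xy<0 = trichotomy x 0# 0≤x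
    (λ x≈0 → <.irrefl (trans (*-congʳ x≈0) (zeroˡ y)) xy<0)
    λ 0<x → trichotomy y 0# 0≤y
      (λ y≈0 → <.irrefl (trans (*-congˡ y≈0) (zeroʳ x)) xy<0)
      (λ 0<y → <.asym (*-pos 0<x 0<y) xy<0)

  *-monoˡ-≤ : ∀ {x y z} → 0# ≤ z → x ≤ y → z * x ≤ z * y
  *-monoˡ-≤ {x} {y} {z} 0≤z x≤y = ≤-by (*-nonneg 0≤z (≤⇒0≤- x≤y))
    (solve 3 (λ x y z → z :* x :+ z :* (y :- x) := z :* y) refl x y z)

  *-monoʳ-≤ : ∀ {x y z} → 0# ≤ z → x ≤ y → x * z ≤ y * z
  *-monoʳ-≤ {x} {y} {z} 0≤z x≤y = ≤-trans (≤-reflexive (*-comm x z)) (≤-trans (*-monoˡ-≤ 0≤z x≤y) (≤-reflexive (*-comm z y)))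

  *-mono-≤ : ∀ {x y u v} → 0# ≤ u → 0# ≤ y → x ≤ y → u ≤ v → x * u ≤ y * v
  *-mono-≤ 0≤u 0≤y x≤y u≤v = ≤-trans (*-monoʳ-≤ 0≤u x≤y) (*-monoˡ-≤ 0≤y u≤v)

  *-monoˡ-< : ∀ {x y z} → 0# < z → x < y → z * x < z * y
  *-monoˡ-< {x} {y} {z} 0<z x<y = <-by (*-pos 0<z (<⇒0<- x<y))
    (solve 3 (λ x y z → z :* x :+ z :* (y :- x) := z :* y) refl x y z)

  *-cancelˡ-≤ : ∀ {x y z} → 0# < z → z * x ≤ z * y → x ≤ y
  *-cancelˡ-≤ 0<z zx≤zy y<x = zx≤zy (*-monoˡ-< 0<z y<x)

  neg-mono-≤ : ∀ {x y} → x ≤ y → - y ≤ - x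
  neg-mono-≤ {x} {y} x≤y = ≤-by (≤⇒0≤- x≤y) (solve 2 (λ x y → :- y :+ (y :- x) := :- x) refl x y)

  neg-*-neg : ∀ x → - x * - x ≈ x * x
  neg-*-neg = solve 1 (λ x → :- x :* :- x := x :* x) refl

  square-nonneg : ∀ x → 0# ≤ x * x
  square-nonneg x x²<0 = trichotomy x 0#
    (λ x<0 → let 0<-x = <-respʳ (+-identityˡ (- x)) (<⇒0<- x<0) in
       <.asym (<-respʳ (neg-*-neg x) (*-pos 0<-x 0<-x)) x²<0)
    (λ x≈0 → <.irrefl (trans (*-congʳ x≈0) (zeroˡ x)) x²<0)
    (λ 0<x → <.asym (*-pos 0<x 0<x) x²<0)

  square-cancel-≤ : ∀ {x y} → 0# ≤ y → x * x ≤ y * y → x ≤ y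
  square-cancel-≤ {x} {y} 0≤y x²≤y² y<x = x²≤y² (<-by (*-pos (<⇒0<- y<x) 0<x+y)
    (solve 2 (λ x y → y :* y :+ (x :- y) :* (x :+ y) := x :* x) refl x y))
    where
    0<x+y : 0# < x + y
    0<x+y = <-≤-trans (≤-<-trans 0≤y y<x) (≤-by 0≤y refl)

  square-mono-≤ : ∀ {x y} → 0# ≤ x → x ≤ y → x * x ≤ y * y
  square-mono-≤ 0≤x x≤y = *-mono-≤ 0≤x (≤-trans 0≤x x≤y) x≤y x≤y

  0<1 : 0# < 1#
  0<1 = <-respʳ (+-identityʳ 1#) (fromℕ-pos 1)

  0≤1 : 0# ≤ 1#
  0≤1 = <⇒≤ 0<1

  fromℕ-nonneg : ∀ n → 0# ≤ fromℕ n
  fromℕ-nonneg zero    = ≤-refl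
  fromℕ-nonneg (suc n) = +-nonneg 0≤1 (fromℕ-nonneg n)

  fromℕ-+ : ∀ m n → fromℕ (m ℕ.+ n) ≈ fromℕ m + fromℕ n
  fromℕ-+ = ×-homo-+ 1#

  fromℕ-* : ∀ m n → fromℕ (m ℕ.* n) ≈ fromℕ m * fromℕ n
  fromℕ-* = ×1-homo-*

  fromℕ-1 : fromℕ 1 ≈ 1#
  fromℕ-1 = +-identityʳ 1#

  fromℕ-^ : ∀ m n → fromℕ (m ℕ.^ n) ≈ fromℕ m ^ n
  fromℕ-^ m zero    = fromℕ-1
  fromℕ-^ m (suc n) = trans (fromℕ-* m (m ℕ.^ n)) (*-congˡ (fromℕ-^ m n))

  fromℕ-mono-≤ : ∀ {m n} → m ℕ.≤ n → fromℕ m ≤ fromℕ n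
  fromℕ-mono-≤ {n = n} z≤n = fromℕ-nonneg n
  fromℕ-mono-≤ (s≤s m≤n)   = +-monoʳ-≤ 1# (fromℕ-mono-≤ m≤n)

  1≤fromℕ : ∀ n .{{_ : NonZero n}} → 1# ≤ fromℕ n
  1≤fromℕ (suc n) = ≤-by (fromℕ-nonneg n) (refl {1# + fromℕ n})

  ^-nonneg : ∀ {x} n → 0# ≤ x → 0# ≤ x ^ n
  ^-nonneg zero    0≤x = 0≤1
  ^-nonneg (suc n) 0≤x = *-nonneg 0≤x (^-nonneg n 0≤x)

  ^-monoˡ-≤ : ∀ {x y} n → 0# ≤ x → x ≤ y → x ^ n ≤ y ^ n
  ^-monoˡ-≤ zero    0≤x x≤y = ≤-refl
  ^-monoˡ-≤ (suc n) 0≤x x≤y = *-mono-≤ (^-nonneg n 0≤x) (≤-trans 0≤x x≤y) x≤y (^-monoˡ-≤ n 0≤x x≤y)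

  1≤^ : ∀ {x} n → 1# ≤ x → 1# ≤ x ^ n
  1≤^ zero    1≤x = ≤-refl
  1≤^ {x} (suc n) 1≤x = ≤-trans (≤-reflexive (sym (*-identityˡ 1#)))
    (*-mono-≤ 0≤1 (≤-trans 0≤1 1≤x) 1≤x (1≤^ n 1≤x))

  ^-monoʳ-≤ : ∀ {x m n} → 1# ≤ x → m ℕ.≤ n → x ^ m ≤ x ^ n
  ^-monoʳ-≤ {n = n} 1≤x z≤n = 1≤^ n 1≤x
  ^-monoʳ-≤ 1≤x (s≤s m≤n) = *-monoˡ-≤ (≤-trans 0≤1 1≤x) (^-monoʳ-≤ 1≤x m≤n)

  x-0≈x : ∀ x → x - 0# ≈ x
  x-0≈x x = trans (+-congˡ -0#≈0#) (+-identityʳ x)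

  -- Junk value: inv 0 = 0.
  inv : ℕ → ℝ
  inv zero      = 0#
  inv n@(suc _) = 1/ n

  1/-inverseʳ : ∀ n .{{_ : NonZero n}} → fromℕ n * 1/ n ≈ 1#
  1/-inverseʳ n = trans (*-congʳ (sym (x-0≈x (fromℕ n))))
    (proj₂ (proj₂ (#⇒invertible (Equivalence.from #⇔<⊎> (inj₂ (fromℕ-pos n))))))

  inv-inverseʳ : ∀ n .{{_ : NonZero n}} → fromℕ n * inv n ≈ 1#
  inv-inverseʳ n@(suc _) = 1/-inverseʳ n

  fromℕ-cancelˡ : ∀ n .{{_ : NonZero n}} {x y} → fromℕ n * x ≈ fromℕ n * y → x ≈ y
  fromℕ-cancelˡ n nx≈ny = ≤-antisym (*-cancelˡ-≤ (fromℕ-pos n) (≤-reflexive nx≈ny))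
                                    (*-cancelˡ-≤ (fromℕ-pos n) (≤-reflexive (sym nx≈ny)))

  inv-unique : ∀ n .{{_ : NonZero n}} {x} → fromℕ n * x ≈ 1# → x ≈ inv n
  inv-unique n nx≈1 = fromℕ-cancelˡ n (trans nx≈1 (sym (inv-inverseʳ n)))

  inv-* : ∀ m n → inv (m ℕ.* n) ≈ inv m * inv n
  inv-* zero    n = sym (zeroˡ _)
  inv-* m@(suc _) zero rewrite ℕP.*-zeroʳ m = sym (zeroʳ _)
  inv-* m@(suc _) n@(suc _) = sym (inv-unique (m ℕ.* n) (trans (*-congʳ (fromℕ-* m n))
    (trans (solve 4 (λ m n x y → (m :* n) :* (x :* y) := (m :* x) :* (n :* y)) refl (fromℕ m) (fromℕ n) (inv m) (inv n))
    (trans (*-cong (inv-inverseʳ m) (inv-inverseʳ n)) (*-identityˡ 1#)))))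

  inv-1 : inv 1 ≈ 1#
  inv-1 = sym (inv-unique 1 (trans (*-identityʳ _) fromℕ-1))

  -- A strict inequality cannot be proved by refuting its negation. Being invertible makes `y` apart
  -- from zero, which yields a sign, and the negative one contradicts `0# < 1#`.
  inverse-pos : ∀ {x y} → 0# < x → x * y ≈ 1# → 0# < y
  inverse-pos {x} {y} 0<x xy≈1
    with Equivalence.to #⇔<⊎> (invertible⇒# (x , trans (*-congˡ (x-0≈x y)) xy≈1
                                               , trans (*-congʳ (x-0≈x y)) (trans (*-comm y x) xy≈1)))
  ... | inj₂ 0<y = 0<y
  ... | inj₁ y<0 = ⊥-elim (<-irrefl (<-trans 0<1 (<-respˡ xy≈1 (<-respʳ (zeroʳ x) (*-monoˡ-< 0<x y<0)))))

  reciprocal : ∀ {x} → 0# < x → ∃[ y ] (0# < y × x * y ≈ 1#)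
  reciprocal {x} 0<x with #⇒invertible (Equivalence.from #⇔<⊎> (inj₂ 0<x))
  ... | y , _ , [x-0]y≈1 = y , inverse-pos 0<x xy≈1 , xy≈1
    where
    xy≈1 : x * y ≈ 1#
    xy≈1 = trans (*-congʳ (sym (x-0≈x x))) [x-0]y≈1

  inv-pos : ∀ n .{{_ : NonZero n}} → 0# < inv n
  inv-pos n = inverse-pos (fromℕ-pos n) (inv-inverseʳ n)

  inv-nonneg : ∀ n → 0# ≤ inv n
  inv-nonneg zero      = ≤-refl
  inv-nonneg n@(suc _) = <⇒≤ (inv-pos n)

  inv-anti : ∀ {m n} .{{_ : NonZero m}} → m ℕ.≤ n → inv n ≤ inv m
  inv-anti {m@(suc _)} {n@(suc _)} m≤n = *-cancelˡ-≤ (fromℕ-pos m) (≤-trans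
    (*-monoʳ-≤ (inv-nonneg n) (fromℕ-mono-≤ m≤n))
    (≤-reflexive (trans (inv-inverseʳ n) (sym (inv-inverseʳ m)))))

  sum-mono : ∀ {n} {u v : Vector ℝ n} → (∀ i → u i ≤ v i) → sum u ≤ sum v
  sum-mono {ℕ.zero}  u≤v = ≤-refl
  sum-mono {ℕ.suc n} u≤v = +-mono-≤ (u≤v Fin.zero) (sum-mono (u≤v ∘ Fin.suc))

  sum-nonneg : ∀ {n} {u : Vector ℝ n} → (∀ i → 0# ≤ u i) → 0# ≤ sum u
  sum-nonneg {ℕ.zero}  0≤u = ≤-refl
  sum-nonneg {ℕ.suc n} 0≤u = +-nonneg (0≤u Fin.zero) (sum-nonneg (0≤u ∘ Fin.suc))

  half-pos : ∀ {x} → 0# < x → 0# < x * inv 2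
  half-pos 0<x = *-pos 0<x (inv-pos 2)

  half+half : ∀ x → x * inv 2 + x * inv 2 ≈ x
  half+half x = trans (solve 2 (λ x h → x :* h :+ x :* h := x :* ((con 1ℤ :+ (con 1ℤ :+ con ℤ.0ℤ)) :* h)) refl x (inv 2))
    (trans (*-congˡ (inv-inverseʳ 2)) (*-identityʳ x))

  square≤0⇒≈0 : ∀ {x} → x * x ≤ 0# → x ≈ 0#
  square≤0⇒≈0 {x} x²≤0 = ≤-antisym (x²≤0⇒x≤0 x²≤0) (≤-trans (neg-mono-≤ (x²≤0⇒x≤0 (≤-trans (≤-reflexive (neg-*-neg x)) x²≤0)))
                                                    (≤-reflexive (-‿involutive x)) ∘ <-respʳ (sym -0#≈0#))
    where
    x²≤0⇒x≤0 : ∀ {x} → x * x ≤ 0# → x ≤ 0#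
    x²≤0⇒x≤0 x²≤0 = square-cancel-≤ ≤-refl (≤-trans x²≤0 (≤-reflexive (sym (zeroˡ 0#))))

  -- Stands in for a square root: `ε = y / (1 + y)` lies below both `1#` and `y`, so `ε² < ε < y`.
  square-below : ∀ {y} → 0# < y → ∃[ ε ] (0# < ε × ε * ε < y)
  square-below {y} 0<y with reciprocal (<-trans 0<1 (<-by 0<y (refl {1# + y})))
  ... | r , 0<r , [1+y]r≈1 = y * r , *-pos 0<y 0<r , <-trans ε²<ε ε<y
    where
    r<1 : r < 1#
    r<1 = <-by (*-pos 0<y 0<r) (trans (solve 2 (λ y r → r :+ y :* r := (con 1ℤ :+ y) :* r) refl y r) [1+y]r≈1)
    ε<1 : y * r < 1#
    ε<1 = <-by 0<r (trans (solve 2 (λ y r → y :* r :+ r := (con 1ℤ :+ y) :* r) refl y r) [1+y]r≈1)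
    ε<y : y * r < y
    ε<y = <-respʳ (*-identityʳ y) (*-monoˡ-< 0<y r<1)
    ε²<ε : (y * r) * (y * r) < y * r
    ε²<ε = <-respʳ (*-identityʳ _) (*-monoˡ-< (*-pos 0<y 0<r) ε<1)

-- Sums over initial segments, Cauchy products and the binomial theorem.

module RangeSums {c ℓ} (R : CommutativeRing c ℓ) where
  open CommutativeRing R
  open RawSemiringDefs (Semiring.rawSemiring semiring) using (sum)
  open MonoidSum +-commutativeMonoid using (sum-cong-≋; ∑-distrib-+)
  open SemiringSum semiring using (*-distribˡ-sum; *-distribʳ-sum)
  open IntegerCoefficients R using (solve; _:=_; _:+_; _:*_; _:-_)
  open SetoidReasoning setoid

  Σ< : ℕ → (ℕ → Carrier) → Carrier
  Σ< n u = sum {n} (u ∘ toℕ)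

  Σ<-cong : ∀ n {u v} → (∀ i → i ℕ.< n → u i ≈ v i) → Σ< n u ≈ Σ< n v
  Σ<-cong n u≈v = sum-cong-≋ {n} (λ i → u≈v (toℕ i) (FinP.toℕ<n i))

  Σ<-snoc : ∀ n u → Σ< (suc n) u ≈ Σ< n u + u n
  Σ<-snoc zero    u = +-comm (u 0) 0#
  Σ<-snoc (suc n) u = trans (+-congˡ (Σ<-snoc n (u ∘ suc))) (sym (+-assoc _ _ _))

  Σ<-+ : ∀ n u v → Σ< n (λ i → u i + v i) ≈ Σ< n u + Σ< n v
  Σ<-+ n u v = ∑-distrib-+ {n} (u ∘ toℕ) (v ∘ toℕ)

  Σ<-*ˡ : ∀ n x u → x * Σ< n u ≈ Σ< n (λ i → x * u i)
  Σ<-*ˡ n x u = *-distribˡ-sum {n} x (u ∘ toℕ)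

  Σ<-*ʳ : ∀ n x u → Σ< n u * x ≈ Σ< n (λ i → u i * x)
  Σ<-*ʳ n x u = *-distribʳ-sum {n} x (u ∘ toℕ)

  module Convolution (u v : ℕ → Carrier) where
    convolution : ℕ → Carrier
    convolution m = Σ< (suc m) (λ i → u i * v (m ∸ i))

    -- Both sides run over the triangle `i + j < n`, by antidiagonals on the left and by rows on the
    -- right. Passing to `suc n` lengthens every row by its entry on the antidiagonal `i + j = n`.
    Σ<-convolution : ∀ n → Σ< n convolution ≈ Σ< n (λ i → u i * Σ< (n ∸ i) v)
    Σ<-convolution zero    = refl
    Σ<-convolution (suc n) = begin
      Σ< (suc n) convolution
        ≈⟨ Σ<-snoc n convolution ⟩
      Σ< n convolution + convolution n
        ≈⟨ +-congʳ (Σ<-convolution n) ⟩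
      Σ< n (λ i → u i * Σ< (n ∸ i) v) + convolution n
        ≈⟨ +-congʳ (sym last≈0) ⟩
      Σ< (suc n) (λ i → u i * Σ< (n ∸ i) v) + convolution n
        ≈⟨ Σ<-+ (suc n) (λ i → u i * Σ< (n ∸ i) v) (λ i → u i * v (n ∸ i)) ⟨
      Σ< (suc n) (λ i → u i * Σ< (n ∸ i) v + u i * v (n ∸ i))
        ≈⟨ Σ<-cong (suc n) (λ { i (s≤s i≤n) → step i i≤n }) ⟩
      Σ< (suc n) (λ i → u i * Σ< (suc n ∸ i) v)
        ∎
      where
      last≈0 : Σ< (suc n) (λ i → u i * Σ< (n ∸ i) v) ≈ Σ< n (λ i → u i * Σ< (n ∸ i) v)
      last≈0 = begin
        Σ< (suc n) (λ i → u i * Σ< (n ∸ i) v)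
          ≈⟨ Σ<-snoc n (λ i → u i * Σ< (n ∸ i) v) ⟩
        Σ< n (λ i → u i * Σ< (n ∸ i) v) + u n * Σ< (n ∸ n) v
          ≈⟨ +-congˡ (*-congˡ (reflexive (≡.cong (λ d → Σ< d v) (ℕP.n∸n≡0 n)))) ⟩
        Σ< n (λ i → u i * Σ< (n ∸ i) v) + u n * 0#
          ≈⟨ +-congˡ (zeroʳ (u n)) ⟩
        Σ< n (λ i → u i * Σ< (n ∸ i) v) + 0#
          ≈⟨ +-identityʳ _ ⟩
        Σ< n (λ i → u i * Σ< (n ∸ i) v)
          ∎

      step : ∀ i → i ℕ.≤ n → u i * Σ< (n ∸ i) v + u i * v (n ∸ i) ≈ u i * Σ< (suc n ∸ i) v
      step i i≤n = begin
        u i * Σ< (n ∸ i) v + u i * v (n ∸ i)   ≈⟨ distribˡ (u i) _ _ ⟨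
        u i * (Σ< (n ∸ i) v + v (n ∸ i))       ≈⟨ *-congˡ (Σ<-snoc (n ∸ i) v) ⟨
        u i * Σ< (suc (n ∸ i)) v               ≡⟨ ≡.cong (λ d → u i * Σ< d v) (≡.sym (ℕP.+-∸-assoc 1 i≤n)) ⟩
        u i * Σ< (suc n ∸ i) v                 ∎

    -- The square minus the triangle leaves the corner `i, j < n ≤ i + j`, here written by rows.
    Σ<-*-Σ<-minus-convolution : ∀ n → Σ< n u * Σ< n v - Σ< n convolution ≈
                                  Σ< n (λ i → u i * (Σ< n v - Σ< (n ∸ i) v))
    Σ<-*-Σ<-minus-convolution n = begin
      Σ< n u * Σ< n v - Σ< n convolution
        ≈⟨ +-cong (Σ<-*ʳ n (Σ< n v) u) (-‿cong (Σ<-convolution n)) ⟩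
      Σ< n (λ i → u i * Σ< n v) - Σ< n (λ i → u i * Σ< (n ∸ i) v)
        ≈⟨ +-congʳ (Σ<-cong n (λ i _ → solve 3 (λ a b c → a :* b := a :* (b :- c) :+ a :* c) refl (u i) (Σ< n v) (Σ< (n ∸ i) v))) ⟩
      Σ< n (λ i → u i * (Σ< n v - Σ< (n ∸ i) v) + u i * Σ< (n ∸ i) v) - Σ< n (λ i → u i * Σ< (n ∸ i) v)
        ≈⟨ +-congʳ (Σ<-+ n (λ i → u i * (Σ< n v - Σ< (n ∸ i) v)) (λ i → u i * Σ< (n ∸ i) v)) ⟩
      Σ< n (λ i → u i * (Σ< n v - Σ< (n ∸ i) v)) + Σ< n (λ i → u i * Σ< (n ∸ i) v) - Σ< n (λ i → u i * Σ< (n ∸ i) v)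
        ≈⟨ solve 2 (λ a b → a :+ b :- b := a) refl _ _ ⟩
      Σ< n (λ i → u i * (Σ< n v - Σ< (n ∸ i) v))
        ∎

-- Stated over any commutative ring with inverse factorials because it serves twice: over `ℂ` for
-- the exponential series, and over `ℝ` for the series that dominates it.
module ExponentialTerms {c ℓ} (R : CommutativeRing c ℓ)
  (inv! : ℕ → CommutativeRing.Carrier R)
  (inv!-inverse : ∀ n → CommutativeRing._≈_ R
    (CommutativeRing._*_ R (IntegerCoefficients.⟦_⟧ R (+ (n !))) (inv! n)) (CommutativeRing.1# R)) where

  open CommutativeRing R
  open SemiringMult semiring using () renaming (_×_ to _·_)
  open RawSemiringDefs (Semiring.rawSemiring semiring) using (_^_)
  open SemiringMult semiring using (×1-homo-*; ×-assoc-*; ×-congʳ)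
  open RangeSums R
  open IntegerCoefficients R using (solve; _:=_; _:+_; _:*_; _:-_)
  open SetoidReasoning setoid

  term : Carrier → ℕ → Carrier
  term z n = inv! n * z ^ n

  inv!-binomial : ∀ m i → i ℕ.≤ m → inv! m * ((m C i) · 1#) ≈ inv! i * inv! (m ∸ i)
  inv!-binomial m i i≤m = begin
    inv! m * mCi                                            ≈⟨ *-identityʳ _ ⟨
    inv! m * mCi * 1#                                       ≈⟨ *-congˡ (trans (*-cong (inv!-inverse i) (inv!-inverse (m ∸ i))) (*-identityˡ 1#)) ⟨
    inv! m * mCi * ((i! * inv! i) * (j! * inv! (m ∸ i)))
      ≈⟨ solve 6 (λ a mCi i! x j! y → a :* mCi :* ((i! :* x) :* (j! :* y)) := ((mCi :* (i! :* j!)) :* a) :* (x :* y)) refl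
           (inv! m) mCi i! (inv! i) j! (inv! (m ∸ i)) ⟩
    (mCi * (i! * j!)) * inv! m * (inv! i * inv! (m ∸ i))    ≈⟨ *-congʳ (*-congʳ mCi·i!j!≈m!) ⟩
    ((m !) · 1#) * inv! m * (inv! i * inv! (m ∸ i))       ≈⟨ *-congʳ (inv!-inverse m) ⟩
    1# * (inv! i * inv! (m ∸ i))                          ≈⟨ *-identityˡ _ ⟩
    inv! i * inv! (m ∸ i)                                 ∎
    where
    mCi  = (m C i) · 1#
    i! = (i !) · 1#
    j! = ((m ∸ i) !) · 1#
    instance i!j!≢0 = i ℕP.!* (m ∸ i) !≢0

    mCi·i!j!≈m! : mCi * (i! * j!) ≈ (m !) · 1#
    mCi·i!j!≈m! = begin
      mCi * (i! * j!)                                 ≈⟨ *-congˡ (×1-homo-* (i !) _) ⟨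
      mCi * ((i ! ℕ.* (m ∸ i) !) · 1#)                ≈⟨ ×1-homo-* (m C i) _ ⟨
      ((m C i) ℕ.* (i ! ℕ.* (m ∸ i) !)) · 1#        ≡⟨ ≡.cong (_· 1#) (≡.trans (≡.cong (ℕ._* (i ! ℕ.* (m ∸ i) !)) (nCk≡n!/k![n-k]! i≤m))
                                                                           (m/n*n≡m (k![n∸k]!∣n! i≤m))) ⟩
      (m !) · 1#                                    ∎

  convolution-term : ∀ z w m → Convolution.convolution (term z) (term w) m ≈ term (z + w) m
  convolution-term z w m = sym (begin
    inv! m * (z + w) ^ m
      ≈⟨ *-congˡ (Binomial.theorem commutativeSemiring m z w) ⟩
    inv! m * Σ< (suc m) (λ i → (m C i) · (z ^ i * w ^ (m ∸ i)))
      ≈⟨ Σ<-*ˡ (suc m) (inv! m) (λ i → (m C i) · (z ^ i * w ^ (m ∸ i))) ⟩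
    Σ< (suc m) (λ i → inv! m * ((m C i) · (z ^ i * w ^ (m ∸ i))))
      ≈⟨ Σ<-cong (suc m) (λ { i (s≤s i≤m) → step i i≤m }) ⟩
    Σ< (suc m) (λ i → term z i * term w (m ∸ i))
      ∎)
    where
    step : ∀ i → i ℕ.≤ m → inv! m * ((m C i) · (z ^ i * w ^ (m ∸ i))) ≈ term z i * term w (m ∸ i)
    step i i≤m = begin
      inv! m * ((m C i) · (z ^ i * w ^ (m ∸ i)))
        ≈⟨ *-congˡ (trans (×-congʳ (m C i) (sym (*-identityˡ _))) (sym (×-assoc-* (m C i) 1# _))) ⟩
      inv! m * ((m C i) · 1# * (z ^ i * w ^ (m ∸ i)))
        ≈⟨ *-assoc (inv! m) _ _ ⟨
      inv! m * ((m C i) · 1#) * (z ^ i * w ^ (m ∸ i))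
        ≈⟨ *-congʳ (inv!-binomial m i i≤m) ⟩
      inv! i * inv! (m ∸ i) * (z ^ i * w ^ (m ∸ i))
        ≈⟨ solve 4 (λ a b x y → a :* b :* (x :* y) := (a :* x) :* (b :* y)) refl (inv! i) (inv! (m ∸ i)) (z ^ i) (w ^ (m ∸ i)) ⟩
      term z i * term w (m ∸ i)
        ∎

-- The ring of complex numbers, bounds on the modulus, and null sequences.

module ComplexNumbers {c ℓ₁ ℓ₂ : Level} (R : RealField c ℓ₁ ℓ₂) where
  open RealField R
  open OrderedField R
  open Complex R

  -ℂ_ : ℂ → ℂ
  -ℂ z = - re z +i - im z

  ℂ-commutativeRing : CommutativeRing c ℓ₁
  ℂ-commutativeRing = record
    { Carrier = ℂ ; _≈_ = _≈ℂ_ ; _+_ = _+ℂ_ ; _*_ = _*ℂ_ ; -_ = -ℂ_ ; 0# = 0ℂ ; 1# = 1ℂ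
    ; isCommutativeRing = record
      { isRing = record
        { +-isAbelianGroup = record
          { isGroup = record
            { isMonoid = record
              { isSemigroup = record
                { isMagma = record
                  { isEquivalence = record
                    { refl  = refl , refl
                    ; sym   = λ (p , q) → sym p , sym q
                    ; trans = λ (p , q) (p′ , q′) → trans p p′ , trans q q′
                    }
                  ; ∙-cong = λ (p , q) (p′ , q′) → +-cong p p′ , +-cong q q′
                  }
                ; assoc = λ _ _ _ → +-assoc _ _ _ , +-assoc _ _ _
                }
              ; identity = (λ _ → +-identityˡ _ , +-identityˡ _) , (λ _ → +-identityʳ _ , +-identityʳ _)
              }
            ; inverse = (λ _ → -‿inverseˡ _ , -‿inverseˡ _) , (λ _ → -‿inverseʳ _ , -‿inverseʳ _)
            ; ⁻¹-cong = λ (p , q) → -‿cong p , -‿cong q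
            }
          ; comm = λ _ _ → +-comm _ _ , +-comm _ _
          }
        ; *-cong = λ (p , q) (p′ , q′) → +-cong (*-cong p p′) (-‿cong (*-cong q q′)) , +-cong (*-cong p q′) (*-cong q p′)
        ; *-assoc = λ u v w →
            solve 6 (λ a b c d e f → (a :* c :- b :* d) :* e :- (a :* d :+ b :* c) :* f
                                  := a :* (c :* e :- d :* f) :- b :* (c :* f :+ d :* e))
              refl (re u) (im u) (re v) (im v) (re w) (im w) ,
            solve 6 (λ a b c d e f → (a :* c :- b :* d) :* f :+ (a :* d :+ b :* c) :* e
                                  := a :* (c :* f :+ d :* e) :+ b :* (c :* e :- d :* f))
              refl (re u) (im u) (re v) (im v) (re w) (im w)
        ; *-identity =
            (λ z → solve 2 (λ a b → con 1ℤ :* a :- con ℤ.0ℤ :* b := a) refl (re z) (im z) ,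
                   solve 2 (λ a b → con 1ℤ :* b :+ con ℤ.0ℤ :* a := b) refl (re z) (im z)) ,
            (λ z → solve 2 (λ a b → a :* con 1ℤ :- b :* con ℤ.0ℤ := a) refl (re z) (im z) ,
                   solve 2 (λ a b → a :* con ℤ.0ℤ :+ b :* con 1ℤ := b) refl (re z) (im z))
        ; distrib =
            (λ u v w →
              solve 6 (λ a b c d e f → a :* (c :+ e) :- b :* (d :+ f) := (a :* c :- b :* d) :+ (a :* e :- b :* f))
                refl (re u) (im u) (re v) (im v) (re w) (im w) ,
              solve 6 (λ a b c d e f → a :* (d :+ f) :+ b :* (c :+ e) := (a :* d :+ b :* c) :+ (a :* f :+ b :* e))
                refl (re u) (im u) (re v) (im v) (re w) (im w)) ,
            (λ u v w →
              solve 6 (λ a b c d e f → (c :+ e) :* a :- (d :+ f) :* b := (c :* a :- d :* b) :+ (e :* a :- f :* b))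
                refl (re u) (im u) (re v) (im v) (re w) (im w) ,
              solve 6 (λ a b c d e f → (c :+ e) :* b :+ (d :+ f) :* a := (c :* b :+ d :* a) :+ (e :* b :+ f :* a))
                refl (re u) (im u) (re v) (im v) (re w) (im w))
        }
      ; *-comm = λ u v →
          solve 4 (λ a b c d → a :* c :- b :* d := c :* a :- d :* b) refl (re u) (im u) (re v) (im v) ,
          solve 4 (λ a b c d → a :* d :+ b :* c := c :* b :+ d :* a) refl (re u) (im u) (re v) (im v)
      }
    }

  module ℂR = CommutativeRing ℂ-commutativeRing
  module ℂS = IntegerCoefficients ℂ-commutativeRing
  module ℂΣ = RangeSums ℂ-commutativeRing

  conj : ℂ → ℂ
  conj z = re z +i - im z

  conj-cong : ∀ {w z} → w ≈ℂ z → conj w ≈ℂ conj z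
  conj-cong (p , q) = p , -‿cong q

  conj-+ : ∀ w z → conj (w +ℂ z) ≈ℂ conj w +ℂ conj z
  conj-+ w z = refl , solve 2 (λ x y → :- (x :+ y) := :- x :+ :- y) refl (im w) (im z)

  conj-* : ∀ w z → conj (w *ℂ z) ≈ℂ conj w *ℂ conj z
  conj-* w z = solve 4 (λ a b c d → a :* c :- b :* d := a :* c :- (:- b) :* (:- d)) refl (re w) (im w) (re z) (im z)
             , solve 4 (λ a b c d → :- (a :* d :+ b :* c) := a :* (:- d) :+ (:- b) :* c) refl (re w) (im w) (re z) (im z)

  ofReal-+ : ∀ x y → ofReal (x + y) ≈ℂ ofReal x +ℂ ofReal y
  ofReal-+ x y = refl , sym (+-identityˡ 0#)

  ofReal-* : ∀ x y → ofReal (x * y) ≈ℂ ofReal x *ℂ ofReal y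
  ofReal-* x y = solve 2 (λ x y → x :* y := x :* y :- con ℤ.0ℤ :* con ℤ.0ℤ) refl x y
               , solve 2 (λ x y → con ℤ.0ℤ := x :* con ℤ.0ℤ :+ con ℤ.0ℤ :* y) refl x y

  ofReal-fromℕ : ∀ n → ℂS.⟦ + n ⟧ ≈ℂ ofReal (fromℕ n)
  ofReal-fromℕ zero    = refl , refl
  ofReal-fromℕ (suc n) = +-congˡ (proj₁ (ofReal-fromℕ n)) , trans (+-congˡ (proj₂ (ofReal-fromℕ n))) (+-identityˡ 0#)

  ∣∣²-cong : ∀ {w z} → w ≈ℂ z → ∣ w ∣² ≈ ∣ z ∣²
  ∣∣²-cong (p , q) = +-cong (*-cong p p) (*-cong q q)

  ∣∣²-nonneg : ∀ z → 0# ≤ ∣ z ∣²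
  ∣∣²-nonneg z = +-nonneg (square-nonneg (re z)) (square-nonneg (im z))

  ∣∣²-* : ∀ w z → ∣ w *ℂ z ∣² ≈ ∣ w ∣² * ∣ z ∣²
  ∣∣²-* w z = solve 4 (λ a b c d → (a :* c :- b :* d) :* (a :* c :- b :* d) :+ (a :* d :+ b :* c) :* (a :* d :+ b :* c)
                                := (a :* a :+ b :* b) :* (c :* c :+ d :* d))
                refl (re w) (im w) (re z) (im z)

  ∣neg∣² : ∀ z → ∣ -ℂ z ∣² ≈ ∣ z ∣²
  ∣neg∣² z = +-cong (neg-*-neg (re z)) (neg-*-neg (im z))

  ∣ofReal∣² : ∀ x → ∣ ofReal x ∣² ≈ x * x
  ∣ofReal∣² x = solve 1 (λ x → x :* x :+ con ℤ.0ℤ :* con ℤ.0ℤ := x :* x) refl x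

  ∣∣²≤0⇒≈0 : ∀ {z} → ∣ z ∣² ≤ 0# → z ≈ℂ 0ℂ
  ∣∣²≤0⇒≈0 {z} ∣z∣²≤0 =
    square≤0⇒≈0 (≤-trans (≤-by (square-nonneg (im z)) refl) ∣z∣²≤0) ,
    square≤0⇒≈0 (≤-trans (≤-by (square-nonneg (re z)) (+-comm _ _)) ∣z∣²≤0)

  -- z ⊑ M says |z| ≤ M, for M ≥ 0.
  infix 4 _⊑_
  _⊑_ : ℂ → ℝ → _
  z ⊑ M = ∣ z ∣² ≤ M * M

  ⊑-cong : ∀ {w z M} → w ≈ℂ z → w ⊑ M → z ⊑ M
  ⊑-cong {w} {z} w≈z = ≤-trans (≤-reflexive (sym (∣∣²-cong {w} {z} w≈z)))

  ⊑-* : ∀ {w z M N} → w ⊑ M → z ⊑ N → w *ℂ z ⊑ M * N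
  ⊑-* {w} {z} {M} {N} w⊑M z⊑N = ≤-trans (≤-reflexive (∣∣²-* w z))
    (≤-trans (*-mono-≤ (∣∣²-nonneg z) (square-nonneg M) w⊑M z⊑N)
             (≤-reflexive (solve 2 (λ m n → (m :* m) :* (n :* n) := (m :* n) :* (m :* n)) refl M N)))

  -- Cauchy–Schwarz in the plane, from Lagrange's identity.
  ⊑-+ : ∀ {w z M N} → 0# ≤ M → 0# ≤ N → w ⊑ M → z ⊑ N → w +ℂ z ⊑ M + N
  ⊑-+ {w} {z} {M} {N} 0≤M 0≤N w⊑M z⊑N =
    ≤-trans (≤-reflexive (solve 4 (λ a b c d → (a :+ c) :* (a :+ c) :+ (b :+ d) :* (b :+ d)
                                  := ((a :* a :+ b :* b) :+ (c :* c :+ d :* d)) :+ ((a :* c :+ b :* d) :+ (a :* c :+ b :* d)))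
                             refl (re w) (im w) (re z) (im z)))
    (≤-trans (+-mono-≤ (+-mono-≤ w⊑M z⊑N) (+-mono-≤ inner≤ inner≤))
             (≤-reflexive (solve 2 (λ m n → (m :* m :+ n :* n) :+ (m :* n :+ m :* n) := (m :+ n) :* (m :+ n)) refl M N)))
    where
    inner≤ : re w * re z + im w * im z ≤ M * N
    inner≤ = square-cancel-≤ (*-nonneg 0≤M 0≤N)
      (≤-trans (≤-by (square-nonneg (re w * im z - im w * re z))
                 (solve 4 (λ a b c d → (a :* c :+ b :* d) :* (a :* c :+ b :* d) :+ (a :* d :- b :* c) :* (a :* d :- b :* c)
                             := (a :* c :- b :* d) :* (a :* c :- b :* d) :+ (a :* d :+ b :* c) :* (a :* d :+ b :* c))
                    refl (re w) (im w) (re z) (im z)))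
               (⊑-* w⊑M z⊑N))

  ⊑-ofReal : ∀ x → ofReal x ⊑ x
  ⊑-ofReal x = ≤-reflexive (∣ofReal∣² x)

  ⊑-^ : ∀ {z M} n → z ⊑ M → z ^ℂ n ⊑ M ^ n
  ⊑-^ zero        z⊑M = ⊑-ofReal 1#
  ⊑-^ {z} (suc n) z⊑M = ⊑-* {z} {z ^ℂ n} z⊑M (⊑-^ {z} n z⊑M)

  bounded : ∀ z → ∃[ n ] z ⊑ fromℕ (suc n)
  bounded z with archimedean ∣ z ∣²
  ... | n , ∣z∣²<n = n , ≤-trans (<⇒≤ ∣z∣²<n) (≤-trans (fromℕ-mono-≤ (ℕP.≤-trans (ℕP.n≤1+n n) (ℕP.m≤m*n (suc n) (suc n))))
                                                       (≤-reflexive (fromℕ-* (suc n) (suc n))))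

  -- Quantified exactly as `Limitℂ`, so that `Limitℂ u l` unfolds to nullity of `u n -ℂ l` and limit
  -- laws become closure properties of null sequences.
  Null : (ℕ → ℂ) → _
  Null u = ∀ ε → 0# < ε → ∃[ M ] (∀ n → M ℕ.≤ n → u n ⊑ ε)

  null-dominated : ∀ {u v} → (∀ n → ∣ u n ∣² ≤ ∣ v n ∣²) → Null v → Null u
  null-dominated u≤v null-v ε 0<ε with null-v ε 0<ε
  ... | M , v⊑ε = M , λ n M≤n → ≤-trans (u≤v n) (v⊑ε n M≤n)

  null-cong : ∀ {u v} → (∀ n → u n ≈ℂ v n) → Null v → Null u
  null-cong {u} {v} u≈v = null-dominated {u} {v} (λ n → ≤-reflexive (∣∣²-cong {u n} {v n} (u≈v n)))

  null-+ : ∀ {u v} → Null u → Null v → Null (λ n → u n +ℂ v n)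
  null-+ {u} {v} null-u null-v ε 0<ε with null-u (ε * inv 2) (half-pos 0<ε) | null-v (ε * inv 2) (half-pos 0<ε)
  ... | M , u⊑ | M′ , v⊑ = M ℕ.⊔ M′ , λ n M≤n →
    ≤-trans (⊑-+ {u n} {v n} (<⇒≤ (half-pos 0<ε)) (<⇒≤ (half-pos 0<ε))
               (u⊑ n (ℕP.≤-trans (ℕP.m≤m⊔n M M′) M≤n)) (v⊑ n (ℕP.≤-trans (ℕP.m≤n⊔m M M′) M≤n)))
            (≤-reflexive (*-cong (half+half ε) (half+half ε)))

  null-neg : ∀ {u} → Null u → Null (λ n → -ℂ u n)
  null-neg {u} = null-dominated (λ n → ≤-reflexive (∣neg∣² (u n)))

  null-* : ∀ {u v} → Null u → Null v → Null (λ n → u n *ℂ v n)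
  null-* {u} {v} null-u null-v ε 0<ε with null-u ε 0<ε | null-v 1# 0<1
  ... | M , u⊑ | M′ , v⊑ = M ℕ.⊔ M′ , λ n M≤n →
    ≤-trans (⊑-* {u n} {v n} (u⊑ n (ℕP.≤-trans (ℕP.m≤m⊔n M M′) M≤n)) (v⊑ n (ℕP.≤-trans (ℕP.m≤n⊔m M M′) M≤n)))
            (≤-reflexive (*-cong (*-identityʳ ε) (*-identityʳ ε)))

  null-scale : ∀ z {u} → Null u → Null (λ n → z *ℂ u n)
  null-scale z {u} null-u ε 0<ε with bounded z
  ... | B , z⊑B with null-u (ε * inv (suc B)) (*-pos 0<ε (inv-pos (suc B)))
  ...   | M , u⊑ = M , λ n M≤n → ≤-trans (⊑-* {z} {u n} z⊑B (u⊑ n M≤n)) (≤-reflexive (*-cong unscale unscale))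
    where
    unscale : fromℕ (suc B) * (ε * inv (suc B)) ≈ ε
    unscale = trans (solve 3 (λ b ε i → b :* (ε :* i) := (b :* i) :* ε) refl (fromℕ (suc B)) ε (inv (suc B)))
                    (trans (*-congʳ (inv-inverseʳ (suc B))) (*-identityˡ ε))

  null-constant : ∀ {z} → Null (λ _ → z) → z ≈ℂ 0ℂ
  null-constant {z} null-z = ∣∣²≤0⇒≈0 {z} λ 0<∣z∣² → absurd (square-below 0<∣z∣²)
    where
    absurd : ¬ (∃[ ε ] (0# < ε × ε * ε < ∣ z ∣²))
    absurd (ε , 0<ε , ε²<) with null-z ε 0<ε
    ... | M , z⊑ε = z⊑ε M ℕP.≤-refl ε²<

  -- Two sequences are allowed because the identities for `exp` compare different approximations,
  -- such as a product of partial sums and the partial sum of a product.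
  limit-unique : ∀ {u v l m} → Limitℂ u l → Limitℂ v m → Null (λ n → u n -ℂ v n) → l ≈ℂ m
  limit-unique {u} {v} {l} {m} u→l v→m u-v→0 = ℂR.trans (l≈[l-m]+m l m) (ℂR.trans (ℂR.+-congʳ {m} {l -ℂ m} {0ℂ} l-m≈0) (ℂR.+-identityˡ m))
    where
    l≈[l-m]+m : ∀ l m → l ≈ℂ (l -ℂ m) +ℂ m
    l≈[l-m]+m = ℂS.solve 2 (λ l m → l ℂS.:= (l ℂS.:- m) ℂS.:+ m) ℂR.refl

    l-m≈0 : l -ℂ m ≈ℂ 0ℂ
    l-m≈0 = null-constant {l -ℂ m} (null-cong
      (λ n → ℂS.solve 4 (λ u v l m → (l ℂS.:- m) ℂS.:= (u ℂS.:- v) ℂS.:+ (ℂS.:- (u ℂS.:- l) ℂS.:+ (v ℂS.:- m))) ℂR.refl (u n) (v n) l m)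
      (null-+ {λ n → u n -ℂ v n} {λ n → (-ℂ (u n -ℂ l)) +ℂ (v n -ℂ m)} u-v→0
        (null-+ {λ n → -ℂ (u n -ℂ l)} {λ n → v n -ℂ m} (null-neg {λ n → u n -ℂ l} u→l) v→m)))

  limit-* : ∀ {u v l m} → Limitℂ u l → Limitℂ v m → Limitℂ (λ n → u n *ℂ v n) (l *ℂ m)
  limit-* {u} {v} {l} {m} u→l v→m = null-cong
    (λ n → ℂS.solve 4 (λ u v l m → (u ℂS.:* v ℂS.:- l ℂS.:* m)
                                   ℂS.:= (u ℂS.:- l) ℂS.:* (v ℂS.:- m) ℂS.:+ (l ℂS.:* (v ℂS.:- m) ℂS.:+ m ℂS.:* (u ℂS.:- l)))
             ℂR.refl (u n) (v n) l m)
    (null-+ {λ n → (u n -ℂ l) *ℂ (v n -ℂ m)} {λ n → (l *ℂ (v n -ℂ m)) +ℂ (m *ℂ (u n -ℂ l))}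
      (null-* {λ n → u n -ℂ l} {λ n → v n -ℂ m} u→l v→m)
      (null-+ {λ n → l *ℂ (v n -ℂ m)} {λ n → m *ℂ (u n -ℂ l)} (null-scale l {λ n → v n -ℂ m} v→m) (null-scale m {λ n → u n -ℂ l} u→l)))

-- The functional equation of the exponential series.

module Exponential {c ℓ₁ ℓ₂ : Level} (R : RealField c ℓ₁ ℓ₂) (E : ElementaryFunctions R) where
  open RealField R
  open OrderedField R
  open Complex R
  open ComplexNumbers R
  open ElementaryFunctions E
  open RangeSums commutativeRing

  inv! : ℕ → ℝ
  inv! n = (1/ (n !)) {{n ℕP.!≢0}}

  inv!-inverse : ∀ n → fromℕ (n !) * inv! n ≈ 1#
  inv!-inverse n = 1/-inverseʳ (n !) {{n ℕP.!≢0}}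

  inv!-nonneg : ∀ n → 0# ≤ inv! n
  inv!-nonneg n = <⇒≤ (inverse-pos (fromℕ-pos (n !) {{n ℕP.!≢0}}) (inv!-inverse n))

  inv!-inverseℂ : ∀ n → ℂS.⟦ + (n !) ⟧ *ℂ ofReal (inv! n) ≈ℂ 1ℂ
  inv!-inverseℂ n = ℂR.trans {j = ofReal (fromℕ (n !)) *ℂ ofReal (inv! n)} (ℂR.*-congʳ {ofReal (inv! n)} {ℂS.⟦ + (n !) ⟧} {ofReal (fromℕ (n !))} (ofReal-fromℕ (n !)))
    (ℂR.trans {j = ofReal (fromℕ (n !) * inv! n)} (ℂR.sym {ofReal (fromℕ (n !) * inv! n)} {ofReal (fromℕ (n !)) *ℂ ofReal (inv! n)} (ofReal-* (fromℕ (n !)) (inv! n))) (inv!-inverse n , refl))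

  module RealTerms = ExponentialTerms commutativeRing inv! inv!-inverse
  module ComplexTerms = ExponentialTerms ℂ-commutativeRing (ofReal ∘ inv!) inv!-inverseℂ
  open RealTerms using (term)

  partial : ℂ → ℕ → ℂ
  partial z n = ℂΣ.Σ< n (expTerm z)

  term-nonneg : ∀ {x} n → 0# ≤ x → 0# ≤ term x n
  term-nonneg n 0≤x = *-nonneg (inv!-nonneg n) (^-nonneg n 0≤x)

  expTerm⊑term : ∀ {z M} n → z ⊑ M → expTerm z n ⊑ term M n
  expTerm⊑term {z} n z⊑M = ⊑-* {ofReal (inv! n)} {z ^ℂ n} (⊑-ofReal (inv! n)) (⊑-^ {z} n z⊑M)

  Σ<-mono : ∀ n {u v} → (∀ i → i ℕ.< n → u i ≤ v i) → Σ< n u ≤ Σ< n v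
  Σ<-mono n u≤v = sum-mono {n} (λ i → u≤v (toℕ i) (FinP.toℕ<n i))

  Σ<-nonneg : ∀ n {u} → (∀ i → 0# ≤ u i) → 0# ≤ Σ< n u
  Σ<-nonneg n 0≤u = sum-nonneg {n} (0≤u ∘ toℕ)

  Σ<-mono-length : ∀ {m n} u → (∀ i → 0# ≤ u i) → m ℕ.≤ n → Σ< m u ≤ Σ< n u
  Σ<-mono-length {n = n} u 0≤u z≤n = Σ<-nonneg n 0≤u
  Σ<-mono-length u 0≤u (s≤s m≤n)   = +-monoʳ-≤ (u 0) (Σ<-mono-length (u ∘ suc) (0≤u ∘ suc) m≤n)

  Σ<-⊑ : ∀ n {u U} → (∀ i → 0# ≤ U i) → (∀ i → i ℕ.< n → u i ⊑ U i) → ℂΣ.Σ< n u ⊑ Σ< n U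
  Σ<-⊑ zero            0≤U u⊑U = ⊑-ofReal 0#
  Σ<-⊑ (suc n) {u} {U} 0≤U u⊑U = ⊑-+ {u 0} {ℂΣ.Σ< n (u ∘ suc)} (0≤U 0) (Σ<-nonneg n (0≤U ∘ suc))
    (u⊑U 0 (s≤s z≤n)) (Σ<-⊑ n {u ∘ suc} {U ∘ suc} (0≤U ∘ suc) (λ i i<n → u⊑U (suc i) (s≤s i<n)))

  Σ<-tail-⊑ : ∀ {m n} u U → (∀ i → 0# ≤ U i) → (∀ i → u i ⊑ U i) → m ℕ.≤ n →
              ℂΣ.Σ< n u -ℂ ℂΣ.Σ< m u ⊑ Σ< n U - Σ< m U
  Σ<-tail-⊑ {n = n} u U 0≤U u⊑U z≤n =
    ⊑-cong {ℂΣ.Σ< n u} {ℂΣ.Σ< n u -ℂ 0ℂ} (sym (x-0≈x _) , sym (x-0≈x _))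
      (≤-trans (Σ<-⊑ n 0≤U (λ i _ → u⊑U i)) (≤-reflexive (*-cong (sym (x-0≈x _)) (sym (x-0≈x _)))))
  Σ<-tail-⊑ {suc m} {suc n} u U 0≤U u⊑U (s≤s m≤n) =
    ⊑-cong {ℂΣ.Σ< n (u ∘ suc) -ℂ ℂΣ.Σ< m (u ∘ suc)} {ℂΣ.Σ< (suc n) u -ℂ ℂΣ.Σ< (suc m) u}
      (cancel (re (u 0)) _ _ , cancel (im (u 0)) _ _)
      (≤-trans (Σ<-tail-⊑ (u ∘ suc) (U ∘ suc) (0≤U ∘ suc) (u⊑U ∘ suc) m≤n)
               (≤-reflexive (*-cong (cancel (U 0) _ _) (cancel (U 0) _ _))))
    where
    cancel : ∀ x y z → y - z ≈ (x + y) - (x + z)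
    cancel = solve 3 (λ x y z → y :- z := (x :+ y) :- (x :+ z)) refl

  -- The product of two partial sums differs from the partial sum of the
  -- product series by the terms u i v j with i, j < n ≤ i + j, and these are
  -- dominated by the part of the real series of A + B between n and 2 n.
  partial-+ : ∀ {z w A B} n → 0# ≤ A → 0# ≤ B → z ⊑ A → w ⊑ B →
              (partial z n *ℂ partial w n) -ℂ partial (z +ℂ w) n ⊑
              Σ< (n ℕ.+ n) (term (A + B)) - Σ< n (term (A + B))
  partial-+ {z} {w} {A} {B} n 0≤A 0≤B z⊑A w⊑B =
    ⊑-cong {corner} {(partial z n *ℂ partial w n) -ℂ partial (z +ℂ w) n} corner≈
      (≤-trans corner⊑ (square-mono-≤ Corner-nonneg Corner≤))
    where
    open Convolution (term A) (term B)
    module ℂC = ℂΣ.Convolution (expTerm z) (expTerm w)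

    corner : ℂ
    corner = ℂΣ.Σ< n (λ i → expTerm z i *ℂ (partial w n -ℂ partial w (n ∸ i)))

    corner≈ : corner ≈ℂ (partial z n *ℂ partial w n) -ℂ partial (z +ℂ w) n
    corner≈ = ℂR.trans {corner} {(partial z n *ℂ partial w n) -ℂ ℂΣ.Σ< n ℂC.convolution}
      (ℂR.sym {(partial z n *ℂ partial w n) -ℂ ℂΣ.Σ< n ℂC.convolution} {corner} (ℂC.Σ<-*-Σ<-minus-convolution n))
      (ℂR.+-congˡ {partial z n *ℂ partial w n} { -ℂ ℂΣ.Σ< n ℂC.convolution} { -ℂ partial (z +ℂ w) n}
        (ℂR.-‿cong {ℂΣ.Σ< n ℂC.convolution} {partial (z +ℂ w) n}
          (ℂΣ.Σ<-cong n {ℂC.convolution} {expTerm (z +ℂ w)} (λ i _ → ComplexTerms.convolution-term z w i))))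

    Corner : ℝ
    Corner = Σ< n (λ i → term A i * (Σ< n (term B) - Σ< (n ∸ i) (term B)))

    tail-nonneg : ∀ i → 0# ≤ Σ< n (term B) - Σ< (n ∸ i) (term B)
    tail-nonneg i = ≤⇒0≤- (Σ<-mono-length (term B) (λ j → term-nonneg j 0≤B) (ℕP.m∸n≤m n i))

    Corner-terms-nonneg : ∀ i → 0# ≤ term A i * (Σ< n (term B) - Σ< (n ∸ i) (term B))
    Corner-terms-nonneg i = *-nonneg (term-nonneg i 0≤A) (tail-nonneg i)

    Corner-nonneg : 0# ≤ Corner
    Corner-nonneg = Σ<-nonneg n Corner-terms-nonneg

    corner⊑ : corner ⊑ Corner
    corner⊑ = Σ<-⊑ n Corner-terms-nonneg λ i _ →
      ⊑-* {expTerm z i} {partial w n -ℂ partial w (n ∸ i)} (expTerm⊑term {z} i z⊑A)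
          (Σ<-tail-⊑ (expTerm w) (term B) (λ j → term-nonneg j 0≤B) (λ j → expTerm⊑term {w} j w⊑B) (ℕP.m∸n≤m n i))

    convolution≈ : ∀ m → Σ< m convolution ≈ Σ< m (term (A + B))
    convolution≈ m = Σ<-cong m (λ i _ → RealTerms.convolution-term A B i)

    -- The square `i, j < n` is contained in the triangle `i + j < n + n`, and all terms are
    -- nonnegative.
    product≤ : Σ< n (term A) * Σ< n (term B) ≤ Σ< (n ℕ.+ n) (term (A + B))
    product≤ = begin
      Σ< n (term A) * Σ< n (term B)
        ≈⟨ Σ<-*ʳ n (Σ< n (term B)) (term A) ⟩
      Σ< n (λ i → term A i * Σ< n (term B))
        ≤⟨ Σ<-mono n (λ i i<n → *-monoˡ-≤ (term-nonneg i 0≤A)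
             (Σ<-mono-length (term B) (λ j → term-nonneg j 0≤B)
               (≡.subst (n ℕ.≤_) (≡.sym (ℕP.+-∸-assoc n (ℕP.<⇒≤ i<n))) (ℕP.m≤m+n n (n ∸ i))))) ⟩
      Σ< n (λ i → term A i * Σ< (n ℕ.+ n ∸ i) (term B))
        ≤⟨ Σ<-mono-length (λ i → term A i * Σ< (n ℕ.+ n ∸ i) (term B))
             (λ i → *-nonneg (term-nonneg i 0≤A) (Σ<-nonneg (n ℕ.+ n ∸ i) (λ j → term-nonneg j 0≤B)))
             (ℕP.m≤m+n n n) ⟩
      Σ< (n ℕ.+ n) (λ i → term A i * Σ< (n ℕ.+ n ∸ i) (term B))
        ≈⟨ Σ<-convolution (n ℕ.+ n) ⟨
      Σ< (n ℕ.+ n) convolution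
        ≈⟨ convolution≈ (n ℕ.+ n) ⟩
      Σ< (n ℕ.+ n) (term (A + B))
        ∎
      where open ≤-Reasoning

    Corner≤ : Corner ≤ Σ< (n ℕ.+ n) (term (A + B)) - Σ< n (term (A + B))
    Corner≤ = ≤-trans (≤-reflexive (sym (Σ<-*-Σ<-minus-convolution n)))
      (+-mono-≤ product≤ (≤-reflexive (-‿cong (convolution≈ n))))

  ofReal-^ : ∀ x n → ofReal x ^ℂ n ≈ℂ ofReal (x ^ n)
  ofReal-^ x zero    = refl , refl
  ofReal-^ x (suc n) = ℂR.trans {j = ofReal x *ℂ ofReal (x ^ n)} (ℂR.*-congˡ {ofReal x} {ofReal x ^ℂ n} {ofReal (x ^ n)} (ofReal-^ x n))
    (ℂR.sym {ofReal (x * x ^ n)} {ofReal x *ℂ ofReal (x ^ n)} (ofReal-* x (x ^ n)))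

  partial-ofReal : ∀ x n → partial (ofReal x) n ≈ℂ ofReal (Σ< n (term x))
  partial-ofReal x n = go n (expTerm (ofReal x)) (term x) λ i →
    ℂR.trans {j = ofReal (inv! i) *ℂ ofReal (x ^ i)} (ℂR.*-congˡ {ofReal (inv! i)} {ofReal x ^ℂ i} {ofReal (x ^ i)} (ofReal-^ x i))
      (ℂR.sym {ofReal (term x i)} {ofReal (inv! i) *ℂ ofReal (x ^ i)} (ofReal-* (inv! i) (x ^ i)))
    where
    go : ∀ n u U → (∀ i → u i ≈ℂ ofReal (U i)) → ℂΣ.Σ< n u ≈ℂ ofReal (Σ< n U)
    go zero    u U u≈U = refl , refl
    go (suc n) u U u≈U = let p , q = u≈U 0 ; p′ , q′ = go n (u ∘ suc) (U ∘ suc) (u≈U ∘ suc) in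
      +-cong p p′ , trans (+-cong q q′) (+-identityˡ 0#)

  -- The error of the product of partial sums is dominated by the block from `n` to `n + n` of the
  -- real series at `A+B`. That series converges because it is the series of `exp` at a real point,
  -- so its blocks form a null sequence.
  exp-+ : ∀ z w → exp (z +ℂ w) ≈ℂ exp z *ℂ exp w
  exp-+ z w with bounded z | bounded w
  ... | a , z⊑ | b , w⊑ = ℂR.sym {exp z *ℂ exp w} {exp (z +ℂ w)}
    (limit-unique {λ n → partial z n *ℂ partial w n} {partial (z +ℂ w)}
      (limit-* {partial z} {partial w} (exp-series z) (exp-series w)) (exp-series (z +ℂ w))
      (null-dominated {λ n → (partial z n *ℂ partial w n) -ℂ partial (z +ℂ w) n} dominated gap-null))
    where
    A+B : ℝ
    A+B = fromℕ (suc a) + fromℕ (suc b)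

    S : ℕ → ℂ
    S = partial (ofReal A+B)

    gap : ℕ → ℂ
    gap n = S (n ℕ.+ n) -ℂ S n

    dominated : ∀ n → ∣ (partial z n *ℂ partial w n) -ℂ partial (z +ℂ w) n ∣² ≤ ∣ gap n ∣²
    dominated n = ≤-trans (partial-+ n (fromℕ-nonneg (suc a)) (fromℕ-nonneg (suc b)) z⊑ w⊑)
      (≤-reflexive (trans (sym (∣ofReal∣² _))
        (∣∣²-cong {ofReal (Σ< (n ℕ.+ n) (term A+B) - Σ< n (term A+B))} {gap n} gap≈)))
      where
      gap≈ : ofReal (Σ< (n ℕ.+ n) (term A+B) - Σ< n (term A+B)) ≈ℂ gap n
      gap≈ = let p , q = partial-ofReal A+B (n ℕ.+ n) ; p′ , q′ = partial-ofReal A+B n in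
        +-cong (sym p) (-‿cong (sym p′)) ,
        trans (sym (x-0≈x 0#)) (+-cong (sym q) (-‿cong (sym q′)))

    shifted : Null (λ n → S (n ℕ.+ n) -ℂ exp (ofReal A+B))
    shifted ε 0<ε with exp-series (ofReal A+B) ε 0<ε
    ... | M , S⊑ = M , λ n M≤n → S⊑ (n ℕ.+ n) (ℕP.≤-trans M≤n (ℕP.m≤m+n n n))

    gap-null : Null gap
    gap-null = null-cong
      (λ n → ℂS.solve 3 (λ x y l → x ℂS.:- y ℂS.:= (x ℂS.:- l) ℂS.:+ ℂS.:- (y ℂS.:- l)) ℂR.refl (S (n ℕ.+ n)) (S n) (exp (ofReal A+B)))
      (null-+ {λ n → S (n ℕ.+ n) -ℂ exp (ofReal A+B)} {λ n → -ℂ (S n -ℂ exp (ofReal A+B))} shifted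
        (null-neg {λ n → S n -ℂ exp (ofReal A+B)} (exp-series (ofReal A+B))))

  ^ℂ-cong : ∀ {w z} n → w ≈ℂ z → w ^ℂ n ≈ℂ z ^ℂ n
  ^ℂ-cong zero    w≈z = refl , refl
  ^ℂ-cong {w} {z} (suc n) w≈z = ℂR.*-cong {w} {z} {w ^ℂ n} {z ^ℂ n} w≈z (^ℂ-cong {w} {z} n w≈z)

  expTerm-cong : ∀ {w z} n → w ≈ℂ z → expTerm w n ≈ℂ expTerm z n
  expTerm-cong {w} {z} n w≈z = ℂR.*-congˡ {ofReal (inv! n)} {w ^ℂ n} {z ^ℂ n} (^ℂ-cong {w} {z} n w≈z)

  null-≈ : ∀ {u v : ℕ → ℂ} → (∀ n → u n ≈ℂ v n) → Null (λ n → u n -ℂ v n)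
  null-≈ {u} {v} u≈v ε 0<ε = 0 , λ n _ →
    ≤-trans (≤-reflexive (trans (∣∣²-cong {u n -ℂ v n} {0ℂ} (difference≈0 {u n} {v n} (u≈v n))) (∣ofReal∣² 0#)))
            (≤-trans (≤-reflexive (zeroˡ 0#)) (square-nonneg ε))
    where
    difference≈0 : ∀ {w z} → w ≈ℂ z → w -ℂ z ≈ℂ 0ℂ
    difference≈0 (p , q) = trans (+-congʳ p) (-‿inverseʳ _) , trans (+-congʳ q) (-‿inverseʳ _)

  exp-cong : ∀ {w z} → w ≈ℂ z → exp w ≈ℂ exp z
  exp-cong {w} {z} w≈z = limit-unique {partial w} {partial z} (exp-series w) (exp-series z)
    (null-≈ {partial w} {partial z} (λ n → ℂΣ.Σ<-cong n {expTerm w} {expTerm z} (λ i _ → expTerm-cong {w} {z} i w≈z)))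

  conj-^ : ∀ z n → conj (z ^ℂ n) ≈ℂ conj z ^ℂ n
  conj-^ z zero    = refl , -0#≈0#
  conj-^ z (suc n) = ℂR.trans {j = conj z *ℂ conj (z ^ℂ n)} (conj-* z (z ^ℂ n)) (ℂR.*-congˡ {conj z} {conj (z ^ℂ n)} {conj z ^ℂ n} (conj-^ z n))

  conj-Σ< : ∀ n u → conj (ℂΣ.Σ< n u) ≈ℂ ℂΣ.Σ< n (conj ∘ u)
  conj-Σ< zero    u = refl , -0#≈0#
  conj-Σ< (suc n) u = ℂR.trans {j = conj (u 0) +ℂ conj (ℂΣ.Σ< n (u ∘ suc))} (conj-+ (u 0) (ℂΣ.Σ< n (u ∘ suc)))
    (ℂR.+-congˡ {conj (u 0)} {conj (ℂΣ.Σ< n (u ∘ suc))} {ℂΣ.Σ< n (conj ∘ u ∘ suc)} (conj-Σ< n (u ∘ suc)))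

  conj-expTerm : ∀ z n → conj (expTerm z n) ≈ℂ expTerm (conj z) n
  conj-expTerm z n = ℂR.trans {j = conj (ofReal (inv! n)) *ℂ conj (z ^ℂ n)} (conj-* (ofReal (inv! n)) (z ^ℂ n))
    (ℂR.*-cong {conj (ofReal (inv! n))} {ofReal (inv! n)} {conj (z ^ℂ n)} {conj z ^ℂ n} (refl , -0#≈0#) (conj-^ z n))

  -- The series has real coefficients, so conjugation passes through each partial sum. Reality of
  -- `exp` on the real line and `|e t| = 1` are drawn from this.
  exp-conj : ∀ z → exp (conj z) ≈ℂ conj (exp z)
  exp-conj z = limit-unique {partial (conj z)} {conj ∘ partial z} (exp-series (conj z))
    (null-dominated {λ n → conj (partial z n) -ℂ conj (exp z)} {λ n → partial z n -ℂ exp z}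
      (λ n → ≤-reflexive (trans (+-congˡ (solve 2 (λ x y → (:- x :- :- y) :* (:- x :- :- y) := (x :- y) :* (x :- y)) refl _ _)) refl))
      (exp-series z))
    (null-≈ {partial (conj z)} {conj ∘ partial z} (λ n →
      ℂR.sym {conj (partial z n)} {partial (conj z) n} (ℂR.trans {j = ℂΣ.Σ< n (conj ∘ expTerm z)} (conj-Σ< n (expTerm z))
        (ℂΣ.Σ<-cong n {conj ∘ expTerm z} {expTerm (conj z)} (λ i _ → conj-expTerm z i)))))

  limit-eventually : ∀ {u : ℕ → ℂ} {l} → Limitℂ u l → ∀ z → (∀ n → u (suc n) ≈ℂ z) → l ≈ℂ z
  limit-eventually {u} {l} u→l z u≈z = limit-unique {u ∘ suc} {λ _ → z}
    (λ ε 0<ε → let M , u⊑ = u→l ε 0<ε in M , λ n M≤n → u⊑ (suc n) (ℕP.m≤n⇒m≤1+n M≤n))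
    (null-≈ {λ _ → z} {λ _ → z} (λ _ → ℂR.refl {z})) (null-≈ {u ∘ suc} {λ _ → z} u≈z)

  inv!-0 : inv! 0 ≈ 1#
  inv!-0 = trans (sym (*-identityˡ _)) (trans (*-congʳ (sym fromℕ-1)) (inv!-inverse 0))

  inv!-1 : inv! 1 ≈ 1#
  inv!-1 = trans (sym (*-identityˡ _)) (trans (*-congʳ (sym fromℕ-1)) (inv!-inverse 1))

  exp-0 : exp 0ℂ ≈ℂ 1ℂ
  exp-0 = limit-eventually {partial 0ℂ} (exp-series 0ℂ) 1ℂ λ n →
    ℂR.trans {partial 0ℂ (suc n)} {ofReal (Σ< (suc n) (term 0#))} (partial-ofReal 0# (suc n)) (real n , refl)
    where
    Σ-0 : ∀ n {u} → (∀ i → u i ≈ 0#) → Σ< n u ≈ 0#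
    Σ-0 zero    u≈0 = refl
    Σ-0 (suc n) u≈0 = trans (+-cong (u≈0 0) (Σ-0 n (u≈0 ∘ suc))) (+-identityˡ 0#)

    real : ∀ n → Σ< (suc n) (term 0#) ≈ 1#
    real n = trans (+-cong (trans (*-identityʳ _) inv!-0) (Σ-0 n {term 0# ∘ suc} (λ i → trans (*-congˡ (zeroˡ _)) (zeroʳ _)))) (+-identityʳ 1#)

-- Lower bounds for the logarithm of a natural number.

module Logarithm {c ℓ₁ ℓ₂ : Level} (R : RealField c ℓ₁ ℓ₂) (E : ElementaryFunctions R) where
  open RealField R
  open OrderedField R
  open Complex R
  open ComplexNumbers R
  open ElementaryFunctions E
  open RangeSums commutativeRing
  open Exponential R E
  open RealTerms using (term)

  ⊑⇒re≤ : ∀ {z M} → 0# ≤ M → z ⊑ M → re z ≤ M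
  ⊑⇒re≤ {z} 0≤M z⊑M = square-cancel-≤ 0≤M (≤-trans (≤-by (square-nonneg (im z)) refl) z⊑M)

  -- If the limit were smaller than `y` by `δ`, some late term would be within `δ / 2` of it. The
  -- bound is asked from `n = 2` on because the estimates of the exponential series need its first
  -- two terms.
  limit-≥ : ∀ {u : ℕ → ℂ} {l y} → Limitℂ u l → (∀ n → 2 ℕ.≤ n → y ≤ re (u n)) → y ≤ re l
  limit-≥ {u} {l} {y} u→l y≤u l<y = too-close (u→l ε (half-pos 0<δ))
    where
    δ = y - re l
    ε = δ * inv 2

    0<δ : 0# < δ
    0<δ = <⇒0<- l<y

    too-close : ¬ (∃[ M ] (∀ n → M ℕ.≤ n → u n -ℂ l ⊑ ε))
    too-close (M , u⊑) = δ≤ε (<-by (half-pos 0<δ) (half+half δ))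
      where
      n = M ℕ.⊔ 2
      δ≤ε : δ ≤ ε
      δ≤ε = ≤-trans (+-monoˡ-≤ (- re l) (y≤u n (ℕP.m≤n⊔m M 2)))
                    (⊑⇒re≤ {u n -ℂ l} (<⇒≤ (half-pos 0<δ)) (u⊑ n (ℕP.m≤m⊔n M 2)))

  limit-≤ : ∀ {u : ℕ → ℂ} {l y} → Limitℂ u l → (∀ n → 2 ℕ.≤ n → re (u n) ≤ y) → re l ≤ y
  limit-≤ {u} {l} {y} u→l u≤y = ≤-trans (≤-reflexive (sym (-‿involutive _)))
    (≤-trans (neg-mono-≤ (limit-≥ {λ n → -ℂ u n} { -ℂ l} { - y} -u→-l (λ n 2≤n → neg-mono-≤ (u≤y n 2≤n))))
             (≤-reflexive (-‿involutive _)))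
    where
    -u→-l : Limitℂ (λ n → -ℂ u n) (-ℂ l)
    -u→-l = null-dominated {λ n → (-ℂ u n) -ℂ (-ℂ l)} {λ n → u n -ℂ l}
      (λ n → ≤-reflexive (solve 4 (λ a b c d → (:- a :- :- c) :* (:- a :- :- c) :+ (:- b :- :- d) :* (:- b :- :- d)
                                   := (a :- c) :* (a :- c) :+ (b :- d) :* (b :- d)) refl (re (u n)) (im (u n)) (re l) (im l)))
      u→l

  expℝ : ℝ → ℝ
  expℝ x = re (exp (ofReal x))

  -- Conjugation fixes a real argument, so the imaginary part equals its own negative.
  im-exp-ofReal : ∀ x → im (exp (ofReal x)) ≈ 0#
  im-exp-ofReal x = trans (sym (half+half y)) (trans (sym (distribʳ (inv 2) y y)) (trans (*-congʳ y+y≈0) (zeroˡ _)))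
    where
    y = im (exp (ofReal x))
    y≈-y : y ≈ - y
    y≈-y = trans (proj₂ (exp-cong {ofReal x} {conj (ofReal x)} (refl , sym -0#≈0#))) (proj₂ (exp-conj (ofReal x)))
    y+y≈0 : y + y ≈ 0#
    y+y≈0 = trans (+-congˡ y≈-y) (-‿inverseʳ y)

  expℝ-+ : ∀ x y → expℝ (x + y) ≈ expℝ x * expℝ y
  expℝ-+ x y = trans (proj₁ (exp-cong {ofReal (x + y)} {ofReal x +ℂ ofReal y} (ofReal-+ x y)))
    (trans (proj₁ (exp-+ (ofReal x) (ofReal y)))
    (trans (+-congˡ (trans (-‿cong (trans (*-congʳ (im-exp-ofReal x)) (zeroˡ _))) -0#≈0#)) (+-identityʳ _)))

  1+x≤expℝ : ∀ {x} → 0# ≤ x → 1# + x ≤ expℝ x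
  1+x≤expℝ {x} 0≤x = limit-≥ {partial (ofReal x)} (exp-series (ofReal x)) λ { n 2≤n →
    ≤-trans (≤-reflexive (sym two-terms)) (≤-trans (Σ<-mono-length (term x) (λ j → term-nonneg j 0≤x) 2≤n)
      (≤-reflexive (sym (proj₁ (partial-ofReal x n))))) }
    where
    two-terms : Σ< 2 (term x) ≈ 1# + x
    two-terms = +-cong (trans (*-identityʳ _) inv!-0)
      (trans (+-identityʳ _) (trans (*-cong inv!-1 (*-identityʳ x)) (*-identityˡ x)))

  expℝ-1≤3 : expℝ 1# ≤ fromℕ 3
  expℝ-1≤3 = limit-≤ {partial (ofReal 1#)} (exp-series (ofReal 1#)) λ { (suc zero) (s≤s ()) ; (suc (suc n)) _ →
    ≤-trans (≤-reflexive (proj₁ (partial-ofReal 1# (suc (suc n))))) (≤-trans (≤-by (inv!-nonneg (suc n)) refl) (bound n)) }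
    where
    term-1 : ∀ n → term 1# n ≈ inv! n
    term-1 n = trans (*-congˡ (1^ n)) (*-identityʳ _)
      where
      1^ : ∀ n → 1# ^ n ≈ 1#
      1^ zero    = refl
      1^ (suc n) = trans (*-identityˡ _) (1^ n)

    inv!-suc : ∀ n → fromℕ (suc n) * inv! (suc n) ≈ inv! n
    inv!-suc n = fromℕ-cancelˡ (n !) {{n ℕP.!≢0}} (trans (sym (*-assoc _ _ _))
      (trans (*-congʳ (trans (*-comm _ _) (sym (fromℕ-* (suc n) (n !)))))
      (trans (inv!-inverse (suc n)) (sym (inv!-inverse n)))))

    double≤ : ∀ n → inv! (suc (suc n)) + inv! (suc (suc n)) ≤ inv! (suc n)
    double≤ n = ≤-trans (≤-by (*-nonneg (fromℕ-nonneg n) (inv!-nonneg (suc (suc n))))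
        (solve 2 (λ n x → (x :+ x) :+ n :* x := (con 1ℤ :+ (con 1ℤ :+ n)) :* x) refl (fromℕ n) (inv! (suc (suc n)))))
      (≤-reflexive (inv!-suc (suc n)))

    -- Counting the last term twice makes the induction close: two copies of `1/(n+2)!` amount to at
    -- most one copy of `1/(n+1)!`. It starts from `1 + 1 + 1`.
    bound : ∀ n → Σ< (suc (suc n)) (term 1#) + inv! (suc n) ≤ fromℕ 3
    bound zero = ≤-reflexive (trans (+-cong (+-cong (trans (term-1 0) inv!-0) (+-congʳ (trans (term-1 1) inv!-1))) inv!-1)
      (solve 0 ((con 1ℤ :+ (con 1ℤ :+ con ℤ.0ℤ)) :+ con 1ℤ := con 1ℤ :+ (con 1ℤ :+ (con 1ℤ :+ con ℤ.0ℤ))) refl))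
    bound (suc n) = begin
      Σ< (3 ℕ.+ n) (term 1#) + inv! (2 ℕ.+ n)
        ≈⟨ +-congʳ (trans (Σ<-snoc (2 ℕ.+ n) (term 1#)) (+-congˡ (term-1 (2 ℕ.+ n)))) ⟩
      Σ< (2 ℕ.+ n) (term 1#) + inv! (2 ℕ.+ n) + inv! (2 ℕ.+ n)
        ≈⟨ +-assoc _ _ _ ⟩
      Σ< (2 ℕ.+ n) (term 1#) + (inv! (2 ℕ.+ n) + inv! (2 ℕ.+ n))
        ≤⟨ +-monoʳ-≤ _ (double≤ n) ⟩
      Σ< (2 ℕ.+ n) (term 1#) + inv! (1 ℕ.+ n)
        ≤⟨ bound n ⟩
      fromℕ 3
        ∎
      where open ≤-Reasoning

  expℝ-fromℕ≤3^ : ∀ n → expℝ (fromℕ n) ≤ fromℕ 3 ^ n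
  expℝ-fromℕ≤3^ zero    = ≤-reflexive (proj₁ exp-0)
  expℝ-fromℕ≤3^ (suc n) = ≤-trans (≤-reflexive (expℝ-+ 1# (fromℕ n)))
    (*-mono-≤ (≤-trans (+-nonneg 0≤1 (fromℕ-nonneg n)) (1+x≤expℝ (fromℕ-nonneg n))) (fromℕ-nonneg 3) expℝ-1≤3 (expℝ-fromℕ≤3^ n))

  -- If log Q < n, then Q (1 + (n - log Q)) ≤ exp n ≤ 3ⁿ ≤ Q.
  3^n≤Q⇒n≤log : ∀ n Q .{{_ : NonZero Q}} → 3 ℕ.^ n ℕ.≤ Q → fromℕ n ≤ logℕ Q
  3^n≤Q⇒n≤log n Q 3^n≤Q L<n = Q[1+d]≤Q (<-respˡ (*-identityʳ _) (*-monoˡ-< (fromℕ-pos Q) (<-by 0<d refl)))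
    where
    L = logℕ Q
    d = fromℕ n - L

    0<d : 0# < d
    0<d = <⇒0<- L<n

    expL≈Q : expℝ L ≈ fromℕ Q
    expL≈Q = proj₁ (exp-log (fromℕ Q) (fromℕ-pos Q))

    Q[1+d]≤Q : fromℕ Q * (1# + d) ≤ fromℕ Q
    Q[1+d]≤Q = begin
      fromℕ Q * (1# + d)      ≤⟨ *-monoˡ-≤ (fromℕ-nonneg Q) (1+x≤expℝ (<⇒≤ 0<d)) ⟩
      fromℕ Q * expℝ d        ≈⟨ *-congʳ expL≈Q ⟨
      expℝ L * expℝ d         ≈⟨ expℝ-+ L d ⟨
      expℝ (L + d)            ≈⟨ proj₁ (exp-cong {ofReal (L + d)} {ofReal (fromℕ n)} (solve 2 (λ l n → l :+ (n :- l) := n) refl L (fromℕ n) , refl)) ⟩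
      expℝ (fromℕ n)          ≤⟨ expℝ-fromℕ≤3^ n ⟩
      fromℕ 3 ^ n             ≈⟨ fromℕ-^ 3 n ⟨
      fromℕ (3 ℕ.^ n)         ≤⟨ fromℕ-mono-≤ 3^n≤Q ⟩
      fromℕ Q                 ∎
      where open ≤-Reasoning

-- Additive characters modulo q and their orthogonality.

module Characters {c ℓ₁ ℓ₂ : Level} (R : RealField c ℓ₁ ℓ₂) (E : ElementaryFunctions R) where
  open RealField R
  open OrderedField R
  open Complex R
  open ComplexNumbers R
  open ElementaryFunctions E
  open Exponential R E

  fromℤ≈ιℤ : ∀ i → fromℤ i ≈ ιℤ i
  fromℤ≈ιℤ (+ n)    = refl
  fromℤ≈ιℤ -[1+ n ] = refl

  fromℤ-+ : ∀ i j → fromℤ (i ℤ.+ j) ≈ fromℤ i + fromℤ j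
  fromℤ-+ i j = trans (fromℤ≈ιℤ (i ℤ.+ j)) (trans (⟦⟧-+ i j) (sym (+-cong (fromℤ≈ιℤ i) (fromℤ≈ιℤ j))))

  fromℤ-* : ∀ i j → fromℤ (i ℤ.* j) ≈ fromℤ i * fromℤ j
  fromℤ-* i j = trans (fromℤ≈ιℤ (i ℤ.* j)) (trans (⟦⟧-* i j) (sym (*-cong (fromℤ≈ιℤ i) (fromℤ≈ιℤ j))))

  fromℤ-neg : ∀ i → fromℤ (ℤ.- i) ≈ - fromℤ i
  fromℤ-neg i = trans (fromℤ≈ιℤ (ℤ.- i)) (trans (⟦⟧-neg i) (sym (-‿cong (fromℤ≈ιℤ i))))

  -- `y ≉ 0` is a bare negation and yields no inverse. But `x ≈ 0` may be proved by refuting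
  -- `0# < x * x`, and under that assumption `x * x` can be cancelled from `x² y² ≈ 0`.
  product≈0⇒ : ∀ {x y} → x * y ≈ 0# → ¬ (y ≈ 0#) → x ≈ 0#
  product≈0⇒ {x} {y} xy≈0 y≉0 = square≤0⇒≈0 λ 0<x² → y≉0 (square≤0⇒≈0 (*-cancelˡ-≤ 0<x²
    (≤-reflexive (trans (solve 2 (λ x y → (x :* x) :* (y :* y) := (x :* y) :* (x :* y)) refl x y)
      (trans (*-cong xy≈0 xy≈0) (trans (zeroˡ 0#) (sym (zeroʳ _))))))))

  productℂ≈0⇒ : ∀ {w z} → w *ℂ z ≈ℂ 0ℂ → ¬ (z ≈ℂ 0ℂ) → w ≈ℂ 0ℂ
  productℂ≈0⇒ {w} {z} wz≈0 z≉0 = ∣∣²≤0⇒≈0 {w} (≤-reflexive (product≈0⇒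
    (trans (sym (∣∣²-* w z)) (trans (∣∣²-cong {w *ℂ z} {0ℂ} wz≈0) (trans (∣ofReal∣² 0#) (zeroˡ 0#))))
    (λ ∣z∣²≈0 → z≉0 (∣∣²≤0⇒≈0 {z} (≤-reflexive ∣z∣²≈0)))))

  cis : ℝ → ℂ
  cis t = exp (0# +i t)

  cis-+ : ∀ s t → cis (s + t) ≈ℂ cis s *ℂ cis t
  cis-+ s t = ℂR.trans {cis (s + t)} {exp ((0# +i s) +ℂ (0# +i t))}
    (exp-cong {0# +i (s + t)} {(0# +i s) +ℂ (0# +i t)} (sym (+-identityˡ 0#) , refl)) (exp-+ (0# +i s) (0# +i t))

  cis-cong : ∀ {s t} → s ≈ t → cis s ≈ℂ cis t
  cis-cong {s} {t} s≈t = exp-cong {0# +i s} {0# +i t} (refl , s≈t)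

  -- The conjugate of `cis t` is `cis (- t)`, so the functional equation reduces the product of the
  -- two to `exp 0ℂ`.
  ∣cis∣² : ∀ t → ∣ cis t ∣² ≈ 1#
  ∣cis∣² t = trans (solve 2 (λ a b → a :* a :+ b :* b := a :* a :- b :* :- b) refl (re (cis t)) (im (cis t)))
    (proj₁ (ℂR.trans {cis t *ℂ conj (cis t)} {cis t *ℂ cis (- t)} (ℂR.*-congˡ {cis t} {conj (cis t)} {cis (- t)} (ℂR.sym {cis (- t)} {conj (cis t)} (exp-conj (0# +i t))))
      (ℂR.trans {cis t *ℂ cis (- t)} {cis (t - t)} (ℂR.sym {cis (t - t)} {cis t *ℂ cis (- t)} (cis-+ t (- t)))
        (ℂR.trans {cis (t - t)} {exp 0ℂ} (exp-cong {0# +i (t - t)} {0ℂ} (refl , -‿inverseʳ t)) exp-0))))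

  e-cong : ∀ {s t} → s ≈ t → e s ≈ℂ e t
  e-cong s≈t = cis-cong (*-congˡ s≈t)

  e-+ : ∀ s t → e (s + t) ≈ℂ e s *ℂ e t
  e-+ s t = ℂR.trans {e (s + t)} {cis (fromℕ 2 * π * s + fromℕ 2 * π * t)} (cis-cong (distribˡ _ s t)) (cis-+ _ _)

  e-0 : e 0# ≈ℂ 1ℂ
  e-0 = ℂR.trans {e 0#} {exp 0ℂ} (exp-cong {0# +i (fromℕ 2 * π * 0#)} {0ℂ} (refl , zeroʳ _)) exp-0

  e-neg : ∀ t → e (- t) ≈ℂ conj (e t)
  e-neg t = ℂR.trans {e (- t)} {exp (conj (0# +i (fromℕ 2 * π * t)))}
    (exp-cong {0# +i (fromℕ 2 * π * - t)} {conj (0# +i (fromℕ 2 * π * t))} (refl , sym (-‿distribʳ-* _ t))) (exp-conj _)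

  e-half : ∀ t → e t ≈ℂ cis (π * t) *ℂ cis (π * t)
  e-half t = ℂR.trans {e t} {cis (π * t + π * t)}
    (cis-cong (solve 2 (λ p t → (con 1ℤ :+ (con 1ℤ :+ con ℤ.0ℤ)) :* p :* t := p :* t :+ p :* t) refl π t)) (cis-+ (π * t) (π * t))

  -- `cis π` is real because `sin π` vanishes, and has modulus one; whichever sign it has, its
  -- square is one.
  e-1 : e 1# ≈ℂ 1ℂ
  e-1 = ℂR.trans {e 1#} {u *ℂ u} (e-half 1#)
    ( trans (+-cong refl (-‿cong (trans (*-congʳ im≈0) (zeroˡ _)))) (trans (trans (+-congˡ -0#≈0#) (+-identityʳ _)) re²≈1)
    , trans (+-cong (trans (*-congˡ im≈0) (zeroʳ _)) (trans (*-congʳ im≈0) (zeroˡ _))) (+-identityˡ 0#))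
    where
    u = cis (π * 1#)
    im≈0 : im u ≈ 0#
    im≈0 = trans (proj₂ (cis-cong (*-identityʳ π))) sin-π
    re²≈1 : re u * re u ≈ 1#
    re²≈1 = trans (trans (sym (+-identityʳ _)) (+-congˡ (sym (trans (*-congʳ im≈0) (zeroˡ _))))) (∣cis∣² (π * 1#))

  e-fromℕ : ∀ n → e (fromℕ n) ≈ℂ 1ℂ
  e-fromℕ zero    = e-0
  e-fromℕ (suc n) = ℂR.trans {e (fromℕ (suc n))} {e 1# *ℂ e (fromℕ n)} (e-+ 1# (fromℕ n))
    (ℂR.trans {e 1# *ℂ e (fromℕ n)} {1ℂ *ℂ 1ℂ} (ℂR.*-cong {e 1#} {1ℂ} {e (fromℕ n)} {1ℂ} e-1 (e-fromℕ n)) (ℂR.*-identityˡ 1ℂ))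

  e-fromℤ : ∀ i → e (fromℤ i) ≈ℂ 1ℂ
  e-fromℤ (+ n)    = e-fromℕ n
  e-fromℤ -[1+ n ] = ℂR.trans {e (- fromℕ (suc n))} {conj (e (fromℕ (suc n)))} (e-neg (fromℕ (suc n)))
    (ℂR.trans {conj (e (fromℕ (suc n)))} {conj 1ℂ} (conj-cong {e (fromℕ (suc n))} {1ℂ} (e-fromℕ (suc n))) (refl , -0#≈0#))

  -- If e t = 1 with u = exp (π i t), then u² = 1 while im u = sin (π t) ≠ 0,
  -- which forces u² = - (im u)² ≤ 0.
  e≉1 : ∀ {t} → 0# < t → t < 1# → ¬ (e t ≈ℂ 1ℂ)
  e≉1 {t} 0<t t<1 et≈1 = u²≤0 (<-respʳ (sym (proj₁ u²≈1)) 0<1)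
    where
    u = cis (π * t)

    u²≈1 : u *ℂ u ≈ℂ 1ℂ
    u²≈1 = ℂR.trans {u *ℂ u} {e t} (ℂR.sym {e t} {u *ℂ u} (e-half t)) et≈1

    im≉0 : ¬ (im u ≈ 0#)
    im≉0 = π-least (π * t) (*-pos π-pos 0<t) (<-respʳ (*-identityʳ π) (*-monoˡ-< π-pos t<1))

    re≈0 : re u ≈ 0#
    re≈0 = product≈0⇒ (trans (sym (half+half _)) (trans (sym (distribʳ (inv 2) _ _))
      (trans (*-congʳ (trans (+-congˡ (*-comm (re u) (im u))) (proj₂ u²≈1))) (zeroˡ _)))) im≉0

    u²≤0 : re u * re u - im u * im u ≤ 0#
    u²≤0 = ≤-by (square-nonneg (im u)) (trans (solve 2 (λ a b → a :- b :+ b := a) refl _ _) (trans (*-congʳ re≈0) (zeroˡ _)))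

  e-^ : ∀ t n → e (fromℕ n * t) ≈ℂ e t ^ℂ n
  e-^ t zero    = ℂR.trans {e (0# * t)} {e 0#} (e-cong (zeroˡ t)) e-0
  e-^ t (suc n) = ℂR.trans {e (fromℕ (suc n) * t)} {e (t + fromℕ n * t)}
    (e-cong (solve 2 (λ n t → (con 1ℤ :+ n) :* t := t :+ n :* t) refl (fromℕ n) t))
    (ℂR.trans {e (t + fromℕ n * t)} {e t *ℂ e (fromℕ n * t)} (e-+ t (fromℕ n * t))
              (ℂR.*-congˡ {e t} {e (fromℕ n * t)} {e t ^ℂ n} (e-^ t n)))

  geometric : ∀ z n → (z -ℂ 1ℂ) *ℂ ℂΣ.Σ< n (z ^ℂ_) ≈ℂ (z ^ℂ n) -ℂ 1ℂ
  geometric z zero    = ℂR.trans {(z -ℂ 1ℂ) *ℂ 0ℂ} {0ℂ} (ℂR.zeroʳ (z -ℂ 1ℂ)) (ℂR.sym {1ℂ -ℂ 1ℂ} {0ℂ} (ℂR.-‿inverseʳ 1ℂ))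
  geometric z (suc n) =
    ℂR.trans {j = (z -ℂ 1ℂ) *ℂ (S +ℂ (z ^ℂ n))} (ℂR.*-congˡ {z -ℂ 1ℂ} {ℂΣ.Σ< (suc n) (z ^ℂ_)} {S +ℂ (z ^ℂ n)} (ℂΣ.Σ<-snoc n (z ^ℂ_)))
    (ℂR.trans {j = (z -ℂ 1ℂ) *ℂ S +ℂ (z -ℂ 1ℂ) *ℂ (z ^ℂ n)} (ℂR.distribˡ (z -ℂ 1ℂ) S (z ^ℂ n))
    (ℂR.trans {j = ((z ^ℂ n) -ℂ 1ℂ) +ℂ (z -ℂ 1ℂ) *ℂ (z ^ℂ n)} (ℂR.+-congʳ {(z -ℂ 1ℂ) *ℂ (z ^ℂ n)} {(z -ℂ 1ℂ) *ℂ S} {(z ^ℂ n) -ℂ 1ℂ} (geometric z n))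
      (ℂS.solve 2 (λ z w → (w ℂS.:- ℂS.con 1ℤ) ℂS.:+ (z ℂS.:- ℂS.con 1ℤ) ℂS.:* w ℂS.:= z ℂS.:* w ℂS.:- ℂS.con 1ℤ) ℂR.refl z (z ^ℂ n))))
    where
    S = ℂΣ.Σ< n (z ^ℂ_)

  characterSum : ℕ → ℤ → ℂ
  characterSum q i = ℂΣ.Σ< q (λ p → e (fromℕ p * (inv q * fromℤ i)))

  inv*multiple : ∀ q .{{_ : NonZero q}} i → inv q * fromℤ (i ℤ.* + q) ≈ fromℤ i
  inv*multiple q i = trans (*-congˡ (fromℤ-* i (+ q)))
    (trans (solve 3 (λ n i x → x :* (i :* n) := (n :* x) :* i) refl (fromℕ q) (fromℤ i) (inv q))
    (trans (*-congʳ (inv-inverseʳ q)) (*-identityˡ _)))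

  characterSum-∣ : ∀ q .{{_ : NonZero q}} i → (+ q) ℤ∣.∣ i → characterSum q i ≈ℂ ofReal (fromℕ q)
  characterSum-∣ q i q∣i with Signed.∣ᵤ⇒∣ {+ q} {i} q∣i
  ... | Signed.divides d ≡.refl = go q (λ p → e (fromℕ p * (inv q * fromℤ (d ℤ.* + q)))) λ p →
    ℂR.trans {e (fromℕ p * (inv q * fromℤ (d ℤ.* + q)))} {e (fromℤ (+ p ℤ.* d))}
      (e-cong (trans (*-congˡ (inv*multiple q d)) (sym (fromℤ-* (+ p) d)))) (e-fromℤ (+ p ℤ.* d))
    where
    go : ∀ n u → (∀ p → u p ≈ℂ 1ℂ) → ℂΣ.Σ< n u ≈ℂ ofReal (fromℕ n)
    go zero    u u≈1 = refl , refl
    go (suc n) u u≈1 = let a , b = u≈1 0 ; c , d = go n (u ∘ suc) (u≈1 ∘ suc) in +-cong a c , trans (+-cong b d) (+-identityˡ 0#)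

  -- The sum is geometric with ratio `η`, and `η ^ℂ q` is one. Replacing `i` by its nonzero
  -- remainder modulo `q` moves the argument of `e` strictly between 0 and 1, where `e≉1` gives
  -- `η ≠ 1`; hence the sum vanishes.
  characterSum-∤ : ∀ q .{{_ : NonZero q}} i → ¬ ((+ q) ℤ∣.∣ i) → characterSum q i ≈ℂ 0ℂ
  characterSum-∤ q i q∤i =
    ℂR.trans {characterSum q i} {ℂΣ.Σ< q (η ^ℂ_)} (ℂΣ.Σ<-cong q {λ p → e (fromℕ p * x)} {η ^ℂ_} (λ p _ → e-^ x p))
      (productℂ≈0⇒ {ℂΣ.Σ< q (η ^ℂ_)} {η -ℂ 1ℂ}
        (ℂR.trans {ℂΣ.Σ< q (η ^ℂ_) *ℂ (η -ℂ 1ℂ)} {(η -ℂ 1ℂ) *ℂ ℂΣ.Σ< q (η ^ℂ_)} (ℂR.*-comm (ℂΣ.Σ< q (η ^ℂ_)) (η -ℂ 1ℂ))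
          (ℂR.trans {(η -ℂ 1ℂ) *ℂ ℂΣ.Σ< q (η ^ℂ_)} {(η ^ℂ q) -ℂ 1ℂ} (geometric η q)
            (trans (+-congʳ (proj₁ η^q≈1)) (-‿inverseʳ _) , trans (+-congʳ (proj₂ η^q≈1)) (-‿inverseʳ _))))
        (λ η-1≈0 → e≉1 0<ρ ρ<1 (ℂR.trans {e ρ} {η} (ℂR.sym {η} {e ρ} η≈) (η≈1 η-1≈0))))
    where
    x = inv q * fromℤ i
    η = e x
    r = i ℤD.%ℕ q
    d = i ℤD./ℕ q
    ρ = inv q * fromℕ r

    i≡ : i ≡ + r ℤ.+ d ℤ.* + q
    i≡ = ℤD.a≡a%ℕn+[a/ℕn]*n i q

    x≈ : x ≈ ρ + fromℤ d
    x≈ = trans (*-congˡ (trans (reflexive (≡.cong fromℤ i≡)) (fromℤ-+ (+ r) (d ℤ.* + q))))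
      (trans (distribˡ (inv q) _ _) (+-congˡ (inv*multiple q d)))

    η≈ : η ≈ℂ e ρ
    η≈ = ℂR.trans {η} {e (ρ + fromℤ d)} (e-cong x≈) (ℂR.trans {e (ρ + fromℤ d)} {e ρ *ℂ e (fromℤ d)} (e-+ ρ (fromℤ d))
      (ℂR.trans {e ρ *ℂ e (fromℤ d)} {e ρ *ℂ 1ℂ} (ℂR.*-congˡ {e ρ} {e (fromℤ d)} {1ℂ} (e-fromℤ d)) (ℂR.*-identityʳ (e ρ))))

    η^q≈1 : (η ^ℂ q) ≈ℂ 1ℂ
    η^q≈1 = ℂR.trans {η ^ℂ q} {e (fromℕ q * x)} (ℂR.sym {e (fromℕ q * x)} {η ^ℂ q} (e-^ x q))
      (ℂR.trans {e (fromℕ q * x)} {e (fromℤ i)}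
        (e-cong (trans (sym (*-assoc _ _ _)) (trans (*-congʳ (inv-inverseʳ q)) (*-identityˡ _)))) (e-fromℤ i))

    η≈1 : (η -ℂ 1ℂ) ≈ℂ 0ℂ → η ≈ℂ 1ℂ
    η≈1 (a , b) = back a , back b
      where
      back : ∀ {a b} → a - b ≈ 0# → a ≈ b
      back {a} {b} a-b≈0 = trans (solve 2 (λ a b → a := (a :- b) :+ b) refl a b) (trans (+-congʳ a-b≈0) (+-identityˡ b))

    r≢0 : ¬ (r ≡ 0)
    r≢0 r≡0 = q∤i (Signed.∣⇒∣ᵤ {+ q} {i} (Signed.divides d (≡.trans i≡ (≡.trans (≡.cong (λ r → + r ℤ.+ d ℤ.* + q) r≡0) (ℤP.+-identityˡ _)))))

    0<ρ : 0# < ρ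
    0<ρ = *-pos (inv-pos q) (fromℕ-pos r {{ℕ.≢-nonZero r≢0}})

    ρ<1 : ρ < 1#
    ρ<1 = <-respʳ (trans (*-comm _ _) (inv-inverseʳ q)) (*-monoˡ-< (inv-pos q)
      (<-≤-trans (<-by 0<1 (+-comm _ 1#)) (fromℕ-mono-≤ (ℤD.n%ℕd<d i q))))

-- Polynomial congruences modulo prime powers.

module PolynomialCongruences where
  open ℕ∣ using (_∣_)
  open +-*-Solver using (solve; _:=_; _:+_; _:*_; _:-_; :-_; con)

  -- Degree-k polynomial functions with leading coefficient c, described by
  -- their divided differences.
  PolynomialFunction : ℕ → ℤ → (ℤ → ℤ) → Set
  PolynomialFunction zero    c f = ∀ x → f x ≡ c
  PolynomialFunction (suc k) c f =
    ∀ y → ∃[ g ] (PolynomialFunction k c g × (∀ x → f x ℤ.- f y ≡ (x ℤ.- y) ℤ.* g x))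

  polynomialFunction-cong : ∀ k {c f g} → (∀ x → f x ≡ g x) → PolynomialFunction k c f → PolynomialFunction k c g
  polynomialFunction-cong zero    f≗g pf x = ≡.trans (≡.sym (f≗g x)) (pf x)
  polynomialFunction-cong (suc k) f≗g pf y with pf y
  ... | h , ph , eq = h , ph , λ x → ≡.trans (cong₂ ℤ._-_ (≡.sym (f≗g x)) (≡.sym (f≗g y))) (eq x)

  -- The divided difference of `x * g x` at `y` is `g x + y * g₁ x`, where `g₁` has smaller degree
  -- than `g`. Sums of this shape have to keep the leading coefficient of `g`.
  add-lower : ∀ k {c d g h} a → PolynomialFunction (suc k) c g → PolynomialFunction k d h →
              PolynomialFunction (suc k) c (λ x → g x ℤ.+ a ℤ.* h x)
  add-lower zero {g = g} {h} a pg ph y with pg y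
  ... | g₁ , pg₁ , eq = g₁ , pg₁ , λ x → ≡.trans
    (≡.trans (cong (λ v → (g x ℤ.+ a ℤ.* h x) ℤ.- (g y ℤ.+ a ℤ.* v)) (≡.trans (ph y) (≡.sym (ph x))))
             (solve 3 (λ u v w → (u :+ w) :- (v :+ w) := u :- v) ≡.refl (g x) (g y) (a ℤ.* h x)))
    (eq x)
  add-lower (suc k) {g = g} {h} a pg ph y with pg y | ph y
  ... | g₁ , pg₁ , eq | h₁ , ph₁ , eq′ = (λ x → g₁ x ℤ.+ a ℤ.* h₁ x) , add-lower k {g = g₁} a pg₁ ph₁ , λ x → begin
      (g x ℤ.+ a ℤ.* h x) ℤ.- (g y ℤ.+ a ℤ.* h y)
        ≡⟨ solve 5 (λ a u v w z → (u :+ a :* w) :- (v :+ a :* z) := (u :- v) :+ a :* (w :- z)) ≡.refl a (g x) (g y) (h x) (h y) ⟩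
      (g x ℤ.- g y) ℤ.+ a ℤ.* (h x ℤ.- h y)
        ≡⟨ cong₂ (λ u v → u ℤ.+ a ℤ.* v) (eq x) (eq′ x) ⟩
      (x ℤ.- y) ℤ.* g₁ x ℤ.+ a ℤ.* ((x ℤ.- y) ℤ.* h₁ x)
        ≡⟨ solve 4 (λ a d u v → d :* u :+ a :* (d :* v) := d :* (u :+ a :* v)) ≡.refl a (x ℤ.- y) (g₁ x) (h₁ x) ⟩
      (x ℤ.- y) ℤ.* (g₁ x ℤ.+ a ℤ.* h₁ x)
        ∎
    where open ≡.≡-Reasoning

  multiply-by-variable : ∀ k {c g} → PolynomialFunction k c g → PolynomialFunction (suc k) c (λ x → x ℤ.* g x)
  multiply-by-variable zero {g = g} pg y = g , pg , λ x → ≡.trans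
    (cong (λ v → x ℤ.* g x ℤ.- y ℤ.* v) (≡.trans (pg y) (≡.sym (pg x))))
    (solve 3 (λ x y v → x :* v :- y :* v := (x :- y) :* v) ≡.refl x y (g x))
  multiply-by-variable (suc k) {g = g} pg y with pg y
  ... | g₁ , pg₁ , eq = (λ x → g x ℤ.+ y ℤ.* g₁ x) , add-lower k {g = g} y pg pg₁ , λ x → begin
      x ℤ.* g x ℤ.- y ℤ.* g y
        ≡⟨ solve 4 (λ x y u v → x :* u :- y :* v := (x :- y) :* u :+ y :* (u :- v)) ≡.refl x y (g x) (g y) ⟩
      (x ℤ.- y) ℤ.* g x ℤ.+ y ℤ.* (g x ℤ.- g y)
        ≡⟨ cong (λ v → (x ℤ.- y) ℤ.* g x ℤ.+ y ℤ.* v) (eq x) ⟩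
      (x ℤ.- y) ℤ.* g x ℤ.+ y ℤ.* ((x ℤ.- y) ℤ.* g₁ x)
        ≡⟨ solve 4 (λ y d u v → d :* u :+ y :* (d :* v) := d :* (u :+ y :* v)) ≡.refl y (x ℤ.- y) (g x) (g₁ x) ⟩
      (x ℤ.- y) ℤ.* (g x ℤ.+ y ℤ.* g₁ x)
        ∎
    where open ≡.≡-Reasoning

  monomial : ∀ k c → PolynomialFunction k c (λ x → c ℤ.* x ℤ.^ k)
  monomial zero    c x = ℤP.*-identityʳ c
  monomial (suc k) c   = polynomialFunction-cong (suc k)
    (λ x → solve 3 (λ c x w → x :* (c :* w) := c :* (x :* w)) ≡.refl c x (x ℤ.^ k))
    (multiply-by-variable k (monomial k c))

  evalPoly-polynomialFunction : ∀ k (c : Vector ℤ (suc k)) → PolynomialFunction k (head c) (evalPoly c)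
  evalPoly-polynomialFunction zero    c x = ≡.trans (ℤP.+-identityʳ _) (ℤP.*-identityʳ _)
  evalPoly-polynomialFunction (suc k) c   = polynomialFunction-cong (suc k)
    (λ x → cong (λ v → head c ℤ.* x ℤ.^ suc k ℤ.+ v) (ℤP.*-identityˡ (evalPoly (tail c) x)))
    (add-lower k {g = λ x → head c ℤ.* x ℤ.^ suc k} 1ℤ (monomial (suc k) (head c)) (evalPoly-polynomialFunction k (tail c)))

  subtract-constant : ∀ k {c f} r → PolynomialFunction (suc k) c f → PolynomialFunction (suc k) c (λ x → f x ℤ.- r)
  subtract-constant k {f = f} r pf y with pf y
  ... | g , pg , eq = g , pg , λ x →
    ≡.trans (solve 3 (λ u v r → (u :- r) :- (v :- r) := u :- v) ≡.refl (f x) (f y) r) (eq x)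

  ∣-+ : ∀ {d a b} → d ∣ ∣ a ∣ → d ∣ ∣ b ∣ → d ∣ ∣ a ℤ.+ b ∣
  ∣-+ {d} {a} {b} d∣a d∣b = Signed.∣⇒∣ᵤ {+ d} (Signed.∣m∣n⇒∣m+n (Signed.∣ᵤ⇒∣ {+ d} {a} d∣a) (Signed.∣ᵤ⇒∣ {+ d} {b} d∣b))

  ∣-neg : ∀ {d a} → d ∣ ∣ a ∣ → d ∣ ∣ ℤ.- a ∣
  ∣-neg {d} {a} = subst (d ∣_) (≡.sym (ℤP.∣-i∣≡∣i∣ a))

  ∣-- : ∀ {d a b} → d ∣ ∣ a ∣ → d ∣ ∣ b ∣ → d ∣ ∣ a ℤ.- b ∣
  ∣-- {d} {a} {b} d∣a d∣b = ∣-+ {d} {a} {ℤ.- b} d∣a (∣-neg {d} {b} d∣b)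

  ^-monoʳ-∣ : ∀ p {m n} → m ℕ.≤ n → p ℕ.^ m ∣ p ℕ.^ n
  ^-monoʳ-∣ p {m} {n} m≤n = subst (p ℕ.^ m ∣_)
    (≡.trans (≡.sym (ℕP.^-distribˡ-+-* p m (n ∸ m))) (cong (p ℕ.^_) (ℕP.m+[n∸m]≡n m≤n)))
    (ℕ∣.m∣m*n (p ℕ.^ (n ∸ m)))

  module _ {p : ℕ} (p-prime : Prime p) where
    private instance p≢0 = prime⇒nonZero p-prime

    prime-power-cancel : ∀ j {a b} → p ℕ.^ j ∣ a ℕ.* b → ¬ (p ∣ a) → p ℕ.^ j ∣ b
    prime-power-cancel zero    {b = b} _ _ = ℕ∣.1∣ b
    prime-power-cancel (suc j) {a} {b} p^j+1∣ab p∤a with euclidsLemma a b p-prime (ℕ∣.∣-trans (ℕ∣.m∣m*n (p ℕ.^ j)) p^j+1∣ab)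
    ... | inj₁ p∣a = ⊥-elim (p∤a p∣a)
    ... | inj₂ (divides b′ ≡.refl) = subst (p ℕ.* p ℕ.^ j ∣_) (ℕP.*-comm p b′) (ℕ∣.*-monoʳ-∣ p
      (prime-power-cancel j {a} {b′} (ℕ∣.*-cancelˡ-∣ p (subst (p ℕ.* p ℕ.^ j ∣_)
        (≡.trans (≡.sym (ℕP.*-assoc a b′ p)) (ℕP.*-comm (a ℕ.* b′) p)) p^j+1∣ab)) p∤a))

    -- At most `m` factors `p` can be absorbed by `a`, so the remaining ones fall on `b`.
    prime-power-divides-cofactor : ∀ m j {a b} → p ℕ.^ j ∣ a ℕ.* b → ¬ (p ℕ.^ suc m ∣ a) → p ℕ.^ (j ∸ m) ∣ b
    prime-power-divides-cofactor zero j {a} p^j∣ab p∤a = prime-power-cancel j p^j∣ab (p∤a ∘ subst (_∣ a) (≡.sym (ℕP.*-identityʳ p)))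
    prime-power-divides-cofactor (suc m) zero {b = b} _ _ = ℕ∣.1∣ b
    prime-power-divides-cofactor (suc m) (suc j) {a} {b} p^j+1∣ab p^m+2∤a with p ∣? a
    ... | no p∤a = ℕ∣.∣-trans (^-monoʳ-∣ p (ℕP.≤-trans (ℕP.m∸n≤m j m) (ℕP.n≤1+n j))) (prime-power-cancel (suc j) p^j+1∣ab p∤a)
    ... | yes (divides a′ ≡.refl) = prime-power-divides-cofactor m j {a′} {b}
      (ℕ∣.*-cancelˡ-∣ p (subst (p ℕ.* p ℕ.^ j ∣_)
        (≡.trans (cong (ℕ._* b) (ℕP.*-comm a′ p)) (ℕP.*-assoc p a′ b)) p^j+1∣ab))
      (λ p^m+1∣a′ → p^m+2∤a (subst (p ℕ.* p ℕ.^ suc m ∣_) (ℕP.*-comm p a′) (ℕ∣.*-monoʳ-∣ p p^m+1∣a′)))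

    -- A root modulo p ^ j that is not close to the root x₁ is a root modulo
    -- p ^ (j - m) of the divided difference at x₁, which has lower degree.
    root-classes : ∀ k m j {c f} → PolynomialFunction k c f → ¬ (p ∣ ∣ c ∣) → k ℕ.* m ℕ.< j →
                   ∀ xs → (∀ {x} → x ∈ xs → p ℕ.^ j ∣ ∣ f x ∣) →
                   ∃[ l ] (length l ℕ.≤ k × (∀ {z} → z ∈ l → z ∈ xs) ×
                           (∀ {x} → x ∈ xs → ∃[ z ] (z ∈ l × p ℕ.^ suc m ∣ ∣ x ℤ.- z ∣)))
    root-classes k m j pf p∤c km<j [] roots = [] , z≤n , (λ z∈[] → z∈[]) , λ ()
    root-classes zero m (suc j) pf p∤c km<j (x ∷ xs) roots =
      ⊥-elim (p∤c (ℕ∣.∣-trans (ℕ∣.m∣m*n (p ℕ.^ j)) (subst (λ v → p ℕ.^ suc j ∣ ∣ v ∣) (pf x) (roots (here ≡.refl)))))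
    root-classes (suc k) m j {f = f} pf p∤c km<j xs@(x₁ ∷ _) roots
      with pf x₁
    ... | g , pg , eq with root-classes k m (j ∸ m) pg p∤c
                             (ℕP.m+n≤o⇒m≤o∸n (suc (k ℕ.* m)) (subst (λ v → suc v ℕ.≤ j) (ℕP.+-comm m (k ℕ.* m)) km<j)) ys ys-roots
      where
      far? : Decidable (λ x → ¬ (p ℕ.^ suc m ∣ ∣ x ℤ.- x₁ ∣))
      far? x = ¬? (p ℕ.^ suc m ∣? ∣ x ℤ.- x₁ ∣)

      ys : List ℤ
      ys = filter far? xs

      ys-roots : ∀ {x} → x ∈ ys → p ℕ.^ (j ∸ m) ∣ ∣ g x ∣
      ys-roots {x} x∈ys with ∈-filter⁻ far? {xs = xs} x∈ys
      ... | x∈xs , far = prime-power-divides-cofactor m j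
        (subst (p ℕ.^ j ∣_) (≡.trans (cong ∣_∣ (eq x)) (ℤP.abs-* (x ℤ.- x₁) (g x)))
          (∣-- {a = f x} {f x₁} (roots x∈xs) (roots (here ≡.refl)))) far
    ...   | l , |l|≤k , l⊆ys , covers = x₁ ∷ l , s≤s |l|≤k , l⊆xs , covers′
      where
      far? : Decidable (λ x → ¬ (p ℕ.^ suc m ∣ ∣ x ℤ.- x₁ ∣))
      far? x = ¬? (p ℕ.^ suc m ∣? ∣ x ℤ.- x₁ ∣)

      l⊆xs : ∀ {z} → z ∈ x₁ ∷ l → z ∈ xs
      l⊆xs (here ≡.refl) = here ≡.refl
      l⊆xs (there z∈l)   = proj₁ (∈-filter⁻ far? {xs = xs} (l⊆ys z∈l))

      covers′ : ∀ {x} → x ∈ xs → ∃[ z ] (z ∈ x₁ ∷ l × p ℕ.^ suc m ∣ ∣ x ℤ.- z ∣)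
      covers′ {x} x∈xs with p ℕ.^ suc m ∣? ∣ x ℤ.- x₁ ∣
      ... | yes near = x₁ , here ≡.refl , near
      ... | no far with covers (∈-filter⁺ far? x∈xs far)
      ...   | z , z∈l , p∣x-z = z , there z∈l , p∣x-z

  -- The solutions of f(x) ≡ r (mod t) lie in at most c residue classes modulo d.
  -- Quantifying over finite lists of solutions makes the classes computable
  -- without a search.
  SolutionsCovered : (ℤ → ℤ) → ℕ → ℕ → ℕ → Set
  SolutionsCovered f t c d = ∀ r xs → (∀ {x} → x ∈ xs → t ∣ ∣ f x ℤ.- r ∣) →
    ∃[ l ] (length l ℕ.≤ c × (∀ {x} → x ∈ xs → ∃[ z ] (z ∈ l × d ∣ ∣ x ℤ.- z ∣)))

  covered-1 : ∀ f → SolutionsCovered f 1 1 1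
  covered-1 f r xs _ = 0ℤ ∷ [] , ℕP.≤-refl , λ {x} _ → 0ℤ , here ≡.refl , ℕ∣.1∣ _

  -- Meant for primes dividing the leading coefficient: a larger modulus only removes solutions, so
  -- the old classes still cover, with no gain in `d`.
  covered-multiple : ∀ {f t c d} s → SolutionsCovered f t c d → SolutionsCovered f (t ℕ.* s) c d
  covered-multiple s cov r xs sol = cov r xs (λ x∈xs → ℕ∣.∣-trans (ℕ∣.m∣m*n s) (sol x∈xs))

  ∣-coprime-* : ∀ {p} → Prime p → ∀ s {d a} → d ∣ a → p ℕ.^ s ∣ a → ¬ (p ∣ d) → d ℕ.* p ℕ.^ s ∣ a
  ∣-coprime-* {p} p-prime s {d} (divides b ≡.refl) p^s∣bd p∤d = subst (d ℕ.* p ℕ.^ s ∣_) (ℕP.*-comm d b)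
    (ℕ∣.*-monoʳ-∣ d (prime-power-cancel p-prime s (subst (p ℕ.^ s ∣_) (ℕP.*-comm b d) p^s∣bd) p∤d))

  -- Each old class modulo `d` is refined on its own. Its members among the solutions are roots of
  -- `f x - r` modulo `p ^ j`, which occupy at most `suc k` classes modulo `p ^ suc m`; since
  -- `p ∤ d`, the two congruences combine into one modulo the product.
  covered-prime-power : ∀ k m j {a f t c d p} → PolynomialFunction (suc k) a f → Prime p → ¬ (p ∣ ∣ a ∣) → ¬ (p ∣ d) →
                        suc k ℕ.* m ℕ.< j → SolutionsCovered f t c d →
                        SolutionsCovered f (t ℕ.* p ℕ.^ j) (c ℕ.* suc k) (d ℕ.* p ℕ.^ suc m)
  covered-prime-power k m j {a} {f} {t} {c} {d} {p} pf p-prime p∤a p∤d km<j cov r xs sol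
    with cov r xs (λ x∈xs → ℕ∣.∣-trans (ℕ∣.m∣m*n (p ℕ.^ j)) (sol x∈xs))
  ... | l , |l|≤c , covers with refine l
    where
    refine : ∀ l → ∃[ L ] (length L ℕ.≤ length l ℕ.* suc k × (∀ {x y} → x ∈ xs → y ∈ l → d ∣ ∣ x ℤ.- y ∣ →
                             ∃[ z ] (z ∈ L × d ℕ.* p ℕ.^ suc m ∣ ∣ x ℤ.- z ∣)))
    refine [] = [] , z≤n , λ { _ () }
    refine (y ∷ l) with refine l
                      | root-classes p-prime (suc k) m j {f = λ x → f x ℤ.- r} (subtract-constant k {f = f} r pf) p∤a km<j (filter (λ x → d ∣? ∣ x ℤ.- y ∣) xs)
                          (λ x∈ → ℕ∣.∣-trans (ℕ∣.n∣m*n t) (sol (proj₁ (∈-filter⁻ (λ x → d ∣? ∣ x ℤ.- y ∣) {xs = xs} x∈))))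
    ... | L , |L|≤ , coversL | l′ , |l′|≤ , l′⊆ , covers′ = l′ ++ L ,
      ℕP.≤-trans (ℕP.≤-reflexive (ListP.length-++ l′)) (ℕP.+-mono-≤ |l′|≤ |L|≤) , both
      where
      near? : Decidable (λ x → d ∣ ∣ x ℤ.- y ∣)
      near? x = d ∣? ∣ x ℤ.- y ∣

      both : ∀ {x y′} → x ∈ xs → y′ ∈ y ∷ l → d ∣ ∣ x ℤ.- y′ ∣ → ∃[ z ] (z ∈ l′ ++ L × d ℕ.* p ℕ.^ suc m ∣ ∣ x ℤ.- z ∣)
      both x∈xs (there y′∈l) d∣ with coversL x∈xs y′∈l d∣
      ... | z , z∈L , div = z , ∈-++⁺ʳ l′ z∈L , div
      both {x} x∈xs (here ≡.refl) d∣x-y with covers′ (∈-filter⁺ near? x∈xs d∣x-y)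
      ... | z , z∈l′ , p∣x-z = z , ∈-++⁺ˡ z∈l′ , ∣-coprime-* p-prime (suc m) d∣x-z p∣x-z p∤d
        where
        -- The representatives were chosen among the solutions close to `y`, so `z` lies in the
        -- class of `y` modulo `d` as well.
        d∣x-z : d ∣ ∣ x ℤ.- z ∣
        d∣x-z = subst (λ v → d ∣ ∣ v ∣) (solve 3 (λ x y z → (x :- y) :- (z :- y) := x :- z) ≡.refl x y z)
          (∣-- {a = x ℤ.- y} {z ℤ.- y} d∣x-y (proj₂ (∈-filter⁻ near? {xs = xs} (l′⊆ z∈l′))))
  ...   | L , |L|≤ , coversL = L , ℕP.≤-trans |L|≤ (ℕP.*-monoˡ-≤ (suc k) |l|≤c) ,
    λ x∈xs → let y , y∈l , d∣ = covers x∈xs in coversL x∈xs y∈l d∣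

-- Counting solutions of a congruence in an interval.

module IntervalCounts where
  open ℕ∣ using (_∣_)
  open PolynomialCongruences
  open +-*-Solver using (solve; _:=_; _:+_; _:*_; _:-_; :-_; con)

  interval : ℤ → ℕ → List ℤ
  interval m zero    = []
  interval m (suc N) = m ∷ interval (ℤ.suc m) N

  near? : ∀ d y → Decidable (λ x → d ∣ ∣ x ℤ.- y ∣)
  near? d y x = d ∣? ∣ x ℤ.- y ∣

  private
    -- Here m + g is the first element of the residue class at or after m.
    class-count′ : ∀ d y N m g → g ℕ.< d → d ∣ ∣ (m ℤ.+ + g) ℤ.- y ∣ →
                   d ℕ.* length (filter (near? d y) (interval m N)) ℕ.+ suc g ℕ.≤ N ℕ.+ d
    class-count′ d y zero m g g<d _ rewrite ℕP.*-zeroʳ d = g<d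
    class-count′ d@(suc d-1) y (suc N) m zero g<d d∣
      rewrite ListP.filter-accept (near? d y) {x = m} {xs = interval (ℤ.suc m) N}
                (subst (λ v → d ∣ ∣ v ℤ.- y ∣) (ℤP.+-identityʳ m) d∣) = begin
      d ℕ.* suc n ℕ.+ 1            ≡⟨ cong (ℕ._+ 1) (ℕP.*-suc d n) ⟩
      d ℕ.+ d ℕ.* n ℕ.+ 1          ≡⟨ cong (ℕ._+ 1) (ℕP.+-comm d (d ℕ.* n)) ⟩
      d ℕ.* n ℕ.+ d ℕ.+ 1          ≤⟨ ℕP.+-monoˡ-≤ 1 (class-count′ d y N (ℤ.suc m) d-1 ℕP.≤-refl d∣′) ⟩
      N ℕ.+ d ℕ.+ 1                ≡⟨ ℕP.+-comm (N ℕ.+ d) 1 ⟩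
      suc N ℕ.+ d                  ∎
      where
      open ℕP.≤-Reasoning
      n = length (filter (near? d y) (interval (ℤ.suc m) N))
      d∣′ : d ∣ ∣ (ℤ.suc m ℤ.+ + d-1) ℤ.- y ∣
      d∣′ = subst (λ v → d ∣ ∣ v ∣)
        (≡.trans (cong (λ v → ((m ℤ.+ + 0) ℤ.- y) ℤ.+ v) (ℤP.pos-+ 1 d-1))
          (solve 3 (λ m y e → ((m :+ con 0ℤ) :- y) :+ (con 1ℤ :+ e) := ((con 1ℤ :+ m) :+ e) :- y) ≡.refl m y (+ d-1)))
        (∣-+ {a = (m ℤ.+ + 0) ℤ.- y} {+ d} d∣ ℕ∣.∣-refl)
    class-count′ d y (suc N) m (suc g) g<d d∣ = begin
      d ℕ.* length (filter (near? d y) (interval m (suc N))) ℕ.+ suc (suc g)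
        ≡⟨ cong (λ l → d ℕ.* length l ℕ.+ suc (suc g)) (ListP.filter-reject (near? d y) {x = m} {xs = interval (ℤ.suc m) N} miss) ⟩
      d ℕ.* n ℕ.+ suc (suc g)      ≡⟨ ℕP.+-suc (d ℕ.* n) (suc g) ⟩
      suc (d ℕ.* n ℕ.+ suc g)      ≤⟨ s≤s (class-count′ d y N (ℤ.suc m) g (ℕP.<-trans (ℕP.n<1+n g) g<d) d∣′) ⟩
      suc N ℕ.+ d                  ∎
      where
      open ℕP.≤-Reasoning
      n = length (filter (near? d y) (interval (ℤ.suc m) N))
      d∣′ : d ∣ ∣ (ℤ.suc m ℤ.+ + g) ℤ.- y ∣
      d∣′ = subst (λ v → d ∣ ∣ v ℤ.- y ∣)
        (≡.trans (cong (λ v → m ℤ.+ v) (ℤP.pos-+ 1 g)) (solve 2 (λ m g → m :+ (con 1ℤ :+ g) := (con 1ℤ :+ m) :+ g) ≡.refl m (+ g))) d∣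
      miss : ¬ (d ∣ ∣ m ℤ.- y ∣)
      miss d∣m-y = ℕ∣.>⇒∤ g<d (subst (λ v → d ∣ ∣ v ∣)
        (solve 3 (λ m y g → ((m :+ g) :- y) :- (m :- y) := g) ≡.refl m y (+ suc g))
        (∣-- {a = (m ℤ.+ + suc g) ℤ.- y} {m ℤ.- y} d∣ d∣m-y))

  class-count : ∀ d .{{_ : NonZero d}} y m N → d ℕ.* length (filter (near? d y) (interval m N)) ℕ.≤ N ℕ.+ d
  class-count d y m N = ℕP.≤-trans (ℕP.m≤m+n _ (suc g)) (class-count′ d y N m g (ℤD.n%ℕd<d (y ℤ.- m) d) d∣)
    where
    g = (y ℤ.- m) ℤD.%ℕ d
    w = (y ℤ.- m) ℤD./ℕ d
    d∣ : d ∣ ∣ (m ℤ.+ + g) ℤ.- y ∣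
    d∣ = subst (λ v → d ∣ ∣ v ∣)
      (≡.trans (solve 4 (λ m y g v → :- v := (m :+ g) :- (m :+ (g :+ v))) ≡.refl m y (+ g) (w ℤ.* + d))
        (≡.trans (cong (λ v → (m ℤ.+ + g) ℤ.- (m ℤ.+ v)) (≡.sym (ℤD.a≡a%ℕn+[a/ℕn]*n (y ℤ.- m) d)))
                 (solve 3 (λ m y g → (m :+ g) :- (m :+ (y :- m)) := (m :+ g) :- y) ≡.refl m y (+ g))))
      (∣-neg {a = w ℤ.* + d} (Signed.∣⇒∣ᵤ {+ d} (Signed.divides w ≡.refl)))

  length-filter-filter : ∀ {p q} {P : Pred ℤ p} {Q : Pred ℤ q} (P? : Decidable P) (Q? : Decidable Q) xs →
                         length (filter P? (filter Q? xs)) ℕ.≤ length (filter P? xs)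
  length-filter-filter P? Q? [] = z≤n
  length-filter-filter P? Q? (x ∷ xs) with Q? x
  ... | yes _ with P? x
  ...   | yes _ = s≤s (length-filter-filter P? Q? xs)
  ...   | no _  = length-filter-filter P? Q? xs
  length-filter-filter P? Q? (x ∷ xs) | no _ with P? x
  ...   | yes _ = ℕP.m≤n⇒m≤1+n (length-filter-filter P? Q? xs)
  ...   | no _  = length-filter-filter P? Q? xs

  length-filter-¬ : ∀ {p} {P : Pred ℤ p} (P? : Decidable P) xs →
                    length xs ≡ length (filter P? xs) ℕ.+ length (filter (¬? ∘ P?) xs)
  length-filter-¬ P? [] = ≡.refl
  length-filter-¬ P? (x ∷ xs) with P? x
  ... | yes _ = cong suc (length-filter-¬ P? xs)
  ... | no _  = ≡.trans (cong suc (length-filter-¬ P? xs)) (≡.sym (ℕP.+-suc _ _))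

  -- The elements congruent to the first representative are removed and the rest is covered by the
  -- remaining ones; the bound on each class survives because it is inherited by sublists.
  covered-length : ∀ d B l xs → (∀ y → d ℕ.* length (filter (near? d y) xs) ℕ.≤ B) →
                   (∀ {x} → x ∈ xs → ∃[ z ] (z ∈ l × d ∣ ∣ x ℤ.- z ∣)) →
                   d ℕ.* length xs ℕ.≤ length l ℕ.* B
  covered-length d B [] []       thin covers rewrite ℕP.*-zeroʳ d = z≤n
  covered-length d B [] (x ∷ xs) thin covers with covers (here ≡.refl)
  ... | _ , () , _
  covered-length d B (y ∷ l) xs thin covers = begin
    d ℕ.* length xs
      ≡⟨ cong (d ℕ.*_) (length-filter-¬ (near? d y) xs) ⟩
    d ℕ.* (length (filter (near? d y) xs) ℕ.+ length far)
      ≡⟨ ℕP.*-distribˡ-+ d _ _ ⟩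
    d ℕ.* length (filter (near? d y) xs) ℕ.+ d ℕ.* length far
      ≤⟨ ℕP.+-mono-≤ (thin y) (covered-length d B l far
           (λ z → ℕP.≤-trans (ℕP.*-monoʳ-≤ d (length-filter-filter (near? d z) far? xs)) (thin z)) far-covers) ⟩
    B ℕ.+ length l ℕ.* B
      ∎
    where
    open ℕP.≤-Reasoning
    far? : Decidable (λ x → ¬ (d ∣ ∣ x ℤ.- y ∣))
    far? = ¬? ∘ near? d y
    far  = filter far? xs

    far-covers : ∀ {x} → x ∈ far → ∃[ z ] (z ∈ l × d ∣ ∣ x ℤ.- z ∣)
    far-covers {x} x∈far with ∈-filter⁻ far? {xs = xs} x∈far
    ... | x∈xs , d∤x-y with covers x∈xs
    ...   | z , here ≡.refl , d∣x-z = ⊥-elim (d∤x-y d∣x-z)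
    ...   | z , there z∈l   , d∣x-z = z , z∈l , d∣x-z

  solution? : ∀ (f : ℤ → ℤ) t r → Decidable (λ x → t ∣ ∣ f x ℤ.- r ∣)
  solution? f t r x = t ∣? ∣ f x ℤ.- r ∣

  solution-count : ∀ {f t c d} .{{_ : NonZero d}} → SolutionsCovered f t c d → ∀ r m N →
                   d ℕ.* length (filter (solution? f t r) (interval m N)) ℕ.≤ c ℕ.* (N ℕ.+ d)
  solution-count {f} {t} {c} {d} cov r m N
    with cov r (filter (solution? f t r) (interval m N)) (λ x∈ → proj₂ (∈-filter⁻ (solution? f t r) {xs = interval m N} x∈))
  ... | l , |l|≤c , covers = ℕP.≤-trans
    (covered-length d (N ℕ.+ d) l (filter (solution? f t r) (interval m N))
      (λ y → ℕP.≤-trans (ℕP.*-monoʳ-≤ d (length-filter-filter (near? d y) (solution? f t r) (interval m N))) (class-count d y m N))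
      covers)
    (ℕP.*-monoˡ-≤ (N ℕ.+ d) |l|≤c)

-- Numbers without small prime factors.

module Roughness where
  open ℕ∣ using (_∣_)
  rough-pred : ∀ {m n} → suc m Rough n → m Rough n
  rough-pred rough (hasNonTrivialDivisor d<m d∣n) = rough (hasNonTrivialDivisor (ℕP.m<n⇒m<1+n d<m) d∣n)

  ¬rough-suc : ∀ {m n} .{{_ : ℕ.NonTrivial m}} → m ∣ n → ¬ (suc m Rough n)
  ¬rough-suc {m} m∣n rough = rough (hasNonTrivialDivisor (ℕP.n<1+n m) m∣n)

  rough? : ∀ m → Decidable (m Rough_)
  rough? 0 n = yes 0-rough
  rough? 1 n = yes 1-rough
  rough? 2 n = yes 2-rough
  rough? (suc m@(suc (suc _))) n with rough? m n | m ∣? n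
  ... | no ¬rough | _       = no (¬rough ∘ rough-pred)
  ... | yes _     | yes m∣n = no (¬rough-suc m∣n)
  ... | yes rough | no m∤n  = yes (∤⇒rough-suc m∤n rough)

  -- A divisor `m` of an `m`-rough number has no smaller nontrivial divisor, hence is prime.
  rough-composite : ∀ {m n} .{{_ : ℕ.NonTrivial m}} → ¬ Prime m → m Rough n → suc m Rough n
  rough-composite {m} ¬prime rough = ∤⇒rough-suc (λ m∣n → ¬prime (rough∧∣⇒prime rough m∣n)) rough

  -- A divisor below `p` is coprime to `p`, so it already divides `n`.
  rough-*-prime : ∀ {p n} → Prime p → p Rough n → p Rough (p ℕ.* n)
  rough-*-prime {p} p-prime rough (hasNonTrivialDivisor {divisor = suc d} d<p d∣pn) =
    rough (hasNonTrivialDivisor d<p (coprime-divisor (coprime-sym (prime⇒coprime p-prime d<p)) d∣pn))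

  rough-/-prime : ∀ {p n} → p Rough (p ℕ.* n) → p Rough n
  rough-/-prime {p} {n} rough = rough∧∣⇒rough rough (ℕ∣.n∣m*n p)

-- Sums over rough numbers, in particular harmonic sums.

module RoughSums {c ℓ₁ ℓ₂ : Level} (R : RealField c ℓ₁ ℓ₂) where
  open RealField R
  open OrderedField R
  open Roughness
  open ℕ∣ using (_∣_)

  when : ∀ {a} {A : Set a} → Dec A → ℝ → ℝ
  when (yes _) x = x
  when (no _)  x = 0#

  -- At `m = 2` every `n` from 1 to `X` is counted; once `m` exceeds `X`, only `n = 1` survives.
  -- Raising `m` step by step removes one prime at a time.
  roughSum : ℕ → (ℕ → ℝ) → ℕ → ℝ
  roughSum m f zero    = 0#
  roughSum m f (suc X) = roughSum m f X + when (rough? m (suc X)) (f (suc X))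

  when-nonneg : ∀ {a} {A : Set a} (A? : Dec A) {x} → 0# ≤ x → 0# ≤ when A? x
  when-nonneg (yes _) 0≤x = 0≤x
  when-nonneg (no _)  _   = ≤-refl

  when-cong : ∀ {a b} {A : Set a} {B : Set b} (A? : Dec A) (B? : Dec B) → (A → B) → (B → A) →
              ∀ {x y} → x ≈ y → when A? x ≈ when B? y
  when-cong (yes _) (yes _) _ _ x≈y = x≈y
  when-cong (no _)  (no _)  _ _ _   = refl
  when-cong (yes a) (no ¬b) f _ _   = ⊥-elim (¬b (f a))
  when-cong (no ¬a) (yes b) _ g _   = ⊥-elim (¬a (g b))

  when-no : ∀ {a} {A : Set a} (A? : Dec A) {x} → ¬ A → when A? x ≈ 0#
  when-no (yes a) ¬a = ⊥-elim (¬a a)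
  when-no (no _)  _  = refl

  when-yes : ∀ {a} {A : Set a} (A? : Dec A) {x} → A → when A? x ≈ x
  when-yes (yes _) _ = refl
  when-yes (no ¬a) a = ⊥-elim (¬a a)

  when-* : ∀ {a} {A : Set a} (A? : Dec A) x y → when A? (x * y) ≈ x * when A? y
  when-* (yes _) x y = refl
  when-* (no _)  x y = sym (zeroʳ x)

  roughSum-cong : ∀ m {f g} X → (∀ n → f n ≈ g n) → roughSum m f X ≈ roughSum m g X
  roughSum-cong m zero    f≈g = refl
  roughSum-cong m (suc X) f≈g = +-cong (roughSum-cong m X f≈g) (when-cong (rough? m (suc X)) (rough? m (suc X)) (λ r → r) (λ r → r) (f≈g (suc X)))

  roughSum-nonneg : ∀ m {f} X → (∀ n → 0# ≤ f n) → 0# ≤ roughSum m f X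
  roughSum-nonneg m zero    0≤f = ≤-refl
  roughSum-nonneg m (suc X) 0≤f = +-nonneg (roughSum-nonneg m X 0≤f) (when-nonneg (rough? m (suc X)) (0≤f (suc X)))

  roughSum-monoʳ : ∀ m {f X Y} → (∀ n → 0# ≤ f n) → X ℕ.≤ Y → roughSum m f X ≤ roughSum m f Y
  roughSum-monoʳ m {f} 0≤f X≤Y = go (ℕP.≤⇒≤′ X≤Y)
    where
    go : ∀ {X Y} → X ℕ.≤′ Y → roughSum m f X ≤ roughSum m f Y
    go ℕ.≤′-refl = ≤-refl
    go {Y = suc Y} (ℕ.≤′-step X≤Y) = ≤-trans (go X≤Y) (≤-by (when-nonneg (rough? m (suc Y)) (0≤f (suc Y))) refl)

  roughSum-* : ∀ m x f X → roughSum m (λ n → x * f n) X ≈ x * roughSum m f X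
  roughSum-* m x f zero    = sym (zeroʳ x)
  roughSum-* m x f (suc X) = trans (+-cong (roughSum-* m x f X) (when-* (rough? m (suc X)) x (f (suc X)))) (sym (distribˡ x _ _))

  roughSum-composite : ∀ {m} .{{_ : ℕ.NonTrivial m}} → ¬ Prime m → ∀ f X → roughSum m f X ≈ roughSum (suc m) f X
  roughSum-composite ¬prime f zero    = refl
  roughSum-composite {m} ¬prime f (suc X) = +-cong (roughSum-composite ¬prime f X)
    (when-cong (rough? m (suc X)) (rough? (suc m) (suc X)) (rough-composite ¬prime) rough-pred refl)

  roughSum-small : ∀ m f X → suc X ℕ.< m → roughSum m f (suc X) ≈ f 1
  roughSum-small m f zero    1<m = trans (+-identityˡ _) (when-yes (rough? m 1) (rough-1 m))
  roughSum-small m f (suc X) X<m = trans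
    (+-cong (roughSum-small m f X (ℕP.<-trans (ℕP.n<1+n (suc X)) X<m))
            (when-no (rough? m (2 ℕ.+ X)) (λ rough → ℕP.<⇒≱ X<m (rough⇒≤ rough))))
    (+-identityʳ _)

  -- A `p`-rough number divisible by `p` has a `p`-rough quotient, which may itself be divisible by
  -- `p`. So the second sum still contains all higher powers of `p`.
  roughSum-split : ∀ {p} .{{_ : NonZero p}} → Prime p → ∀ f X →
                   roughSum p f X ≈ roughSum (suc p) f X + roughSum p (λ n → f (p ℕ.* n)) (X / p)
  roughSum-split {p@(suc p-1)} p-prime f X = ≡.subst (λ Z → roughSum p f Z ≈ roughSum (suc p) f Z + roughSum p (λ n → f (p ℕ.* n)) (X / p))
    (≡.sym (ℕD.m≡m%n+[m/n]*n X p)) (go (X / p) (X % p) (ℕD.m%n<n X p))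
    where
    instance nonTrivial = prime⇒nonTrivial p-prime

    go : ∀ Y r → r ℕ.< p → roughSum p f (r ℕ.+ Y ℕ.* p) ≈ roughSum (suc p) f (r ℕ.+ Y ℕ.* p) + roughSum p (λ n → f (p ℕ.* n)) Y
    go zero    zero    _   = sym (+-identityˡ 0#)
    -- The one multiple of `p` in its block; its predecessor is the last index of the block before,
    -- with remainder `p-1`.
    go (suc Y) zero    r<p = trans (+-cong (go Y p-1 (ℕP.n<1+n p-1)) same)
      (trans (+-assoc _ _ _) (+-congʳ (trans (sym (+-identityʳ _)) (+-congˡ (sym (when-no (rough? (suc p) n) (¬rough-suc (ℕ∣.n∣m*n (suc Y)))))))))
      where
      n = suc Y ℕ.* p
      n≡ : n ≡ p ℕ.* suc Y
      n≡ = ℕP.*-comm (suc Y) p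
      same : when (rough? p n) (f n) ≈ when (rough? p (suc Y)) (f (p ℕ.* suc Y))
      same = when-cong (rough? p n) (rough? p (suc Y))
        (λ rough → rough-/-prime (subst (p Rough_) n≡ rough)) (λ rough → subst (p Rough_) (≡.sym n≡) (rough-*-prime p-prime rough))
        (reflexive (cong f n≡))
    go Y (suc r) r<p = trans
      (+-cong (go Y r (ℕP.<-trans (ℕP.n<1+n r) r<p))
              (when-cong (rough? p n) (rough? (suc p) n) (∤⇒rough-suc p∤n) rough-pred refl))
      (solve 3 (λ a b c → (a :+ b) :+ c := (a :+ c) :+ b) refl _ _ _)
      where
      n = suc r ℕ.+ Y ℕ.* p
      p∤n : ¬ (p ∣ n)
      p∤n p∣n = ℕ∣.>⇒∤ r<p (ℕ∣.∣m+n∣m⇒∣n (subst (p ∣_) (ℕP.+-comm (suc r) (Y ℕ.* p)) p∣n) (ℕ∣.n∣m*n Y))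

  harmonic : ℕ → ℕ → ℝ
  harmonic m = roughSum m inv

  harmonic-nonneg : ∀ m X → 0# ≤ harmonic m X
  harmonic-nonneg m X = roughSum-nonneg m X inv-nonneg

  harmonic-monoʳ : ∀ m {X Y} → X ℕ.≤ Y → harmonic m X ≤ harmonic m Y
  harmonic-monoʳ m = roughSum-monoʳ m inv-nonneg

  harmonic-split : ∀ {p} .{{_ : NonZero p}} → Prime p → ∀ X →
                   harmonic p X ≈ harmonic (suc p) X + inv p * harmonic p (X / p)
  harmonic-split {p} p-prime X = trans (roughSum-split p-prime inv X)
    (+-congˡ (trans (roughSum-cong p (X / p) (inv-* p)) (roughSum-* p (inv p) inv (X / p))))

  bernoulli : ∀ n {a b} → 0# ≤ a → 0# ≤ b → a ^ suc n + fromℕ (suc n) * (a ^ n * b) ≤ (a + b) ^ suc n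
  bernoulli zero {a} {b} 0≤a 0≤b = ≤-reflexive (solve 2 (λ a b → a :* con 1ℤ :+ (con 1ℤ :+ con 0ℤ) :* (con 1ℤ :* b) := (a :+ b) :* con 1ℤ) refl a b)
  bernoulli (suc n) {a} {b} 0≤a 0≤b = ≤-trans
    (≤-by (*-nonneg (fromℕ-nonneg (suc n)) (*-nonneg (^-nonneg n 0≤a) (*-nonneg 0≤b 0≤b)))
      (solve 4 (λ a b m w → (a :* (a :* w) :+ (con 1ℤ :+ m) :* (a :* w :* b)) :+ m :* (w :* (b :* b))
                         := (a :+ b) :* (a :* w :+ m :* (w :* b))) refl a b (fromℕ (suc n)) (a ^ n)))
    (*-monoˡ-≤ (+-nonneg 0≤a 0≤b) (bernoulli n 0≤a 0≤b))

  -- H(2Y + 1) ≤ 1 + H(Y) for the harmonic numbers.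
  harmonic-dyadic : ∀ n X → X ℕ.< 2 ℕ.^ n → harmonic 2 X ≤ fromℕ n
  harmonic-dyadic zero    zero    _ = ≤-refl
  harmonic-dyadic zero    (suc X) (s≤s ())
  harmonic-dyadic (suc n) X X<2^n+1 = begin
    harmonic 2 X                              ≤⟨ harmonic-monoʳ 2 X≤ ⟩
    harmonic 2 (suc (X / 2 ℕ.* 2))            ≤⟨ odd (X / 2) ⟩
    1# + harmonic 2 (X / 2)                   ≤⟨ +-monoʳ-≤ 1# (harmonic-dyadic n (X / 2)
                                                   (ℕD.m<n*o⇒m/o<n {o = 2} (subst (X ℕ.<_) (ℕP.*-comm 2 (2 ℕ.^ n)) X<2^n+1))) ⟩
    fromℕ (suc n)                             ∎
    where
    open ≤-Reasoning
    X≤ : X ℕ.≤ suc (X / 2 ℕ.* 2)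
    X≤ = ℕP.≤-trans (ℕP.≤-reflexive (ℕD.m≡m%n+[m/n]*n X 2)) (ℕP.+-monoˡ-≤ (X / 2 ℕ.* 2) (ℕ.s≤s⁻¹ (ℕD.m%n<n X 2)))

    odd : ∀ Y → harmonic 2 (suc (Y ℕ.* 2)) ≤ 1# + harmonic 2 Y
    odd zero    = ≤-reflexive (trans (+-identityˡ _) (trans inv-1 (sym (+-identityʳ 1#))))
    odd (suc Y) = begin
      harmonic 2 (suc (Y ℕ.* 2)) + inv (2 ℕ.+ Y ℕ.* 2) + inv (3 ℕ.+ Y ℕ.* 2)
        ≤⟨ +-mono-≤ (+-monoˡ-≤ _ (odd Y)) inv-antitone ⟩
      1# + harmonic 2 Y + inv (2 ℕ.+ Y ℕ.* 2) + inv (2 ℕ.+ Y ℕ.* 2)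
        ≈⟨ trans (+-assoc _ _ _) (trans (+-congˡ (trans (+-cong inv≈ inv≈) (half+half _))) (+-assoc _ _ _)) ⟩
      1# + (harmonic 2 Y + inv (suc Y))
        ∎
      where
      inv≈ : inv (2 ℕ.+ Y ℕ.* 2) ≈ inv (suc Y) * inv 2
      inv≈ = inv-* (suc Y) 2
      inv-antitone : inv (3 ℕ.+ Y ℕ.* 2) ≤ inv (2 ℕ.+ Y ℕ.* 2)
      inv-antitone = inv-anti (ℕP.n≤1+n (2 ℕ.+ Y ℕ.* 2))

-- Summation over denominators, one prime at a time.

module DenominatorSum {c ℓ₁ ℓ₂ : Level} (R : RealField c ℓ₁ ℓ₂)
  (f : ℤ → ℤ) (a : ℤ) (k : ℕ) (f-polynomial : PolynomialCongruences.PolynomialFunction (suc k) a f)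
  (A : ℕ → RealField.ℝ R) (Z : RealField.ℝ R) (Q : ℕ) (ℓ : ℕ → RealField.ℝ R) where

  open RealField R
  open OrderedField R
  open RoughSums R
  open PolynomialCongruences
  open ℕ∣ using (_∣_)

  D K′ K : ℕ
  D  = suc k
  K′ = k ℕ.+ k ℕ.* D
  K  = D ℕ.* D

  ramified? : Decidable (λ p → Prime p × p ∣ ∣ a ∣)
  ramified? p = prime? p ×-dec p ∣? ∣ a ∣

  -- The loss at `p`: for a prime dividing the leading coefficient, `ℓ p` bounds the number of
  -- possible exponents. The other primes are paid for by the harmonic sum and cost one here.
  factor : ℕ → ℝ
  factor p with ramified? p
  ... | yes _ = ℓ p
  ... | no _  = 1#

  factor-ramified : ∀ {p} → Prime p → p ∣ ∣ a ∣ → factor p ≈ ℓ p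
  factor-ramified {p} p-prime p∣a with ramified? p
  ... | yes _          = refl
  ... | no unramified  = ⊥-elim (unramified (p-prime , p∣a))

  factor-unramified : ∀ {p} → ¬ (Prime p × p ∣ ∣ a ∣) → factor p ≈ 1#
  factor-unramified {p} unramified with ramified? p
  ... | yes ramified = ⊥-elim (unramified ramified)
  ... | no _         = refl

  factors : ℕ → ℕ → ℝ
  factors p zero    = 1#
  factors p (suc n) = factor p * factors (suc p) n

  factors-nonneg : (∀ p → 0# ≤ ℓ p) → ∀ p n → 0# ≤ factors p n
  factors-nonneg 0≤ℓ p zero    = 0≤1
  factors-nonneg 0≤ℓ p (suc n) = *-nonneg factor-nonneg (factors-nonneg 0≤ℓ (suc p) n)
    where
    factor-nonneg : 0# ≤ factor p
    factor-nonneg with ramified? p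
    ... | yes _ = 0≤ℓ p
    ... | no _  = 0≤1

  BoundedBy : ℕ → ℕ → ℕ → ℕ → ℕ → ℝ → Set ℓ₂
  BoundedBy p t c d X B = roughSum p (λ q → A (t ℕ.* q)) X ≤ Z * (fromℕ c * inv d) * B

  -- Denominators are split as t * q with q free of primes below p.
  record Admissible (p t c d : ℕ) : Set where
    field
      t≢0     : NonZero t
      d≢0     : NonZero d
      d≤t     : d ℕ.≤ t
      covered : SolutionsCovered f t c d
      coprime : ∀ p′ → Prime p′ → p ℕ.≤ p′ → ¬ (p′ ∣ d)

  open Admissible

  weaken : ∀ {p t c d} → Admissible p t c d → Admissible (suc p) t c d
  weaken {p} adm = record
    { t≢0 = t≢0 adm ; d≢0 = d≢0 adm ; d≤t = d≤t adm ; covered = covered adm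
    ; coprime = λ p′ p′-prime p<p′ → coprime adm p′ p′-prime (ℕP.≤-trans (ℕP.n≤1+n p) p<p′) }

  prime-∣-^ : ∀ {p q} n → Prime p → Prime q → p ∣ q ℕ.^ n → p ≡ q
  prime-∣-^ zero p-prime q-prime p∣1 = ⊥-elim (¬prime[1] (subst Prime (ℕ∣.∣1⇒≡1 p∣1) p-prime))
  prime-∣-^ {p} {q} (suc n) p-prime q-prime p∣ with euclidsLemma q (q ℕ.^ n) p-prime p∣
  ... | inj₂ p∣q^n = prime-∣-^ n p-prime q-prime p∣q^n
  ... | inj₁ p∣q with prime⇒irreducible q-prime p∣q
  ...   | inj₂ p≡q = p≡q
  ...   | inj₁ p≡1 = ⊥-elim (¬prime[1] (subst Prime p≡1 p-prime))

  extend : ∀ {p t c d} m j → Prime p → ¬ (p ∣ ∣ a ∣) → D ℕ.* m ℕ.< j → Admissible p t c d →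
           Admissible (suc p) (t ℕ.* p ℕ.^ j) (c ℕ.* D) (d ℕ.* p ℕ.^ suc m)
  extend {p} {t} {c} {d} m j p-prime p∤a Dm<j adm = record
    { t≢0     = ℕP.m*n≢0 t (p ℕ.^ j) {{t≢0 adm}} {{ℕP.m^n≢0 p j}}
    ; d≢0     = ℕP.m*n≢0 d (p ℕ.^ suc m) {{d≢0 adm}} {{ℕP.m^n≢0 p (suc m)}}
    ; d≤t     = ℕP.*-mono-≤ (d≤t adm) (ℕP.^-monoʳ-≤ p (ℕP.≤-trans (s≤s (ℕP.m≤n*m m D)) Dm<j))
    ; covered = covered-prime-power k m j {f = f} f-polynomial p-prime p∤a (coprime adm p p-prime ℕP.≤-refl) Dm<j (covered adm)
    ; coprime = λ p′ p′-prime p<p′ p′∣ → case p′ p′-prime p<p′ (euclidsLemma d (p ℕ.^ suc m) p′-prime p′∣)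
    }
    where
    instance p≢0 = prime⇒nonZero p-prime
    case : ∀ p′ → Prime p′ → p ℕ.< p′ → (p′ ∣ d) ⊎ (p′ ∣ p ℕ.^ suc m) → ⊥
    case p′ p′-prime p<p′ (inj₁ p′∣d) = coprime adm p′ p′-prime (ℕP.<⇒≤ p<p′) p′∣d
    case p′ p′-prime p<p′ (inj₂ p′∣p^) = ℕP.<-irrefl (≡.sym (prime-∣-^ (suc m) p′-prime p-prime p′∣p^)) p<p′

  ramified-extend : ∀ {p t c d} .{{_ : NonZero p}} → Admissible p t c d → Admissible p (t ℕ.* p) c d
  ramified-extend {p} {t} adm = record
    { t≢0 = ℕP.m*n≢0 t p {{t≢0 adm}} ; d≢0 = d≢0 adm
    ; d≤t = ℕP.≤-trans (d≤t adm) (ℕP.m≤m*n t p) ; covered = covered-multiple {f} p (covered adm) ; coprime = coprime adm }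

  weight-nonneg : 0# ≤ Z → ∀ c d → 0# ≤ Z * (fromℕ c * inv d)
  weight-nonneg 0≤Z c d = *-nonneg 0≤Z (*-nonneg (fromℕ-nonneg c) (inv-nonneg d))

  module _ (0≤Z : 0# ≤ Z) (0≤ℓ : ∀ p → 0# ≤ ℓ p)
           (ℓ-bound : ∀ p → Prime p → p ℕ.≤ Q → ∃[ n ] (Q ℕ.< p ℕ.^ n × fromℕ n ≤ ℓ p))
           (A-bound : ∀ t c d .{{_ : NonZero t}} .{{_ : NonZero d}} → t ℕ.≤ Q → d ℕ.≤ t →
                      SolutionsCovered f t c d → A t ≤ Z * (fromℕ c * inv d)) where

    module Step (p U₀ : ℕ) (p-prime : Prime p) (p≤Q : p ℕ.≤ Q)
      (ih : ∀ t c d X → Admissible (suc p) t c d → t ℕ.* X ℕ.≤ Q →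
            BoundedBy (suc p) t c d X (factors (suc p) U₀ * harmonic (suc p) X ^ K)) where

      private instance
        p≢0 = prime⇒nonZero p-prime

      U : ℝ
      U = factors (suc p) U₀

      U-nonneg : 0# ≤ U
      U-nonneg = factors-nonneg 0≤ℓ (suc p) U₀

      h h⁺ : ℕ → ℝ
      h  = harmonic p
      h⁺ = harmonic (suc p)

      h⁺≤h : ∀ X → h⁺ X ≤ h X
      h⁺≤h X = ≤-by (*-nonneg (inv-nonneg p) (harmonic-nonneg p (X / p))) (sym (harmonic-split p-prime X))

      quotient≤ : ∀ t X → t ℕ.* X ℕ.≤ Q → t ℕ.* p ℕ.* (X / p) ℕ.≤ Q
      quotient≤ t X tX≤Q = ℕP.≤-trans (ℕP.≤-reflexive (ℕP.*-assoc t p (X / p)))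
        (ℕP.≤-trans (ℕP.*-monoʳ-≤ t (ℕP.≤-trans (ℕP.≤-reflexive (ℕP.*-comm p (X / p))) (ℕD.m/n*n≤m X p))) tX≤Q)

      p>1 : 1 ℕ.< p
      p>1 = ℕ.nonTrivial⇒n>1 p {{prime⇒nonTrivial p-prime}}

      -- Since `X < p ^ n`, at most `n` exponents of `p` can occur, and each of them costs one use
      -- of `ih` with unchanged `c` and `d`. Fixing `X₀` keeps the bound constant while `X` is
      -- divided by `p`.
      ramified-step : ∀ {t c d} X₀ n X → Admissible p t c d → X ℕ.< p ℕ.^ n → X ℕ.≤ X₀ → t ℕ.* X ℕ.≤ Q →
                      BoundedBy p t c d X (fromℕ n * (U * h⁺ X₀ ^ K))
      ramified-step X₀ zero zero adm _ _ _ = ≤-reflexive (sym (trans (*-congˡ (zeroˡ _)) (zeroʳ _)))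
      ramified-step X₀ zero (suc X) adm (s≤s ()) _ _
      ramified-step {t} {c} {d} X₀ (suc n) X adm X<p^n+1 X≤X₀ tX≤Q = begin
        roughSum p (λ q → A (t ℕ.* q)) X
          ≈⟨ roughSum-split p-prime (λ q → A (t ℕ.* q)) X ⟩
        roughSum (suc p) (λ q → A (t ℕ.* q)) X + roughSum p (λ q → A (t ℕ.* (p ℕ.* q))) (X / p)
          ≈⟨ +-congˡ (roughSum-cong p (X / p) (λ q → reflexive (cong A (≡.sym (ℕP.*-assoc t p q))))) ⟩
        roughSum (suc p) (λ q → A (t ℕ.* q)) X + roughSum p (λ q → A (t ℕ.* p ℕ.* q)) (X / p)
          ≤⟨ +-mono-≤
               (≤-trans (ih t c d X (weaken adm) tX≤Q)
                 (*-monoˡ-≤ (weight-nonneg 0≤Z c d) (*-monoˡ-≤ U-nonneg (^-monoˡ-≤ K (harmonic-nonneg (suc p) X) (harmonic-monoʳ (suc p) X≤X₀)))))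
               (ramified-step X₀ n (X / p) (ramified-extend adm)
                 (ℕD.m<n*o⇒m/o<n {o = p} (subst (X ℕ.<_) (ℕP.*-comm p (p ℕ.^ n)) X<p^n+1))
                 (ℕP.≤-trans (ℕD.m/n≤m X p) X≤X₀) (quotient≤ t X tX≤Q)) ⟩
        W * B + W * (fromℕ n * B)
          ≈⟨ solve 3 (λ w b n → w :* b :+ w :* (n :* b) := w :* ((con 1ℤ :+ n) :* b)) refl W B (fromℕ n) ⟩
        W * (fromℕ (suc n) * B)
          ∎
        where
        open ≤-Reasoning
        W = Z * (fromℕ c * inv d)
        B = U * h⁺ X₀ ^ K

      ramified : ∀ t c d X → Admissible p t c d → t ℕ.* X ℕ.≤ Q → BoundedBy p t c d X (ℓ p * U * h X ^ K)
      ramified t c d X adm tX≤Q with ℓ-bound p p-prime p≤Q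
      ... | n , Q<p^n , n≤ℓ = ≤-trans
        (ramified-step X n X adm (ℕP.≤-<-trans (ℕP.≤-trans (ℕP.m≤n*m X t {{t≢0 adm}}) tX≤Q) Q<p^n) ℕP.≤-refl tX≤Q)
        (*-monoˡ-≤ (weight-nonneg 0≤Z c d) (≤-trans
          (*-mono-≤ (*-nonneg U-nonneg (^-nonneg K (harmonic-nonneg (suc p) X))) (0≤ℓ p) n≤ℓ
            (*-monoˡ-≤ U-nonneg (^-monoˡ-≤ K (harmonic-nonneg (suc p) X) (h⁺≤h X))))
          (≤-reflexive (sym (*-assoc _ _ _)))))

      module Unramified (p∤a : ¬ (p ∣ ∣ a ∣)) {t c d : ℕ} (adm : Admissible p t c d) (X₀ : ℕ) where

        α : ℝ
        α = h⁺ X₀ ^ K′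

        α-nonneg : 0# ≤ α
        α-nonneg = ^-nonneg K′ (harmonic-nonneg (suc p) X₀)

        β : ℕ → ℝ
        β X = inv p * h (X / p)

        β-mono : ∀ {X Y} → X ℕ.≤ Y → β X ≤ β Y
        β-mono X≤Y = *-monoˡ-≤ (inv-nonneg p) (harmonic-monoʳ p (ℕD./-monoˡ-≤ p X≤Y))

        β-nonneg : ∀ X → 0# ≤ β X
        β-nonneg X = *-nonneg (inv-nonneg p) (harmonic-nonneg p (X / p))

        -- `fromℕ σ * h⁺ X` pays for the exponents left in the current block of equal `⌈j / D⌉`, and
        -- `fromℕ D * β X` for all later blocks together. All but one of the `K` harmonic factors
        -- are frozen at `X₀` in `α`.
        envelope : ℕ → ℕ → ℝ
        envelope σ X = U * (α * (fromℕ σ * h⁺ X + fromℕ D * β X))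

        envelope-nonneg : ∀ σ X → 0# ≤ envelope σ X
        envelope-nonneg σ X = *-nonneg U-nonneg (*-nonneg α-nonneg (+-nonneg
          (*-nonneg (fromℕ-nonneg σ) (harmonic-nonneg (suc p) X)) (*-nonneg (fromℕ-nonneg D) (β-nonneg X))))

        W : ℕ → ℝ
        W m = Z * (fromℕ (c ℕ.* D) * inv (d ℕ.* p ℕ.^ suc m))

        W-nonneg : ∀ m → 0# ≤ W m
        W-nonneg m = weight-nonneg 0≤Z (c ℕ.* D) (d ℕ.* p ℕ.^ suc m)

        W-suc : ∀ m → W (suc m) ≈ W m * inv p
        W-suc m = trans (*-congˡ (*-congˡ (trans (reflexive (cong inv (≡.trans (cong (d ℕ.*_) (ℕP.*-comm p (p ℕ.^ suc m))) (≡.sym (ℕP.*-assoc d (p ℕ.^ suc m) p)))))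
                                                (inv-* (d ℕ.* p ℕ.^ suc m) p))))
          (solve 4 (λ z c x y → z :* (c :* (x :* y)) := (z :* (c :* x)) :* y) refl Z (fromℕ (c ℕ.* D)) (inv (d ℕ.* p ℕ.^ suc m)) (inv p))

        sum-from : ℕ → ℕ → ℝ
        sum-from j X = roughSum p (λ q → A (t ℕ.* p ℕ.^ j ℕ.* q)) X

        -- σ is the number of exponents ≥ j with the same ⌈j / D⌉ = m + 1.
        powers : ∀ n m j σ X → X ℕ.≤ n → X ℕ.≤ X₀ → j ℕ.+ suc σ ≡ suc (D ℕ.* suc m) → suc σ ℕ.≤ D →
                 t ℕ.* p ℕ.^ j ℕ.* X ℕ.≤ Q → sum-from j X ≤ W m * envelope (suc σ) X
        powers n m j σ zero _ _ _ _ _ = *-nonneg (W-nonneg m) (envelope-nonneg (suc σ) 0)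
        -- `n` bounds `X` for the sake of termination, since the recursion passes to `X / p`; `X₀`
        -- bounds it so that `α` stays valid.
        powers (suc n) m j σ X@(suc X-1) X≤n+1 X≤X₀ j+σ≡ σ≤D tX≤Q = begin
          sum-from j X
            ≈⟨ roughSum-split p-prime (λ q → A (t ℕ.* p ℕ.^ j ℕ.* q)) X ⟩
          roughSum (suc p) (λ q → A (t ℕ.* p ℕ.^ j ℕ.* q)) X + roughSum p (λ q → A (t ℕ.* p ℕ.^ j ℕ.* (p ℕ.* q))) (X / p)
            ≈⟨ +-congˡ (roughSum-cong p (X / p) (λ q → reflexive (cong A (shift q)))) ⟩
          roughSum (suc p) (λ q → A (t ℕ.* p ℕ.^ j ℕ.* q)) X + sum-from (suc j) (X / p)
            ≤⟨ +-mono-≤ first (rest σ j+σ≡ σ≤D) ⟩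
          W m * (U * (α * h⁺ X)) + W m * (U * (α * (fromℕ σ * h⁺ X + fromℕ D * β X)))
            ≈⟨ solve 7 (λ w u α h σ D b → w :* (u :* (α :* h)) :+ w :* (u :* (α :* (σ :* h :+ D :* b)))
                          := w :* (u :* (α :* ((con 1ℤ :+ σ) :* h :+ D :* b)))) refl (W m) U α (h⁺ X) (fromℕ σ) (fromℕ D) (β X) ⟩
          W m * envelope (suc σ) X
            ∎
          where
          open ≤-Reasoning
          Dm<j : D ℕ.* m ℕ.< j
          Dm<j = ℕP.+-cancelʳ-≤ D (suc (D ℕ.* m)) j (ℕP.≤-trans
            (ℕP.≤-reflexive (≡.trans (cong suc (≡.trans (ℕP.+-comm (D ℕ.* m) D) (≡.sym (ℕP.*-suc D m)))) (≡.sym j+σ≡)))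
            (ℕP.+-monoʳ-≤ j σ≤D))

          shift : ∀ q → t ℕ.* p ℕ.^ j ℕ.* (p ℕ.* q) ≡ t ℕ.* p ℕ.^ suc j ℕ.* q
          shift q = ≡.trans (≡.sym (ℕP.*-assoc (t ℕ.* p ℕ.^ j) p q))
            (cong (ℕ._* q) (≡.trans (ℕP.*-assoc t (p ℕ.^ j) p) (cong (t ℕ.*_) (ℕP.*-comm (p ℕ.^ j) p))))

          next≤Q : t ℕ.* p ℕ.^ suc j ℕ.* (X / p) ℕ.≤ Q
          next≤Q = subst (ℕ._≤ Q) (cong (ℕ._* (X / p)) (≡.trans (ℕP.*-assoc t (p ℕ.^ j) p) (cong (t ℕ.*_) (ℕP.*-comm (p ℕ.^ j) p))))
            (quotient≤ (t ℕ.* p ℕ.^ j) X tX≤Q)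

          X/p≤X : X / p ℕ.≤ X
          X/p≤X = ℕD.m/n≤m X p

          X/p≤n : X / p ℕ.≤ n
          X/p≤n = ℕ.s≤s⁻¹ (ℕP.≤-trans (ℕD.m/n<m X p p>1) X≤n+1)

          first : roughSum (suc p) (λ q → A (t ℕ.* p ℕ.^ j ℕ.* q)) X ≤ W m * (U * (α * h⁺ X))
          first = ≤-trans (ih (t ℕ.* p ℕ.^ j) (c ℕ.* D) (d ℕ.* p ℕ.^ suc m) X (extend m j p-prime p∤a Dm<j adm) tX≤Q)
            (*-monoˡ-≤ (W-nonneg m) (*-monoˡ-≤ U-nonneg (≤-trans
              (*-monoˡ-≤ (harmonic-nonneg (suc p) X) (^-monoˡ-≤ K′ (harmonic-nonneg (suc p) X) (harmonic-monoʳ (suc p) X≤X₀)))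
              (≤-reflexive (*-comm _ _)))))

          rest : ∀ σ → j ℕ.+ suc σ ≡ suc (D ℕ.* suc m) → suc σ ℕ.≤ D →
                 sum-from (suc j) (X / p) ≤ W m * (U * (α * (fromℕ σ * h⁺ X + fromℕ D * β X)))
          -- Here `j = D (m + 1)` ends its block. The next block has all `D` exponents and a weight
          -- smaller by the factor `inv p`; as `h⁺ (X / p) + β (X / p)` is `h (X / p)`, its envelope
          -- turns into the term `fromℕ D * β X`.
          rest zero j+1≡ _ = ≤-trans
            (powers n (suc m) (suc j) k (X / p) X/p≤n (ℕP.≤-trans X/p≤X X≤X₀) (cong suc
              (≡.trans (cong (ℕ._+ D) (ℕP.suc-injective (≡.trans (ℕP.+-comm 1 j) j+1≡)))
                       (≡.trans (ℕP.+-comm (D ℕ.* suc m) D) (≡.sym (ℕP.*-suc D (suc m)))))) ℕP.≤-refl next≤Q)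
            (≤-reflexive (trans (*-congʳ (W-suc m)) (trans
              (solve 8 (λ w i u α D x y h → (w :* i) :* (u :* (α :* (D :* x :+ D :* y))) := w :* (u :* (α :* (con 0ℤ :* h :+ D :* (i :* (x :+ y)))))) refl
                 (W m) (inv p) U α (fromℕ D) (h⁺ (X / p)) (β (X / p)) (h⁺ X))
              (*-congˡ (*-congˡ (*-congˡ (+-congˡ (*-congˡ (*-congˡ (sym (harmonic-split p-prime (X / p))))))))))))
          rest (suc σ) j+σ≡ σ≤D = ≤-trans
            (powers n m (suc j) σ (X / p) X/p≤n (ℕP.≤-trans X/p≤X X≤X₀) (≡.trans (≡.sym (ℕP.+-suc j (suc σ))) j+σ≡) (ℕP.<⇒≤ σ≤D) next≤Q)
            (*-monoˡ-≤ (W-nonneg m) (*-monoˡ-≤ U-nonneg (*-monoˡ-≤ α-nonneg (+-mono-≤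
              (*-monoˡ-≤ (fromℕ-nonneg (suc σ)) (harmonic-monoʳ (suc p) X/p≤X))
              (*-monoˡ-≤ (fromℕ-nonneg D) (β-mono X/p≤X))))))

        unramified : t ℕ.* X₀ ℕ.≤ Q → BoundedBy p t c d X₀ (1# * U * h X₀ ^ K)
        unramified tX≤Q = begin
          roughSum p (λ q → A (t ℕ.* q)) X₀
            ≈⟨ roughSum-split p-prime (λ q → A (t ℕ.* q)) X₀ ⟩
          roughSum (suc p) (λ q → A (t ℕ.* q)) X₀ + roughSum p (λ q → A (t ℕ.* (p ℕ.* q))) (X₀ / p)
            ≈⟨ +-congˡ (roughSum-cong p (X₀ / p) (λ q → reflexive (cong A
                 (≡.trans (≡.sym (ℕP.*-assoc t p q)) (cong (λ v → t ℕ.* v ℕ.* q) (≡.sym (ℕP.*-identityʳ p))))))) ⟩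
          roughSum (suc p) (λ q → A (t ℕ.* q)) X₀ + sum-from 1 (X₀ / p)
            ≤⟨ +-mono-≤ (ih t c d X₀ (weaken adm) tX≤Q)
                 (powers (X₀ / p) 0 1 k (X₀ / p) ℕP.≤-refl (ℕD.m/n≤m X₀ p) (cong suc (≡.sym (ℕP.*-identityʳ D))) ℕP.≤-refl
                   (subst (λ v → t ℕ.* v ℕ.* (X₀ / p) ℕ.≤ Q) (≡.sym (ℕP.*-identityʳ p)) (quotient≤ t X₀ tX≤Q))) ⟩
          V * (U * h⁺ X₀ ^ K) + W 0 * envelope D (X₀ / p)
            ≈⟨ +-congˡ (*-cong W-0 (*-congˡ (*-congˡ (trans (sym (distribˡ _ _ _)) (*-congˡ (sym (harmonic-split p-prime (X₀ / p)))))))) ⟩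
          V * (U * h⁺ X₀ ^ K) + V * (fromℕ D * inv p) * (U * (α * (fromℕ D * h (X₀ / p))))
            ≈⟨ trans (solve 7 (λ v u x D i α y → v :* (u :* x) :+ (v :* (D :* i)) :* (u :* (α :* (D :* y)))
                          := v :* (con 1ℤ :* u :* (x :+ (D :* D) :* (α :* (i :* y))))) refl
                    V U (h⁺ X₀ ^ K) (fromℕ D) (inv p) α (h (X₀ / p)))
                 (*-congˡ (*-congˡ (+-congˡ (*-congʳ (sym (fromℕ-* D D)))))) ⟩
          -- One factor `D` counts residue classes, the other the exponents in a block. Their
          -- product is the coefficient `K` that `bernoulli` absorbs into the `K`-th power.
          V * (1# * U * (h⁺ X₀ ^ K + fromℕ K * (α * β X₀)))
            ≤⟨ *-monoˡ-≤ (weight-nonneg 0≤Z c d) (*-monoˡ-≤ (*-nonneg 0≤1 U-nonneg)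
                 (bernoulli K′ (harmonic-nonneg (suc p) X₀) (β-nonneg X₀))) ⟩
          V * (1# * U * (h⁺ X₀ + β X₀) ^ K)
            ≈⟨ *-congˡ (*-congˡ (^-congˡ K (sym (harmonic-split p-prime X₀)))) ⟩
          V * (1# * U * h X₀ ^ K)
            ∎
          where
          open ≤-Reasoning
          V = Z * (fromℕ c * inv d)
          W-0 : W 0 ≈ V * (fromℕ D * inv p)
          W-0 = trans (*-congˡ (*-cong (fromℕ-* c D) (trans (reflexive (cong (λ v → inv (d ℕ.* v)) (ℕP.*-identityʳ p))) (inv-* d p))))
            (solve 5 (λ z c D x i → z :* ((c :* D) :* (x :* i)) := (z :* (c :* x)) :* (D :* i)) refl Z (fromℕ c) (fromℕ D) (inv d) (inv p))

    -- Induction on the distance from `p` to `suc Q`, uniformly in `t`, `c`, `d` and `X`, because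
    -- splitting off a power of `p` changes all of them. At `p = suc Q` only `q = 1` is left, where
    -- `A-bound` applies and the harmonic sum is one.
    roughSum-bound : ∀ n p → 2 ℕ.≤ p → p ℕ.+ n ≡ suc Q → ∀ t c d X → Admissible p t c d → t ℕ.* X ℕ.≤ Q →
                     BoundedBy p t c d X (factors p n * harmonic p X ^ K)
    roughSum-bound n p 2≤p p+n≡ t c d zero adm tX≤Q =
      *-nonneg (weight-nonneg 0≤Z c d) (*-nonneg (factors-nonneg 0≤ℓ p n) (^-nonneg K ≤-refl))
    roughSum-bound zero p 2≤p p+0≡ t c d (suc X) adm tX≤Q = begin
      roughSum p (λ q → A (t ℕ.* q)) (suc X)                 ≈⟨ roughSum-small p (λ q → A (t ℕ.* q)) X X<p ⟩
      A (t ℕ.* 1)                                            ≡⟨ cong A (ℕP.*-identityʳ t) ⟩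
      A t                                                    ≤⟨ A-bound t c d {{t≢0 adm}} {{d≢0 adm}} (ℕP.≤-trans (ℕP.m≤m*n t (suc X)) tX≤Q) (d≤t adm) (covered adm) ⟩
      V                                                      ≈⟨ *-identityʳ V ⟨
      V * 1#                                                 ≤⟨ *-monoˡ-≤ (weight-nonneg 0≤Z c d) (≤-trans (1≤^ K 1≤h) (≤-reflexive (sym (*-identityˡ _)))) ⟩
      V * (1# * harmonic p (suc X) ^ K)                      ∎
      where
      open ≤-Reasoning
      V = Z * (fromℕ c * inv d)
      X<p : suc X ℕ.< p
      X<p = ℕP.≤-<-trans (ℕP.≤-trans (ℕP.m≤n*m (suc X) t {{t≢0 adm}}) tX≤Q) (ℕP.≤-reflexive (≡.trans (≡.sym p+0≡) (ℕP.+-identityʳ p)))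
      1≤h : 1# ≤ harmonic p (suc X)
      1≤h = ≤-reflexive (sym (trans (roughSum-small p inv X X<p) inv-1))
    roughSum-bound (suc n) p 2≤p p+n+1≡ t c d X@(suc _) adm tX≤Q = step (prime? p) (p ∣? ∣ a ∣)
      where
      instance nonTrivial = ℕ.n>1⇒nonTrivial 2≤p

      p+1+n≡ : suc p ℕ.+ n ≡ suc Q
      p+1+n≡ = ≡.trans (≡.sym (ℕP.+-suc p n)) p+n+1≡

      p≤Q : p ℕ.≤ Q
      p≤Q = ℕ.s≤s⁻¹ (ℕP.≤-trans (s≤s (ℕP.m≤m+n p n)) (ℕP.≤-reflexive p+1+n≡))

      ih : ∀ t c d X → Admissible (suc p) t c d → t ℕ.* X ℕ.≤ Q →
           BoundedBy (suc p) t c d X (factors (suc p) n * harmonic (suc p) X ^ K)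
      ih = roughSum-bound n (suc p) (ℕP.m≤n⇒m≤1+n 2≤p) p+1+n≡

      step : Dec (Prime p) → Dec (p ∣ ∣ a ∣) → BoundedBy p t c d X (factors p (suc n) * harmonic p X ^ K)
      step (yes p-prime) (yes p∣a) = ≤-trans (Step.ramified p n p-prime p≤Q ih t c d X adm tX≤Q)
        (*-monoˡ-≤ (weight-nonneg 0≤Z c d) (≤-reflexive (*-congʳ (*-congʳ (sym (factor-ramified p-prime p∣a))))))
      step (yes p-prime) (no p∤a) = ≤-trans (Step.Unramified.unramified p n p-prime p≤Q ih p∤a adm X tX≤Q)
        (*-monoˡ-≤ (weight-nonneg 0≤Z c d) (≤-reflexive (*-congʳ (*-congʳ (sym (factor-unramified (p∤a ∘ proj₂)))))))
      step (no ¬prime) _ = ≤-trans (≤-reflexive (roughSum-composite ¬prime (λ q → A (t ℕ.* q)) X))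
        (≤-trans (ih t c d X (weaken adm) tX≤Q)
          (*-monoˡ-≤ (weight-nonneg 0≤Z c d) (≤-reflexive (*-cong
            (trans (sym (*-identityˡ _)) (*-congʳ (sym (factor-unramified (¬prime ∘ proj₁)))))
            (^-congˡ K (sym (roughSum-composite ¬prime inv X)))))))

-- The complete sum over numerators for one denominator.

module FixedDenominator {c ℓ₁ ℓ₂ : Level} (R : RealField c ℓ₁ ℓ₂) (E : ElementaryFunctions R)
  (f : ℤ → ℤ) (m : ℤ) (N : ℕ) (a : Vector (Complex.ℂ R) N) where
  open RealField R
  open OrderedField R
  open Complex R
  open ComplexNumbers R
  open ElementaryFunctions E
  open RangeSums commutativeRing
  open Characters R E
  open RoughSums R using (when)
  open PolynomialCongruences using (SolutionsCovered)
  open IntervalCounts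
  open ℕ∣ using (_∣_)
  open MonoidSum (CommutativeRing.+-commutativeMonoid commutativeRing) using (sum-cong-≋; ∑-distrib-+; ∑-comm)
  open SemiringSum semiring using (*-distribˡ-sum; *-distribʳ-sum)

  value : Fin N → ℤ
  value j = f (m ℤ.+ + toℕ j)

  expSum : ℝ → ℂ
  expSum y = sumℂ (λ j → a j *ℂ e (y * fromℤ (value j)))

  denominatorSum : ℕ → ℝ
  denominatorSum q = Σ< q (λ p → ∣ expSum (fromℕ p * inv q) ∣²)

  -- The real part of `w *ℂ conj z`, that is, the inner product of the plane.
  dot : ℂ → ℂ → ℝ
  dot w z = re w * re z + im w * im z

  sum×sum : ∀ {n} (u v : Vector ℝ n) → sum u * sum v ≈ sum (λ i → sum (λ j → u i * v j))
  sum×sum u v = trans (*-distribʳ-sum (sum v) u) (sum-cong-≋ (λ i → *-distribˡ-sum (u i) v))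

  re-sumℂ : ∀ {n} (u : Vector ℂ n) → re (sumℂ u) ≈ sum (re ∘ u)
  re-sumℂ {zero}  u = refl
  re-sumℂ {suc n} u = +-congˡ (re-sumℂ (u ∘ suc))

  im-sumℂ : ∀ {n} (u : Vector ℂ n) → im (sumℂ u) ≈ sum (im ∘ u)
  im-sumℂ {zero}  u = refl
  im-sumℂ {suc n} u = +-congˡ (im-sumℂ (u ∘ suc))

  ∣sumℂ∣² : ∀ {n} (u : Vector ℂ n) → ∣ sumℂ u ∣² ≈ sum (λ i → sum (λ j → dot (u i) (u j)))
  ∣sumℂ∣² u = trans (+-cong (trans (*-cong (re-sumℂ u) (re-sumℂ u)) (sum×sum (re ∘ u) (re ∘ u)))
                            (trans (*-cong (im-sumℂ u) (im-sumℂ u)) (sum×sum (im ∘ u) (im ∘ u))))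
    (trans (sym (∑-distrib-+ (λ i → sum (λ j → re (u i) * re (u j))) (λ i → sum (λ j → im (u i) * im (u j)))))
           (sum-cong-≋ (λ i → sym (∑-distrib-+ (λ j → re (u i) * re (u j)) (λ j → im (u i) * im (u j))))))

  dot-e : ∀ w z s t → dot (w *ℂ e s) (z *ℂ e t) ≈ re ((w *ℂ conj z) *ℂ e (s - t))
  dot-e w z s t = trans
    (solve 8 (λ a b c d x y u v → (a :* x :- b :* y) :* (c :* u :- d :* v) :+ (a :* y :+ b :* x) :* (c :* v :+ d :* u)
       := (a :* c :- b :* :- d) :* (x :* u :- y :* :- v) :- (a :* :- d :+ b :* c) :* (x :* :- v :+ y :* u)) refl
       (re w) (im w) (re z) (im z) (re (e s)) (im (e s)) (re (e t)) (im (e t)))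
    (sym (proj₁ (ℂR.*-congˡ {w *ℂ conj z} {e (s - t)} {e s *ℂ conj (e t)}
      (ℂR.trans {e (s - t)} {e s *ℂ e (- t)} (e-+ s (- t)) (ℂR.*-congˡ {e s} {e (- t)} {conj (e t)} (e-neg t))))))

  -- This is `|w - z|² ≥ 0`. Trading the product for a mean of squares reduces the double sum to
  -- counting, for each `i`, the indices with congruent value.
  dot≤ : ∀ w z → dot w z ≤ ∣ w ∣² * inv 2 + ∣ z ∣² * inv 2
  dot≤ w z = *-cancelˡ-≤ (fromℕ-pos 2) (≤-trans
    (≤-by (∣∣²-nonneg (w -ℂ z)) (solve 4 (λ a b c d → (con 1ℤ :+ (con 1ℤ :+ con 0ℤ)) :* (a :* c :+ b :* d) :+ ((a :- c) :* (a :- c) :+ (b :- d) :* (b :- d))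
       := (a :* a :+ b :* b) :+ (c :* c :+ d :* d)) refl (re w) (im w) (re z) (im z)))
    (≤-reflexive (sym (trans (solve 3 (λ t x y → t :* (x :+ y) := t :* x :+ t :* y) refl (fromℕ 2) _ _) (+-cong (double _) (double _))))))
    where
    double : ∀ x → fromℕ 2 * (x * inv 2) ≈ x
    double x = trans (solve 3 (λ t x i → t :* (x :* i) := x :* (t :* i)) refl (fromℕ 2) x (inv 2)) (trans (*-congˡ (inv-inverseʳ 2)) (*-identityʳ x))

  Σ<-re : ∀ n w (u : ℕ → ℂ) → Σ< n (λ p → re (w *ℂ u p)) ≈ re (w *ℂ ℂΣ.Σ< n u)
  Σ<-re n w u = trans (sym (re-sumℂ {n} (λ p → w *ℂ u (toℕ p)))) (proj₁ (ℂR.sym {w *ℂ ℂΣ.Σ< n u} {ℂΣ.Σ< n (λ p → w *ℂ u p)} (ℂΣ.Σ<-*ˡ n w u)))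

  difference : Fin N → Fin N → ℤ
  difference i j = value i ℤ.- value j

  denominatorSum-expand : ∀ q → denominatorSum q ≈ sum (λ i → sum (λ j → re ((a i *ℂ conj (a j)) *ℂ characterSum q (difference i j))))
  denominatorSum-expand q = trans
    (sum-cong-≋ {q} (λ p → trans (∣sumℂ∣² (λ j → a j *ℂ e (y p * fromℤ (value j)))) (sum-cong-≋ (λ i → sum-cong-≋ (λ j → entry p i j)))))
    (trans (∑-comm {q} {N} (λ p i → sum (λ j → term i j (toℕ p))))
           (sum-cong-≋ (λ i → trans (∑-comm {q} {N} (λ p j → term i j (toℕ p)))
             (sum-cong-≋ (λ j → Σ<-re q (a i *ℂ conj (a j)) (λ p → e (fromℕ p * (inv q * fromℤ (difference i j)))))))))
    where
    y : Fin q → ℝ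
    y p = fromℕ (toℕ p) * inv q

    term : Fin N → Fin N → ℕ → ℝ
    term i j p = re ((a i *ℂ conj (a j)) *ℂ e (fromℕ p * (inv q * fromℤ (difference i j))))

    entry : ∀ p i j → dot (a i *ℂ e (y p * fromℤ (value i))) (a j *ℂ e (y p * fromℤ (value j))) ≈ term i j (toℕ p)
    entry p i j = trans (dot-e (a i) (a j) (y p * fromℤ (value i)) (y p * fromℤ (value j)))
      (proj₁ (ℂR.*-congˡ {a i *ℂ conj (a j)} {e (y p * fromℤ (value i) - y p * fromℤ (value j))} {e (fromℕ (toℕ p) * (inv q * fromℤ (difference i j)))}
        (e-cong (trans (solve 4 (λ n x u v → n :* x :* u :- n :* x :* v := n :* (x :* (u :- v))) refl (fromℕ (toℕ p)) (inv q) (fromℤ (value i)) (fromℤ (value j)))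
          (*-congˡ (*-congˡ (sym (trans (fromℤ-+ (value i) (ℤ.- value j)) (+-congˡ (fromℤ-neg (value j)))))))))))

  congruent? : ∀ q i → Decidable (λ x → q ∣ ℤ.∣ f x ℤ.- value i ∣)
  congruent? q i = solution? f q (value i)

  -- Congruence of values is symmetric. Stating it once from `i` and once from `j` gives the right
  -- side the form `F i j + F j i`, whose two halves have the same double sum.
  entry≤ : ∀ q .{{_ : NonZero q}} i j → re ((a i *ℂ conj (a j)) *ℂ characterSum q (difference i j)) ≤
           when (congruent? q i (m ℤ.+ + toℕ j)) (fromℕ q * (∣ a i ∣² * inv 2)) +
           when (congruent? q j (m ℤ.+ + toℕ i)) (fromℕ q * (∣ a j ∣² * inv 2))
  entry≤ q i j with congruent? q i (m ℤ.+ + toℕ j) | congruent? q j (m ℤ.+ + toℕ i)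
  ... | yes _  | yes q∣ = ≤-trans (≤-reflexive (trans
      (proj₁ (ℂR.*-congˡ {a i *ℂ conj (a j)} {characterSum q (difference i j)} {ofReal (fromℕ q)} (characterSum-∣ q (difference i j) q∣)))
      (solve 5 (λ a b c d q → (a :* c :- b :* :- d) :* q :- (a :* :- d :+ b :* c) :* con 0ℤ := q :* (a :* c :+ b :* d)) refl
        (re (a i)) (im (a i)) (re (a j)) (im (a j)) (fromℕ q))))
    (≤-trans (*-monoˡ-≤ (fromℕ-nonneg q) (dot≤ (a i) (a j))) (≤-reflexive (distribˡ _ _ _)))
  ... | no _   | no q∤  = ≤-reflexive (trans
      (proj₁ (ℂR.*-congˡ {a i *ℂ conj (a j)} {characterSum q (difference i j)} {0ℂ} (characterSum-∤ q (difference i j) q∤)))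
      (solve 2 (λ x y → x :* con 0ℤ :- y :* con 0ℤ := con 0ℤ :+ con 0ℤ) refl _ _))
  ... | yes q∣ | no q∤  = ⊥-elim (q∤ (subst (q ∣_) (ℤP.∣i-j∣≡∣j-i∣ (value j) (value i)) q∣))
  ... | no q∤  | yes q∣ = ⊥-elim (q∤ (subst (q ∣_) (ℤP.∣i-j∣≡∣j-i∣ (value i) (value j)) q∣))

  sum-when : ∀ {p} {P : Pred ℤ p} (P? : Decidable P) m n x →
             sum {n} (λ j → when (P? (m ℤ.+ + toℕ j)) x) ≈ fromℕ (length (filter P? (interval m n))) * x
  sum-when P? m zero    x = sym (zeroˡ x)
  sum-when {P = P} P? m (suc n) x = trans
    (+-cong (reflexive (cong (λ z → when (P? z) x) (ℤP.+-identityʳ m)))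
            (trans (sum-cong-≋ {n} (λ j → reflexive (cong (λ z → when (P? z) x) (shift (toℕ j))))) (sum-when P? (ℤ.suc m) n x)))
    cons
    where
    shift : ∀ j → m ℤ.+ + suc j ≡ ℤ.suc m ℤ.+ + j
    shift j = ≡.trans (cong (λ v → m ℤ.+ v) (ℤP.pos-+ 1 j)) (+-*-Solver.solve 2 (λ m j → m +-*-Solver.:+ (+-*-Solver.con 1ℤ +-*-Solver.:+ j)
      +-*-Solver.:= (+-*-Solver.con 1ℤ +-*-Solver.:+ m) +-*-Solver.:+ j) ≡.refl m (+ j))

    cons : when (P? m) x + fromℕ (length (filter P? (interval (ℤ.suc m) n))) * x ≈ fromℕ (length (filter P? (m ∷ interval (ℤ.suc m) n))) * x
    cons with P? m
    ... | yes _ = solve 2 (λ x n → x :+ n :* x := (con 1ℤ :+ n) :* x) refl x _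
    ... | no _  = +-identityˡ _

  -- Orthogonality and the count give `t * c * (N + d) / d`. Estimating `t` and the `d` next to `N`
  -- by `Q` leaves `c / d` as the only factor depending on `t`.
  denominatorSum-bound : ∀ Q t c d .{{_ : NonZero t}} .{{_ : NonZero d}} → t ℕ.≤ Q → d ℕ.≤ t → SolutionsCovered f t c d →
                         denominatorSum t ≤ fromℕ Q * (fromℕ N + fromℕ Q) * ‖ a ‖² * (fromℕ c * inv d)
  denominatorSum-bound Q t c d t≤Q d≤t cov = begin
    denominatorSum t
      ≈⟨ denominatorSum-expand t ⟩
    sum (λ i → sum (λ j → re ((a i *ℂ conj (a j)) *ℂ characterSum t (difference i j))))
      ≤⟨ sum-mono (λ i → sum-mono (λ j → entry≤ t i j)) ⟩
    sum (λ i → sum (λ j → F i j + F j i))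
      ≈⟨ trans (sum-cong-≋ (λ i → ∑-distrib-+ (F i) (λ j → F j i))) (∑-distrib-+ (λ i → sum (F i)) (λ i → sum (λ j → F j i))) ⟩
    sum (λ i → sum (F i)) + sum (λ i → sum (λ j → F j i))
      ≈⟨ +-congˡ (∑-comm {N} {N} (λ i j → F j i)) ⟩
    sum (λ i → sum (F i)) + sum (λ i → sum (F i))
      ≈⟨ sym (∑-distrib-+ (λ i → sum (F i)) (λ i → sum (F i))) ⟩
    sum (λ i → sum (F i) + sum (F i))
      ≤⟨ sum-mono row≤ ⟩
    sum (λ i → B * ∣ a i ∣²)
      ≈⟨ sym (*-distribˡ-sum B (λ i → ∣ a i ∣²)) ⟩
    B * ‖ a ‖²
      ≈⟨ solve 4 (λ q n w s → (q :* n :* w) :* s := q :* n :* s :* w) refl (fromℕ Q) (fromℕ N + fromℕ Q) (fromℕ c * inv d) ‖ a ‖² ⟩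
    fromℕ Q * (fromℕ N + fromℕ Q) * ‖ a ‖² * (fromℕ c * inv d)
      ∎
    where
    open ≤-Reasoning

    F : Fin N → Fin N → ℝ
    F i j = when (congruent? t i (m ℤ.+ + toℕ j)) (fromℕ t * (∣ a i ∣² * inv 2))

    B : ℝ
    B = fromℕ Q * (fromℕ N + fromℕ Q) * (fromℕ c * inv d)

    count : Fin N → ℕ
    count i = length (filter (congruent? t i) (interval m N))

    count≤ : ∀ i → fromℕ (count i) ≤ fromℕ c * (fromℕ N + fromℕ Q) * inv d
    count≤ i = begin
      fromℕ (count i)                                    ≈⟨ trans (*-congʳ (inv-inverseʳ d)) (*-identityˡ _) ⟨
      fromℕ d * inv d * fromℕ (count i)                  ≈⟨ solve 3 (λ x y z → x :* y :* z := x :* z :* y) refl (fromℕ d) (inv d) (fromℕ (count i)) ⟩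
      fromℕ d * fromℕ (count i) * inv d                  ≈⟨ *-congʳ (fromℕ-* d (count i)) ⟨
      fromℕ (d ℕ.* count i) * inv d                      ≤⟨ *-monoʳ-≤ (inv-nonneg d) (fromℕ-mono-≤ (ℕP.≤-trans (solution-count {f} cov (value i) m N)
                                                              (ℕP.*-monoʳ-≤ c (ℕP.+-monoʳ-≤ N (ℕP.≤-trans d≤t t≤Q))))) ⟩
      fromℕ (c ℕ.* (N ℕ.+ Q)) * inv d                    ≈⟨ *-congʳ (trans (fromℕ-* c (N ℕ.+ Q)) (*-congˡ (fromℕ-+ N Q))) ⟩
      fromℕ c * (fromℕ N + fromℕ Q) * inv d              ∎

    row≤ : ∀ i → sum (F i) + sum (F i) ≤ B * ∣ a i ∣²
    row≤ i = begin
      sum (F i) + sum (F i)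
        ≈⟨ +-cong (sum-when (congruent? t i) m N _) (sum-when (congruent? t i) m N _) ⟩
      n * (fromℕ t * (s * inv 2)) + n * (fromℕ t * (s * inv 2))
        ≈⟨ trans (solve 4 (λ n t s h → n :* (t :* (s :* h)) :+ n :* (t :* (s :* h)) := t :* n :* (s :* h :+ s :* h)) refl n (fromℕ t) s (inv 2))
             (*-congˡ (half+half s)) ⟩
      fromℕ t * n * s
        ≤⟨ *-monoʳ-≤ (∣∣²-nonneg (a i)) (*-mono-≤ (fromℕ-nonneg (count i)) (fromℕ-nonneg Q) (fromℕ-mono-≤ t≤Q) (count≤ i)) ⟩
      fromℕ Q * (fromℕ c * (fromℕ N + fromℕ Q) * inv d) * s
        ≈⟨ *-congʳ (solve 4 (λ q c n i → q :* (c :* n :* i) := q :* n :* (c :* i)) refl (fromℕ Q) (fromℕ c) (fromℕ N + fromℕ Q) (inv d)) ⟩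
      B * s
        ∎
      where
      n = fromℕ (count i)
      s = ∣ a i ∣²

-- From the Farey sequence to sums over all fractions.

module FareySums {c ℓ₁ ℓ₂ : Level} (R : RealField c ℓ₁ ℓ₂) (E : ElementaryFunctions R) where
  open RealField R
  open OrderedField R
  open Complex R
  open ComplexNumbers R
  open ElementaryFunctions E
  open RangeSums commutativeRing
  open Characters R E
  open RoughSums R
  open MonoidSum (CommutativeRing.+-commutativeMonoid commutativeRing) using (sum-cong-≋)

  listSum : ∀ {A : Set} → (A → ℝ) → List A → ℝ
  listSum F xs = List.foldr _+_ 0# (List.map F xs)

  listSum-++ : ∀ {A : Set} (F : A → ℝ) xs ys → listSum F (xs List.++ ys) ≈ listSum F xs + listSum F ys
  listSum-++ F []       ys = sym (+-identityˡ _)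
  listSum-++ F (x ∷ xs) ys = trans (+-congˡ (listSum-++ F xs ys)) (sym (+-assoc _ _ _))

  listSum-nonneg : ∀ {A : Set} {F : A → ℝ} → (∀ x → 0# ≤ F x) → ∀ xs → 0# ≤ listSum F xs
  listSum-nonneg 0≤F []       = ≤-refl
  listSum-nonneg 0≤F (x ∷ xs) = +-nonneg (0≤F x) (listSum-nonneg 0≤F xs)

  listSum-concatMap : ∀ {A B : Set} (F : B → ℝ) (G : A → ℝ) (g : A → List B) → (∀ x → listSum F (g x) ≤ G x) →
                      ∀ xs → listSum F (List.concatMap g xs) ≤ listSum G xs
  listSum-concatMap F G g g≤G []       = ≤-refl
  listSum-concatMap F G g g≤G (x ∷ xs) = ≤-trans (≤-reflexive (listSum-++ F (g x) (List.concatMap g xs)))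
    (+-mono-≤ (g≤G x) (listSum-concatMap F G g g≤G xs))

  listSum-map-filter : ∀ {A B : Set} {p} {P : Pred A p} (P? : Decidable P) (F : B → ℝ) (G : A → ℝ) (r : A → B) →
                       (∀ x → F (r x) ≤ G x) → (∀ x → 0# ≤ G x) → ∀ xs → listSum F (List.map r (filter P? xs)) ≤ listSum G xs
  listSum-map-filter P? F G r F≤G 0≤G [] = ≤-refl
  listSum-map-filter P? F G r F≤G 0≤G (x ∷ xs) with P? x
  ... | yes _ = +-mono-≤ (F≤G x) (listSum-map-filter P? F G r F≤G 0≤G xs)
  ... | no _  = ≤-trans (≤-reflexive (sym (+-identityˡ _))) (+-mono-≤ (0≤G x) (listSum-map-filter P? F G r F≤G 0≤G xs))

  listSum-upTo-suc : ∀ F n → listSum F (List.upTo (suc n)) ≈ listSum F (List.upTo n) + F n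
  listSum-upTo-suc F n = trans (reflexive (cong (listSum F) (≡.sym (ListP.upTo-∷ʳ n))))
    (trans (listSum-++ F (List.upTo n) (n ∷ [])) (+-congˡ (+-identityʳ _)))

  listSum-upTo : ∀ F n → listSum F (List.upTo n) ≈ Σ< n F
  listSum-upTo F zero    = refl
  listSum-upTo F (suc n) = trans (listSum-upTo-suc F n) (trans (+-congʳ (listSum-upTo F n)) (sym (Σ<-snoc n F)))

  listSum-roughSum : ∀ A n → listSum (A ∘ suc) (List.upTo n) ≈ roughSum 2 A n
  listSum-roughSum A zero    = refl
  listSum-roughSum A (suc n) = trans (listSum-upTo-suc (A ∘ suc) n) (+-congʳ (listSum-roughSum A n))

  -- `p / q` is stored in lowest terms, so the comparison goes through the common factor `g` of the
  -- original numerator and denominator.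
  fromℚ-/ : ∀ p q .{{_ : NonZero q}} → fromℚ (+ p ℚ./ q) ≈ fromℕ p * inv q
  fromℚ-/ p q = fromℕ-cancelˡ q (begin
    fromℕ q * (fromℤ (ℚ.↥ x) * 1/ (ℚ.↧ₙ x))
      ≈⟨ *-congʳ q≈ ⟩
    fromℕ (ℚ.↧ₙ x) * g * (fromℤ (ℚ.↥ x) * 1/ (ℚ.↧ₙ x))
      ≈⟨ solve 4 (λ d g n i → d :* g :* (n :* i) := (d :* i) :* (n :* g)) refl (fromℕ (ℚ.↧ₙ x)) g (fromℤ (ℚ.↥ x)) (1/ (ℚ.↧ₙ x)) ⟩
    (fromℕ (ℚ.↧ₙ x) * 1/ (ℚ.↧ₙ x)) * (fromℤ (ℚ.↥ x) * g)
      ≈⟨ *-cong (1/-inverseʳ (ℚ.↧ₙ x)) (trans (sym (fromℤ-* (ℚ.↥ x) (ℤG.gcd (+ p) (+ q)))) (reflexive (cong fromℤ (ℚP.↥-/ (+ p) q)))) ⟩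
    1# * fromℕ p
      ≈⟨ *-congʳ (inv-inverseʳ q) ⟨
    fromℕ q * inv q * fromℕ p
      ≈⟨ solve 3 (λ q i p → q :* i :* p := q :* (p :* i)) refl (fromℕ q) (inv q) (fromℕ p) ⟩
    fromℕ q * (fromℕ p * inv q)
      ∎)
    where
    open import Relation.Binary.Reasoning.Setoid (CommutativeRing.setoid commutativeRing)
    x = + p ℚ./ q
    g = fromℤ (ℤG.gcd (+ p) (+ q))
    q≈ : fromℕ q ≈ fromℕ (ℚ.↧ₙ x) * g
    q≈ = trans (reflexive (cong fromℤ (≡.sym (ℚP.↧-/ (+ p) q)))) (fromℤ-* (ℚ.↧ x) (ℤG.gcd (+ p) (+ q)))

  fareySum≤ : ∀ {k N} (P : Vector ℤ (suc k)) m (a : Vector ℂ N) Q →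
              fareySum Q (λ x → ∣ exponentialSum P m a x ∣²) ≤
              roughSum 2 (FixedDenominator.denominatorSum R E (evalPoly P) m N a) Q
  fareySum≤ {N = N} P m a Q = ≤-trans
    (listSum-concatMap F (denominatorSum ∘ suc) _ (λ q-1 → ≤-trans
      (listSum-map-filter (λ p → gcd p (suc q-1) ℕP.≟ 1) F (λ p → ∣ expSum (fromℕ p * inv (suc q-1)) ∣²) (λ p → + p ℚ./ suc q-1)
        (λ p → ≤-reflexive (∣∣²-cong {exponentialSum P m a (+ p ℚ./ suc q-1)} {expSum (fromℕ p * inv (suc q-1))} (expSum≈ p (suc q-1))))
        (λ p → ∣∣²-nonneg (expSum (fromℕ p * inv (suc q-1))))
        (List.upTo (suc q-1)))
      (≤-reflexive (listSum-upTo (λ p → ∣ expSum (fromℕ p * inv (suc q-1)) ∣²) (suc q-1)))) (List.upTo Q))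
    (≤-reflexive (listSum-roughSum denominatorSum Q))
    where
    open FixedDenominator R E (evalPoly P) m N a

    F : ℚ → ℝ
    F x = ∣ exponentialSum P m a x ∣²

    expSum≈ : ∀ p q .{{_ : NonZero q}} → exponentialSum P m a (+ p ℚ./ q) ≈ℂ expSum (fromℕ p * inv q)
    expSum≈ p q = MonoidSum.sum-cong-≋ ℂR.+-commutativeMonoid {N} {λ j → a j *ℂ e (fromℚ (+ p ℚ./ q) * fromℤ (value j))} {λ j → a j *ℂ e (fromℕ p * inv q * fromℤ (value j))}
      (λ j → ℂR.*-congˡ {a j} {e (fromℚ (+ p ℚ./ q) * fromℤ (value j))} {e (fromℕ p * inv q * fromℤ (value j))} (e-cong (*-congʳ (fromℚ-/ p q))))

  fareySum-nonneg : ∀ Q {F} → (∀ x → 0# ≤ F x) → 0# ≤ fareySum Q F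
  fareySum-nonneg Q 0≤F = listSum-nonneg 0≤F (ℱ Q)

-- Integer logarithms compared with log Q, and the factors of the primes dividing c₀.

n≤n+1C2 : ∀ n → n ℕ.≤ suc n C 2
n≤n+1C2 n = ℕP.≤-trans (ℕP.m≤m+n n (n C 2))
  (ℕP.≤-reflexive (≡.trans (cong (ℕ._+ n C 2) (≡.sym (nC1≡n n))) (nCk+nC[k+1]≡[n+1]C[k+1] n 1)))

integer-log : ∀ p n → 2 ℕ.≤ p → 1 ℕ.≤ n → ∃[ s ] (p ℕ.^ s ℕ.≤ n × n ℕ.< p ℕ.^ suc s)
integer-log p (suc zero) 2≤p _ = 0 , ℕP.≤-refl , ℕP.≤-trans 2≤p (ℕP.≤-reflexive (≡.sym (ℕP.*-identityʳ p)))
integer-log p (suc n@(suc _)) 2≤p _ with integer-log p n 2≤p (s≤s z≤n)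
... | s , p^s≤n , n<p^s+1 with suc n ℕP.<? p ℕ.^ suc s
...   | yes n+1<p^s+1 = s , ℕP.m≤n⇒m≤1+n p^s≤n , n+1<p^s+1
...   | no n+1≮p^s+1  = suc s , ℕP.≮⇒≥ n+1≮p^s+1 , ℕP.≤-<-trans n<p^s+1
  (subst (ℕ._< p ℕ.^ suc (suc s)) (ℕP.*-identityˡ _) (ℕP.*-monoˡ-< (p ℕ.^ suc s) {{ℕP.m^n≢0 p (suc s) {{ℕ.>-nonZero (ℕP.<⇒≤ 2≤p)}}}} 2≤p))

module LogarithmicBounds {c ℓ₁ ℓ₂ : Level} (R : RealField c ℓ₁ ℓ₂) (E : ElementaryFunctions R)
  (Q : ℕ) .{{Q≢0 : NonZero Q}} (3≤Q : 3 ℕ.≤ Q) where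
  open RealField R
  open OrderedField R
  open ElementaryFunctions E
  open Logarithm R E
  open ℕ∣ using (_∣_)

  L : ℝ
  L = logℕ Q

  1≤L : 1# ≤ L
  1≤L = ≤-trans (≤-reflexive (sym fromℕ-1)) (3^n≤Q⇒n≤log 1 Q 3≤Q)

  0≤L : 0# ≤ L
  0≤L = ≤-trans 0≤1 1≤L

  4L : ℝ
  4L = fromℕ 4 * L

  -- With `n = s / 2`, the chain `3ⁿ ≤ 4ⁿ ≤ 2^s ≤ Q` gives `n ≤ L`, and
  -- `s + 1 ≤ 2 (n + 1) ≤ 2 (L + L)` because `1 ≤ L`.
  2^s≤Q⇒s+1≤4L : ∀ s → 2 ℕ.^ s ℕ.≤ Q → fromℕ (suc s) ≤ 4L
  2^s≤Q⇒s+1≤4L s 2^s≤Q = begin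
    fromℕ (suc s)                          ≤⟨ fromℕ-mono-≤ s+1≤ ⟩
    fromℕ (2 ℕ.* suc n)                    ≈⟨ fromℕ-* 2 (suc n) ⟩
    fromℕ 2 * (1# + fromℕ n)               ≤⟨ *-monoˡ-≤ (fromℕ-nonneg 2) (+-mono-≤ 1≤L (3^n≤Q⇒n≤log n Q 3^n≤Q)) ⟩
    fromℕ 2 * (L + L)                      ≈⟨ solve 2 (λ t l → t :* (l :+ l) := (t :+ t) :* l) refl (fromℕ 2) L ⟩
    (fromℕ 2 + fromℕ 2) * L                ≈⟨ *-congʳ (fromℕ-+ 2 2) ⟨
    4L                                     ∎
    where
    open ≤-Reasoning
    n = s / 2
    s≡ : s ≡ s % 2 ℕ.+ n ℕ.* 2
    s≡ = ℕD.m≡m%n+[m/n]*n s 2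
    s+1≤ : suc s ℕ.≤ 2 ℕ.* suc n
    s+1≤ = ℕP.≤-trans (s≤s (ℕP.≤-trans (ℕP.≤-reflexive s≡) (ℕP.+-monoˡ-≤ (n ℕ.* 2) (ℕ.s≤s⁻¹ (ℕD.m%n<n s 2)))))
      (ℕP.≤-reflexive (ℕP.*-comm (suc n) 2))
    3^n≤Q : 3 ℕ.^ n ℕ.≤ Q
    3^n≤Q = ℕP.≤-trans (ℕP.^-monoˡ-≤ n (ℕP.n≤1+n 3)) (ℕP.≤-trans (ℕP.≤-reflexive (ℕP.^-*-assoc 2 2 n))
      (ℕP.≤-trans (ℕP.^-monoʳ-≤ 2 (ℕP.≤-trans (ℕP.≤-reflexive (ℕP.*-comm 2 n)) (ℕD.m/n*n≤m s 2))) 2^s≤Q))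

  -- κ p = 4 for p < 9 and κ p = 1 otherwise: 1 + log_p Q ≤ log Q needs log p ≥ 2.
  κ : ℕ → ℝ
  κ p = fromℕ 4 ^ ((9 ∸ p) ∸ (9 ∸ suc p))

  1≤4 : 1# ≤ fromℕ 4
  1≤4 = 1≤fromℕ 4

  1≤κ : ∀ p → 1# ≤ κ p
  1≤κ p = 1≤^ ((9 ∸ p) ∸ (9 ∸ suc p)) 1≤4

  ℓ : ℕ → ℝ
  ℓ p = κ p * L

  0≤ℓ : ∀ p → 0# ≤ ℓ p
  0≤ℓ p = *-nonneg (≤-trans 0≤1 (1≤κ p)) 0≤L

  ℓ-bound : ∀ p → Prime p → p ℕ.≤ Q → ∃[ n ] (Q ℕ.< p ℕ.^ n × fromℕ n ≤ ℓ p)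
  ℓ-bound p p-prime p≤Q with integer-log p Q (ℕ.nonTrivial⇒n>1 p {{prime⇒nonTrivial p-prime}}) (ℕP.≤-trans (s≤s z≤n) 3≤Q)
  ... | zero  , _     , Q<p = ⊥-elim (ℕP.<⇒≱ (subst (Q ℕ.<_) (ℕP.*-identityʳ p) Q<p) p≤Q)
  ... | suc s , p^s≤Q , Q<p^s+1 = suc (suc s) , Q<p^s+1 , bound (p ℕP.<? 9)
    where
    bound : Dec (p ℕ.< 9) → fromℕ (2 ℕ.+ s) ≤ ℓ p
    bound (yes p<9) = ≤-trans (2^s≤Q⇒s+1≤4L (suc s) (ℕP.≤-trans (ℕP.^-monoˡ-≤ (suc s) (ℕ.nonTrivial⇒n>1 p {{prime⇒nonTrivial p-prime}})) p^s≤Q))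
      (≤-reflexive (*-congʳ (sym (trans (reflexive (cong (fromℕ 4 ^_) exponent)) (*-identityʳ _)))))
      where
      exponent : (9 ∸ p) ∸ (9 ∸ suc p) ≡ 1
      exponent = ≡.trans (cong (_∸ (9 ∸ suc p)) (ℕP.+-∸-assoc 1 (ℕ.s≤s⁻¹ p<9))) (ℕP.m+n∸n≡m 1 (8 ∸ p))
    bound (no p≮9) = ≤-trans (3^n≤Q⇒n≤log (2 ℕ.+ s) Q 3^≤Q) (≤-trans (≤-reflexive (sym (*-identityˡ L))) (*-monoʳ-≤ 0≤L (1≤κ p)))
      where
      -- Since `p ≤ Q` excludes the exponent zero, `p ^ suc s ≤ Q` with `2 + s ≤ 2 (1 + s)`. So
      -- `3² ≤ p` suffices, which is the origin of the threshold 9.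
      3^≤Q : 3 ℕ.^ (2 ℕ.+ s) ℕ.≤ Q
      3^≤Q = ℕP.≤-trans (ℕP.^-monoʳ-≤ 3 (s≤s (s≤s (ℕP.m≤n*m s 2))))
        (ℕP.≤-trans (ℕP.≤-reflexive (≡.trans (cong (3 ℕ.^_) (≡.sym (ℕP.*-distribˡ-+ 2 1 s))) (≡.sym (ℕP.^-*-assoc 3 2 (suc s)))))
        (ℕP.≤-trans (ℕP.^-monoˡ-≤ (suc s) (ℕP.≮⇒≥ p≮9)) p^s≤Q))

  module RamifiedFactors
    (f : ℤ → ℤ) (a : ℤ) (k : ℕ) (f-polynomial : PolynomialCongruences.PolynomialFunction (suc k) a f)
    (A : ℕ → ℝ) (Z : ℝ) (a≢0 : a ≢ 0ℤ) where
    open DenominatorSum R f a k f-polynomial A Z Q ℓ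

    primesBelow : ℕ → ℕ
    primesBelow n = length (filter ramified? (upTo n))

    primesBelow-suc : ∀ n → primesBelow (suc n) ≡ primesBelow n ℕ.+ length (filter ramified? (n ∷ []))
    primesBelow-suc n = ≡.trans (cong (length ∘ filter ramified?) (≡.sym (ListP.upTo-∷ʳ n)))
      (≡.trans (cong length (ListP.filter-++ ramified? (upTo n) (n ∷ []))) (ListP.length-++ (filter ramified? (upTo n))))

    -- `ω` searches up to `|a|`, and a nonzero `a` has no divisor beyond that.
    primesBelow≤ω : ∀ n → primesBelow n ℕ.≤ ω ∣ a ∣
    primesBelow≤ω n with ℕP.≤-total n (suc ∣ a ∣)
    ... | inj₁ n≤ = mono (ℕP.≤⇒≤′ n≤)
      where
      mono : ∀ {m n} → m ℕ.≤′ n → primesBelow m ℕ.≤ primesBelow n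
      mono ℕ.≤′-refl = ℕP.≤-refl
      mono {n = suc n} (ℕ.≤′-step m≤n) = ℕP.≤-trans (mono m≤n) (ℕP.≤-trans (ℕP.m≤m+n _ _) (ℕP.≤-reflexive (≡.sym (primesBelow-suc n))))
    ... | inj₂ a<n = ℕP.≤-reflexive (constant (ℕP.≤⇒≤′ a<n))
      where
      constant : ∀ {n} → suc ∣ a ∣ ℕ.≤′ n → primesBelow n ≡ primesBelow (suc ∣ a ∣)
      constant ℕ.≤′-refl = ≡.refl
      constant {suc n} (ℕ.≤′-step a<n) = ≡.trans (primesBelow-suc n)
        (≡.trans (cong (λ l → primesBelow n ℕ.+ length l) (ListP.filter-reject ramified? {x = n} {xs = []} unramified))
          (≡.trans (ℕP.+-identityʳ _) (constant a<n)))
        where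
        instance ∣a∣≢0 = ℕ.≢-nonZero (a≢0 ∘ ℤP.∣i∣≡0⇒i≡0)
        unramified : ¬ (Prime n × n ∣ ∣ a ∣)
        unramified (_ , n∣a) = ℕ∣.>⇒∤ (ℕP.≤′⇒≤ a<n) n∣a

    factor-step : ∀ p → L ^ primesBelow p * factor p ≤ κ p * L ^ primesBelow (suc p)
    factor-step p = ≤-trans (step (ramified? p)) (≤-reflexive (*-congˡ (reflexive (cong (L ^_) (≡.sym (primesBelow-suc p))))))
      where
      step : Dec (Prime p × p ∣ ∣ a ∣) → L ^ primesBelow p * factor p ≤ κ p * L ^ (primesBelow p ℕ.+ length (filter ramified? (p ∷ [])))
      step (yes ramified@(p-prime , p∣a)) = ≤-reflexive (trans (*-congˡ (factor-ramified p-prime p∣a))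
        (trans (solve 3 (λ x k l → x :* (k :* l) := k :* (x :* (l :* con 1ℤ))) refl (L ^ primesBelow p) (κ p) L)
        (*-congˡ (trans (sym (^-homo-* L (primesBelow p) 1))
          (reflexive (cong (λ l → L ^ (primesBelow p ℕ.+ length l)) (≡.sym (ListP.filter-accept ramified? {x = p} {xs = []} ramified))))))))
      step (no unramified) = ≤-trans (≤-reflexive (trans (*-congˡ (factor-unramified unramified)) (trans (*-comm _ _)
          (*-congˡ (reflexive (cong (L ^_) (≡.trans (≡.sym (ℕP.+-identityʳ _))
            (cong (λ l → primesBelow p ℕ.+ length l) (≡.sym (ListP.filter-reject ramified? {x = p} {xs = []} unramified))))))))))
        (*-monoʳ-≤ (^-nonneg (primesBelow p ℕ.+ length (filter ramified? (p ∷ []))) 0≤L) (1≤κ p))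

    -- The exponents in `κ` are successive differences of `9 ∸ p`, so the powers of 4 telescope. The
    -- powers of `L` grow exactly at the primes dividing `a`.
    factors-bound : ∀ n p → L ^ primesBelow p * factors p n ≤ fromℕ 4 ^ (9 ∸ p) * L ^ primesBelow (p ℕ.+ n)
    factors-bound zero p = ≤-trans (≤-reflexive (trans (*-identityʳ _) (trans (reflexive (cong (λ n → L ^ primesBelow n) (≡.sym (ℕP.+-identityʳ p)))) (sym (*-identityˡ _)))))
      (*-monoʳ-≤ (^-nonneg (primesBelow (p ℕ.+ 0)) 0≤L) (1≤^ (9 ∸ p) 1≤4))
    factors-bound (suc n) p = begin
      L ^ primesBelow p * (factor p * factors (suc p) n)
        ≈⟨ *-assoc _ _ _ ⟨
      L ^ primesBelow p * factor p * factors (suc p) n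
        ≤⟨ *-monoʳ-≤ (factors-nonneg 0≤ℓ (suc p) n) (factor-step p) ⟩
      κ p * L ^ primesBelow (suc p) * factors (suc p) n
        ≈⟨ *-assoc _ _ _ ⟩
      κ p * (L ^ primesBelow (suc p) * factors (suc p) n)
        ≤⟨ *-monoˡ-≤ (≤-trans 0≤1 (1≤κ p)) (factors-bound n (suc p)) ⟩
      κ p * (fromℕ 4 ^ (9 ∸ suc p) * L ^ primesBelow (suc p ℕ.+ n))
        ≈⟨ *-assoc _ _ _ ⟨
      κ p * fromℕ 4 ^ (9 ∸ suc p) * L ^ primesBelow (suc p ℕ.+ n)
        ≈⟨ *-cong (trans (sym (^-homo-* (fromℕ 4) ((9 ∸ p) ∸ (9 ∸ suc p)) (9 ∸ suc p))) (reflexive (cong (fromℕ 4 ^_) (ℕP.m∸n+n≡m (ℕP.∸-monoʳ-≤ 9 (ℕP.n≤1+n p))))))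
                  (reflexive (cong (λ n → L ^ primesBelow n) (≡.sym (ℕP.+-suc p n)))) ⟩
      fromℕ 4 ^ (9 ∸ p) * L ^ primesBelow (p ℕ.+ suc n)
        ∎
      where
      open ≤-Reasoning

    factors≤ : ∀ n → factors 2 n ≤ fromℕ 4 ^ 7 * L ^ ω ∣ a ∣
    factors≤ n = begin
      factors 2 n                          ≈⟨ *-identityˡ _ ⟨
      -- There is no prime below 2, so `L ^ primesBelow 2` computes to `1#`; the exponent 7 is
      -- `9 ∸ 2`.
      1# * factors 2 n                     ≤⟨ factors-bound n 2 ⟩
      fromℕ 4 ^ 7 * L ^ primesBelow (2 ℕ.+ n)  ≤⟨ *-monoˡ-≤ (^-nonneg 7 (fromℕ-nonneg 4)) (^-monoʳ-≤ 1≤L (primesBelow≤ω (2 ℕ.+ n))) ⟩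
      fromℕ 4 ^ 7 * L ^ ω ∣ a ∣            ∎
      where open ≤-Reasoning

theorem1 : {c ℓ₁ ℓ₂ : Level} (R : RealField c ℓ₁ ℓ₂) (E : ElementaryFunctions R) →
    let open RealField R
        open Complex R
        open ElementaryFunctions E
    in (k : ℕ) .{{_ : NonZero k}} →
       ∃[ K ] (0# < K ×
         -- For Q = 1 (log Q = 0) and Q = 2 (log Q < 1, ω(c₀) unbounded) the inequality fails.
         ((Q : ℕ) .{{_ : NonZero Q}} → 3 ℕ.≤ Q →
          (m : ℤ) (N : ℕ) (P : Vector ℤ (suc k)) → head P ≢ 0ℤ →
          (a : Vector ℂ N) →
          ∣ fareySum Q (λ x → ∣ exponentialSum P m a x ∣²) ∣≤
            K * (fromℕ Q * (fromℕ N + fromℕ Q) * logℕ Q ^ (ω ∣ head P ∣ ℕ.+ θ k) * ‖ a ‖²)))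
theorem1 R E zero {{()}}
theorem1 R E (suc k) = K₀ , 0<K₀ , λ Q 3≤Q m N P lead≢0 a → bound Q 3≤Q m N P lead≢0 a
  where
  open RealField R
  open OrderedField R
  open Complex R
  open ComplexNumbers R using (∣∣²-nonneg)
  open ElementaryFunctions E
  open RoughSums R
  open PolynomialCongruences using (evalPoly-polynomialFunction; covered-1)

  K : ℕ
  K = suc k ℕ.* suc k

  -- `4 ^ 7` comes from the constants `κ` at the integers 2 to 8, and `4 ^ K` from bounding the
  -- harmonic sum by `4L` before taking its `K`-th power.
  K₀ : ℝ
  K₀ = fromℕ 4 ^ 7 * fromℕ 4 ^ K

  0<4^ : ∀ n → 0# < fromℕ 4 ^ n
  0<4^ zero    = 0<1
  0<4^ (suc n) = *-pos (fromℕ-pos 4) (0<4^ n)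

  0<K₀ : 0# < K₀
  0<K₀ = *-pos (0<4^ 7) (0<4^ K)

  bound : ∀ Q .{{_ : NonZero Q}} → 3 ℕ.≤ Q → ∀ m N (P : Vector ℤ (suc (suc k))) → head P ≢ 0ℤ → (a : Vector ℂ N) →
          ∣ fareySum Q (λ x → ∣ exponentialSum P m a x ∣²) ∣≤
            K₀ * (fromℕ Q * (fromℕ N + fromℕ Q) * logℕ Q ^ (ω ∣ head P ∣ ℕ.+ θ (suc k)) * ‖ a ‖²)
  bound Q@(suc Q-1) 3≤Q m N P lead≢0 a = farey≤B , ≤-trans (≤-trans (neg-mono-≤ 0≤farey) (≤-reflexive -0#≈0#)) (≤-trans 0≤farey farey≤B)
    where
    open LogarithmicBounds R E Q 3≤Q
    open FixedDenominator R E (evalPoly P) m N a using (denominatorSum; denominatorSum-bound)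
    open FareySums R E

    Z : ℝ
    Z = fromℕ Q * (fromℕ N + fromℕ Q) * ‖ a ‖²

    f-polynomial = evalPoly-polynomialFunction (suc k) P

    open DenominatorSum R (evalPoly P) (head P) k f-polynomial denominatorSum Z Q ℓ using (factors; roughSum-bound; Admissible)
    open RamifiedFactors (evalPoly P) (head P) k f-polynomial denominatorSum Z lead≢0 using (factors≤)

    0≤Z : 0# ≤ Z
    0≤Z = *-nonneg (*-nonneg (fromℕ-nonneg Q) (+-nonneg (fromℕ-nonneg N) (fromℕ-nonneg Q))) (sum-nonneg (λ i → ∣∣²-nonneg (a i)))

    0≤farey : 0# ≤ fareySum Q (λ x → ∣ exponentialSum P m a x ∣²)
    0≤farey = fareySum-nonneg Q (λ x → ∣∣²-nonneg (exponentialSum P m a x))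

    trivial : Admissible 2 1 1 1
    trivial = record { t≢0 = _ ; d≢0 = _ ; d≤t = ℕP.≤-refl ; covered = covered-1 (evalPoly P)
                     ; coprime = λ p p-prime _ p∣1 → ¬prime[1] (subst Prime (ℕ∣.∣1⇒≡1 p∣1) p-prime) }

    H : ℝ
    H = harmonic 2 Q

    H≤4L : H ≤ 4L
    H≤4L with integer-log 2 Q ℕP.≤-refl (s≤s z≤n)
    ... | s , 2^s≤Q , Q<2^s+1 = ≤-trans (harmonic-dyadic (suc s) Q Q<2^s+1) (2^s≤Q⇒s+1≤4L s 2^s≤Q)

    K≤θ : K ℕ.≤ θ (suc k)
    K≤θ = ℕP.*-monoʳ-≤ (suc k) (n≤n+1C2 (suc k))

    ωL = ω ∣ head P ∣

    farey≤B : fareySum Q (λ x → ∣ exponentialSum P m a x ∣²) ≤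
              K₀ * (fromℕ Q * (fromℕ N + fromℕ Q) * L ^ (ωL ℕ.+ θ (suc k)) * ‖ a ‖²)
    farey≤B = begin
      fareySum Q (λ x → ∣ exponentialSum P m a x ∣²)
        ≤⟨ fareySum≤ P m a Q ⟩
      roughSum 2 denominatorSum Q
        ≈⟨ roughSum-cong 2 Q (λ q → reflexive (cong denominatorSum (≡.sym (ℕP.*-identityˡ q)))) ⟩
      roughSum 2 (λ q → denominatorSum (1 ℕ.* q)) Q
        ≤⟨ roughSum-bound 0≤Z 0≤ℓ ℓ-bound (denominatorSum-bound Q) Q-1 2 ℕP.≤-refl ≡.refl 1 1 1 Q trivial (ℕP.≤-reflexive (ℕP.*-identityˡ Q)) ⟩
      Z * (fromℕ 1 * inv 1) * (factors 2 Q-1 * H ^ K)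
        ≈⟨ *-congʳ (trans (*-congˡ (inv-inverseʳ 1)) (*-identityʳ Z)) ⟩
      Z * (factors 2 Q-1 * H ^ K)
        ≤⟨ *-monoˡ-≤ 0≤Z (*-mono-≤ (^-nonneg K (harmonic-nonneg 2 Q))
             (*-nonneg (<⇒≤ (0<4^ 7)) (^-nonneg ωL 0≤L)) (factors≤ Q-1) (^-monoˡ-≤ K (harmonic-nonneg 2 Q) H≤4L)) ⟩
      Z * ((fromℕ 4 ^ 7 * L ^ ωL) * 4L ^ K)
        ≈⟨ *-congˡ (*-congˡ (^-distrib-* (fromℕ 4) L K)) ⟩
      Z * ((fromℕ 4 ^ 7 * L ^ ωL) * (fromℕ 4 ^ K * L ^ K))
        ≤⟨ *-monoˡ-≤ 0≤Z (*-monoˡ-≤ (*-nonneg (<⇒≤ (0<4^ 7)) (^-nonneg ωL 0≤L)) (*-monoˡ-≤ (<⇒≤ (0<4^ K)) (^-monoʳ-≤ 1≤L K≤θ))) ⟩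
      Z * ((fromℕ 4 ^ 7 * L ^ ωL) * (fromℕ 4 ^ K * L ^ θ (suc k)))
        ≈⟨ solve 6 (λ q s x y z w → (q :* s) :* ((x :* y) :* (z :* w)) := (x :* z) :* (q :* (y :* w) :* s)) refl
             (fromℕ Q * (fromℕ N + fromℕ Q)) ‖ a ‖² (fromℕ 4 ^ 7) (L ^ ωL) (fromℕ 4 ^ K) (L ^ θ (suc k)) ⟩
      K₀ * (fromℕ Q * (fromℕ N + fromℕ Q) * (L ^ ωL * L ^ θ (suc k)) * ‖ a ‖²)
        ≈⟨ *-congˡ (*-congʳ (*-congˡ (sym (^-homo-* L ωL (θ (suc k)))))) ⟩
      K₀ * (fromℕ Q * (fromℕ N + fromℕ Q) * L ^ (ωL ℕ.+ θ (suc k)) * ‖ a ‖²)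
        ∎
      where open ≤-Reasoning
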